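{- Let $r\geq 4$ and let $\mathcal{H}$ be an $r$-graph on $s$ vertices that is embeddable in a $2$-reducible $r$-tree. Let $\sigma=\sigma(\mathcal{H})$, suppose $\sigma\geq 2$, and define $\beta:=1/((r-2)(\sigma+1)+1)$. There is $n(r,s)$, depending only on $r$ and $s$, such that the following holds for all $n\geq n(r,s)$ and every $K\geq 0$. If $\mathcal{F}\subseteq\binom{[n]}{r}$ does not contain $\mathcal{H}$ and $$|\mathcal{F}|\geq(\sigma-1)\binom{n}{r-1}-Kn^{r-1-\beta},$$ then there exists a set $A\subseteq[n]$ of $\sigma-1$ vertices such that $$|\mathcal{L}_{\mathcal{F}}(A)|\geq\binom{n}{r-1}-(r-1)(K+2s^2)n^{r-1-\beta},$$ and all but at most $\left((\sigma-1)(r-1)(K+2s^2)+2s^2\right)n^{r-1-\beta}$ members of $\mathcal{F}$ meet $A$ in exactly one element.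
   Context: An $r$-graph is an $r$-uniform hypergraph. An $r$-tree is an $r$-uniform hypergraph whose edges can be ordered $E_1,\dots,E_m$ so that for each $i>1$ there is $\alpha(i)<i$ with $E_i\cap\bigcup_{j<i}E_j\subseteq E_{\alpha(i)}$. It is $2$-reducible if each edge contains at least $2$ vertices of degree $1$. $\mathcal{H}$ is embeddable in $\mathcal{T}$ if it is isomorphic to a subgraph of $\mathcal{T}$. A cross-cut of $\mathcal{H}$ is a vertex set containing exactly one vertex of each edge; $\sigma(\mathcal{H})$ is the minimum size of a cross-cut. For $A\subseteq[n]$, the common link graph is $\mathcal{L}_{\mathcal{F}}(A)=\{D\subseteq[n]\setminus A:\ D\cup\{a\}\in\mathcal{F}\text{ for all }a\in A\}$.
   Formalization: The constant K ≥ 0 ranges over rational numbers instead of real numbers; inequalities involving n^{r-1-β} are stated in the equivalent form obtained by raising both sides to the power (r-2)(σ+1)+1. -}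

module Defs where

open import Data.Nat as ℕ using (ℕ; zero; suc; _∸_)
open import Data.Bool using (Bool; true; false)
import Data.Bool.Properties as BoolP
open import Data.Fin using (Fin; toℕ)
open import Data.Fin.Properties using (any?; all?) renaming (_≟_ to _≟ᶠ_)
open import Data.Fin.Subset using (Subset; _∈_; _∉_; _∩_; _∪_; ⁅_⁆; ∣_∣; _⊆_; ⋃; inside; outside)
open import Data.Fin.Subset.Properties using (_∈?_)
open import Data.Vec using (Vec; []; _∷_; tabulate)
import Data.Vec.Properties as VecP
open import Data.List using (List; []; _∷_; length; filter; map; _++_; take; lookup; allFin)
open import Data.List.Relation.Unary.All using (All)
open import Data.List.Relation.Unary.Unique.Propositional using (Unique)
open import Data.List.Relation.Binary.Permutation.Propositional using (_↭_)
open import Data.Product using (Σ; ∃; ∃-syntax; _×_; _,_)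
open import Data.Sum using (_⊎_)
open import Data.Integer using (+_)
open import Data.Rational using (ℚ; _/_; 1ℚ; 0ℚ; _≤_; _*_)
open import Function.Definitions using (Injective)
open import Relation.Binary.PropositionalEquality using (_≡_)
open import Relation.Binary.Definitions using (DecidableEquality)
open import Relation.Nullary using (Dec; ¬_; ¬?)
open import Relation.Nullary.Decidable using (_×-dec_; _→-dec_; ⌊_⌋)

-- Hypergraphs.  A hypergraph on the vertex set [n] = Fin n is given by
-- its list of edges (each edge a subset of Fin n).  Edges are distinct.

_≟ˢ_ : ∀ {n} → DecidableEquality (Subset n)
_≟ˢ_ = VecP.≡-dec BoolP._≟_

import Data.List.Membership.DecPropositional as DecMem

module _ {n : ℕ} where
  open DecMem (_≟ˢ_ {n}) public using () renaming (_∈_ to _∈ᴱ_; _∈?_ to _∈ᴱ?_)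

IsRGraph : ∀ {n} → ℕ → List (Subset n) → Set
IsRGraph r E = Unique E × All (λ e → ∣ e ∣ ≡ r) E

degree : ∀ {n} → List (Subset n) → Fin n → ℕ
degree E v = length (filter (λ e → v ∈? e) E)

TreeOrdered : ∀ {n} → List (Subset n) → Set
TreeOrdered L =
  ∀ (i : Fin (length L)) → 0 ℕ.< toℕ i →
    ∃[ j ] (toℕ j ℕ.< toℕ i × ((lookup L i ∩ ⋃ (take (toℕ i) L)) ⊆ lookup L j))

IsRTree : ∀ {n} → ℕ → List (Subset n) → Set
IsRTree r T = IsRGraph r T × ∃[ L ] (L ↭ T × TreeOrdered L)

degOneCount : ∀ {n} → List (Subset n) → Subset n → ℕ
degOneCount {n} E e = length (filter (λ v → (v ∈? e) ×-dec (degree E v ℕ.≟ 1)) (allFin n))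

TwoReducible : ∀ {n} → List (Subset n) → Set
TwoReducible E = All (λ e → 2 ℕ.≤ degOneCount E e) E

image : ∀ {s t} → (Fin s → Fin t) → Subset s → Subset t
image f e = tabulate (λ w → ⌊ any? (λ v → (v ∈? e) ×-dec (f v ≟ᶠ w)) ⌋)

Embeds : ∀ {s t} → List (Subset s) → List (Subset t) → Set
Embeds {s} {t} H G = ∃[ f ] (Injective _≡_ _≡_ f × All (λ e → image f e ∈ᴱ G) H)

IsCrossCut : ∀ {s} → List (Subset s) → Subset s → Set
IsCrossCut H X = All (λ e → ∣ X ∩ e ∣ ≡ 1) H

IsCrossCutNumber : ∀ {s} → List (Subset s) → ℕ → Set
IsCrossCutNumber H σ =
  (∃[ X ] (IsCrossCut H X × ∣ X ∣ ≡ σ)) × (∀ X → IsCrossCut H X → σ ℕ.≤ ∣ X ∣)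

allSubsets : ∀ n → List (Subset n)
allSubsets zero = [] ∷ []
allSubsets (suc n) = map (outside ∷_) (allSubsets n) ++ map (inside ∷_) (allSubsets n)

InLink : ∀ {n} → List (Subset n) → Subset n → Subset n → Set
InLink F A D = ∀ a → a ∈ A → (a ∉ D × (D ∪ ⁅ a ⁆) ∈ᴱ F)

inLink? : ∀ {n} (F : List (Subset n)) (A D : Subset n) → Dec (InLink F A D)
inLink? F A D = all? (λ a → (a ∈? A) →-dec (¬? (a ∈? D) ×-dec ((D ∪ ⁅ a ⁆) ∈ᴱ? F)))

linkSize : ∀ {n} → List (Subset n) → Subset n → ℕ
linkSize {n} F A = length (filter (inLink? F A) (allSubsets n))

badCount : ∀ {n} → List (Subset n) → Subset n → ℕ
badCount F A = length (filter (λ e → ¬? (∣ A ∩ e ∣ ℕ.≟ 1)) F)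

ℕtoℚ : ℕ → ℚ
ℕtoℚ k = + k / 1

_^ᵠ_ : ℚ → ℕ → ℚ
x ^ᵠ zero = 1ℚ
x ^ᵠ suc k = x * (x ^ᵠ k)

-- LeRootPow x c n a m  expresses the real inequality  x ≤ c · n^(a/m)
-- (for c ≥ 0, m ≥ 1): either x ≤ 0, or x > 0 and x^m ≤ c^m · n^a.
LeRootPow : ℚ → ℚ → ℕ → ℕ → ℕ → Set
LeRootPow x c n a m = x ≤ 0ℚ ⊎ ((x ^ᵠ m) ≤ ((c ^ᵠ m) * ℕtoℚ (n ℕ.^ a)))

βden : ℕ → ℕ → ℕ
βden r σ = (r ∸ 2) ℕ.* (σ ℕ.+ 1) ℕ.+ 1

-- r - 1 - β = ((r-1)·m - 1) / m
expNum : ℕ → ℕ → ℕ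
expNum r σ = (r ∸ 1) ℕ.* βden r σ ∸ 1

{-# OPTIONS --safe #-}
-- Write k = r - 1 (below, r = 3 + ρ and σ = 2 + τ).  Call a k-set high if it lies in more than s edges of F, and low otherwise.
--
-- Embedding: a family of k-sets (or of j-sets, j ≥ r - 2) with more than s members per set of its shadow
-- has a subfamily of large minimum degree, into which a tree can be mapped greedily, one vertex at a time;
-- only the vertices of H have to stay distinct, so the size of the tree plays no role.  Since H lies in
-- a 2-reducible tree, trimming one or two private vertices from each edge, and a cross-cut, shows that an
-- H-free F has O(n^(k-1)) high k-sets, O(n^(k-2)) expandable (k-1)-sets (whose link graph has no
-- cover of size s), and, for every σ-set S, O(n^(k-2)) sets P of size k - 1 with all P ∪ {w}, w ∈ S, high.
--
-- Consequently all but O(n^(k-1)) edges E have exactly one low k-subset D = E ∖ {w}.  Sorting the sets that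
-- contain the center w by how many extensions they have to high sets, with ratio n / b from one size to the next,
-- confines the centers to a set W of O(b^(k-1)) vertices at the cost of O(n^k / b) further edges.  Apart
-- from O(|W|^σ n^(k-1)) exceptions, a low set D then has at most σ - 1 centers, so |F| ≤ (σ - 1) C(n, k) + error;
-- and if D has σ - 1 centers, they are also the neighbours in W of every D ∖ {x}.  So the sets D
-- fall into classes with disjoint shadows, and a Kruskal–Katona type bound makes one class as large as claimed.
-- With b proportional to q, where n ≤ q^m < 2^m n and m = (r - 2)(σ + 1) + 1, all errors are at most n^k / q.
module Submission where

open import Defs
open import Level using (0ℓ)
open import Data.Nat using (ℕ; zero; suc; _≤_; _<_; _∸_; _*_; _+_; _^_; _!; _⊓_; z≤n; s≤s; _≤?_; _<?_; NonZero; >-nonZero; _≟_)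
open import Data.Nat.Properties hiding (_≟_)
open import Data.Nat.DivMod using (_/_; m/n*n≤m; m≡m%n+[m/n]*n; m%n<n)
open import Data.Nat.Combinatorics using (_C_; k>n⇒nCk≡0; nCk+nC[k+1]≡[n+1]C[k+1])
open import Data.Nat.Solver using (module +-*-Solver)
open import Data.Bool using (Bool; true; false)
open import Data.Fin using (Fin; zero; suc; toℕ; fromℕ<)
open import Data.Fin.Properties using (any?; all?; toℕ-fromℕ<; toℕ-injective; toℕ<n) renaming (_≟_ to _≟ᶠ_; suc-injective to suc-injectiveᶠ)
open import Data.Fin.Subset using (Subset; ∣_∣; _∈_; _∉_; _⊆_; _∩_; _∪_; ⁅_⁆; ⊥; ⊤; ⋃; inside; outside)
open import Data.Fin.Subset.Properties using (_∈?_; _⊆?_; ∉⊥; ∈⊤; ∣⊥∣≡0; ∣⊤∣≡n; ∣p∣≤n; p⊆q⇒∣p∣≤∣q∣; p⊂q⇒∣p∣<∣q∣; ⊆-antisym; anySubset?; x∈p∩q⁺; x∈p∩q⁻; x∈p∪q⁺; ∪-identityʳ; nonempty?; Empty-unique; ∩-comm; x∈⁅x⁆; x∈⁅y⁆⇒x≡y; ∣⁅x⁆∣≡1)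
open import Data.Vec using ([]; _∷_; here; there; _[_]≔_; tabulate)
import Data.Vec.Properties as Vecₚ
open import Data.List using (List; []; _∷_; length; filter; map; _++_; allFin; lookup; take)
import Data.List.Properties as Listₚ
open import Data.List.Relation.Unary.Any as Any using (Any; here; there)
open import Data.List.Relation.Unary.All as All using (All; []; _∷_)
open import Data.List.Relation.Unary.AllPairs using ([]; _∷_)
open import Data.List.Relation.Unary.Unique.Propositional using (Unique)
import Data.List.Membership.Propositional as List∈
open import Data.List.Membership.Propositional.Properties using (∈-allFin; ∈-++⁺ˡ; ∈-++⁺ʳ; ∈-map⁺; ∈-filter⁺; ∈-lookup)
open import Data.Product using (∃-syntax; _×_; _,_; proj₁; proj₂)
open import Data.Sum using (_⊎_; inj₁; inj₂; [_,_]′)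
open import Function using (_∘_; id; case_of_)
open import Relation.Binary.PropositionalEquality using (_≡_; _≢_; refl; sym; trans; cong; cong₂; subst; subst₂; module ≡-Reasoning)
open import Relation.Nullary using (Dec; yes; no; does; ¬_; ¬?; contradiction)
open import Relation.Nullary.Decidable using (_×-dec_; _⊎-dec_; _→-dec_; isYes≗does)
open import Relation.Unary using (Decidable; Pred)
open import Data.List.Relation.Binary.Permutation.Propositional using (↭-sym)
open import Data.List.Relation.Binary.Permutation.Propositional.Properties using (∈-resp-↭)
open import Data.List.Relation.Unary.Any.Properties using (lookup-index)
open import Data.Rational as ℚ using (ℚ; 0ℚ; 1ℚ) renaming (_≤_ to _≤ᵠ_; _<_ to _<ᵠ_; _+_ to _+ᵠ_; _-_ to _-ᵠ_; _*_ to _*ᵠ_)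
import Data.Rational.Properties as ℚₚ
open import Data.Rational.Solver using () renaming (module +-*-Solver to ℚ-Solver)
import Data.Rational.Unnormalised as ℚᵘ
import Data.Rational.Unnormalised.Properties as ℚᵘₚ
import Data.Integer as ℤ
import Data.Integer.Properties as ℤₚ

-- Indicators and finite sums

-- The bound on common links holds for one fixed set S of σ vertices. Summed over all σ-sets of
-- vertices it would cost a factor n^σ, more than the main term itself; this obstacle is the reason
-- for confining the centers to a small set. The two costs pull b in opposite directions: n^k / b
-- for the edges given up, and about b^((k-1)σ) n^(k-1) for the exceptional low sets. With b of
-- order q both stay below n^k / q as soon as q^((r-2)σ+1) is at most a small constant times n, and
-- the r - 2 further factors of q in q^m absorb that constant; this is the origin of β = 1/m. The
-- threshold s for degrees and covers comes from the s vertices of H, whose current images a new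
-- vertex has to avoid. The factor r - 1 in the conclusion is a slope: if a fraction 1 - δ of all
-- k-sets have σ - 1 centers, the shadow inequality yields a class containing about a fraction (1 -
-- δ)^k ≥ 1 - kδ of all k-sets.

bit : Bool → ℕ
bit true  = 1
bit false = 0

⟦_⟧ : {P : Set} → Dec P → ℕ
⟦ d ⟧ = bit (does d)

private variable
  α β : Set
  Φ Ψ : Set

⟦⟧≤1 : (d : Dec Φ) → ⟦ d ⟧ ≤ 1
⟦⟧≤1 (yes _) = ≤-refl
⟦⟧≤1 (no _)  = z≤n

1≤⟦⟧ : (d : Dec Φ) → Φ → 1 ≤ ⟦ d ⟧
1≤⟦⟧ (yes _) _ = ≤-refl
1≤⟦⟧ (no ¬p) p = contradiction p ¬p

⟦⟧≡1 : (d : Dec Φ) → Φ → ⟦ d ⟧ ≡ 1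
⟦⟧≡1 d p = ≤-antisym (⟦⟧≤1 d) (1≤⟦⟧ d p)

⟦⟧≡0 : (d : Dec Φ) → ¬ Φ → ⟦ d ⟧ ≡ 0
⟦⟧≡0 (yes p) ¬p = contradiction p ¬p
⟦⟧≡0 (no _)  _  = refl

⟦⟧*≤ : (d : Dec Φ) {x y : ℕ} → (Φ → x ≤ y) → ⟦ d ⟧ * x ≤ y
⟦⟧*≤ (yes p) {x} h = ≤-trans (≤-reflexive (+-identityʳ x)) (h p)
⟦⟧*≤ (no _)  h = z≤n

⟦⟧≤ : (d : Dec Φ) {y : ℕ} → (Φ → 1 ≤ y) → ⟦ d ⟧ ≤ y
⟦⟧≤ (yes p) h = h p
⟦⟧≤ (no _)  h = z≤n

⟦⟧-mono : (d : Dec Φ) (e : Dec Ψ) → (Φ → Ψ) → ⟦ d ⟧ ≤ ⟦ e ⟧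
⟦⟧-mono d e f = ⟦⟧≤ d (1≤⟦⟧ e ∘ f)

⟦⟧-cong : (d : Dec Φ) (e : Dec Ψ) → (Φ → Ψ) → (Ψ → Φ) → ⟦ d ⟧ ≡ ⟦ e ⟧
⟦⟧-cong d e f g = ≤-antisym (⟦⟧-mono d e f) (⟦⟧-mono e d g)

⟦⟧-× : (d : Dec Φ) (e : Dec Ψ) → ⟦ d ×-dec e ⟧ ≡ ⟦ d ⟧ * ⟦ e ⟧
⟦⟧-× (yes _) (yes _) = refl
⟦⟧-× (yes _) (no _)  = refl
⟦⟧-× (no _)  _       = refl

1≤* : ∀ {x y} → 1 ≤ x → 1 ≤ y → 1 ≤ x * y
1≤* = *-mono-≤

∑ : List α → (α → ℕ) → ℕ
∑ []       f = 0
∑ (x ∷ xs) f = f x + ∑ xs f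

∑-mono : (xs : List α) {f g : α → ℕ} → (∀ x → f x ≤ g x) → ∑ xs f ≤ ∑ xs g
∑-mono []       h = z≤n
∑-mono (x ∷ xs) h = +-mono-≤ (h x) (∑-mono xs h)

∑-cong : (xs : List α) {f g : α → ℕ} → (∀ x → f x ≡ g x) → ∑ xs f ≡ ∑ xs g
∑-cong []       h = refl
∑-cong (x ∷ xs) h = cong₂ _+_ (h x) (∑-cong xs h)

∑-+ : (xs : List α) (f g : α → ℕ) → ∑ xs (λ x → f x + g x) ≡ ∑ xs f + ∑ xs g
∑-+ []       f g = refl
∑-+ (x ∷ xs) f g = trans (cong ((f x + g x) +_) (∑-+ xs f g))
  (solve 4 (λ a b c d → (a :+ b) :+ (c :+ d) := (a :+ c) :+ (b :+ d)) refl (f x) (g x) (∑ xs f) (∑ xs g))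
  where open +-*-Solver

∑-*ˡ : (xs : List α) (c : ℕ) (f : α → ℕ) → ∑ xs (λ x → c * f x) ≡ c * ∑ xs f
∑-*ˡ []       c f = sym (*-zeroʳ c)
∑-*ˡ (x ∷ xs) c f = trans (cong (c * f x +_) (∑-*ˡ xs c f)) (sym (*-distribˡ-+ c (f x) (∑ xs f)))

∑-*ʳ : (xs : List α) (c : ℕ) (f : α → ℕ) → ∑ xs (λ x → f x * c) ≡ ∑ xs f * c
∑-*ʳ xs c f = trans (∑-cong xs (λ x → *-comm (f x) c)) (trans (∑-*ˡ xs c f) (*-comm c (∑ xs f)))

∑-zero : (xs : List α) → ∑ xs (λ _ → 0) ≡ 0
∑-zero []       = refl
∑-zero (x ∷ xs) = ∑-zero xs

∑-const : (xs : List α) (c : ℕ) → ∑ xs (λ _ → c) ≡ length xs * c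
∑-const []       c = refl
∑-const (x ∷ xs) c = cong (c +_) (∑-const xs c)

∑-swap : (xs : List α) (ys : List β) (f : α → β → ℕ) →
         ∑ xs (λ x → ∑ ys (f x)) ≡ ∑ ys (λ y → ∑ xs (λ x → f x y))
∑-swap []       ys f = sym (∑-zero ys)
∑-swap (x ∷ xs) ys f = trans (cong (∑ ys (f x) +_) (∑-swap xs ys f))
                             (sym (∑-+ ys (f x) (λ y → ∑ xs (λ x → f x y))))

∑-++ : (xs ys : List α) (f : α → ℕ) → ∑ (xs ++ ys) f ≡ ∑ xs f + ∑ ys f
∑-++ []       ys f = refl
∑-++ (x ∷ xs) ys f = trans (cong (f x +_) (∑-++ xs ys f)) (sym (+-assoc (f x) _ _))

∑-map : (g : α → β) (xs : List α) (f : β → ℕ) → ∑ (map g xs) f ≡ ∑ xs (f ∘ g)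
∑-map g []       f = refl
∑-map g (x ∷ xs) f = cong (f (g x) +_) (∑-map g xs f)

∑-member : {xs : List α} {x : α} (f : α → ℕ) → x List∈.∈ xs → f x ≤ ∑ xs f
∑-member {xs = x ∷ xs} f (here refl) = m≤m+n _ _
∑-member {xs = y ∷ xs} f (there x∈)  = ≤-trans (∑-member f x∈) (m≤n+m _ (f y))

length-filter : {P : Pred α 0ℓ} (P? : Decidable P) (xs : List α) →
                length (filter P? xs) ≡ ∑ xs (λ x → ⟦ P? x ⟧)
length-filter P? []       = refl
length-filter P? (x ∷ xs) with P? x
... | yes _ = cong suc (length-filter P? xs)
... | no _  = length-filter P? xs

∑F : ∀ {n} → (Fin n → ℕ) → ℕ
∑F {n} = ∑ (allFin n)

∑S : ∀ {n} → (Subset n → ℕ) → ℕ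
∑S {n} = ∑ (allSubsets n)

private variable
  n s t j k : ℕ

∈-allSubsets : (p : Subset n) → p List∈.∈ allSubsets n
∈-allSubsets []            = here refl
∈-allSubsets (outside ∷ p) = ∈-++⁺ˡ (∈-map⁺ (outside ∷_) (∈-allSubsets p))
∈-allSubsets (inside ∷ p)  = ∈-++⁺ʳ _ (∈-map⁺ (inside ∷_) (∈-allSubsets p))

∑F-member : (f : Fin n → ℕ) (x : Fin n) → f x ≤ ∑F f
∑F-member f x = ∑-member f (∈-allFin x)

∑S-member : (f : Subset n → ℕ) (p : Subset n) → f p ≤ ∑S f
∑S-member f p = ∑-member f (∈-allSubsets p)

∑F-suc : (f : Fin (suc n) → ℕ) → ∑F f ≡ f zero + ∑F (f ∘ suc)
∑F-suc {n} f = cong (f zero +_) (trans (cong (λ l → ∑ l f) (sym (Listₚ.map-tabulate id suc))) (∑-map suc (allFin n) f))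

∑S-suc : (f : Subset (suc n) → ℕ) → ∑S f ≡ ∑S (f ∘ (outside ∷_)) + ∑S (f ∘ (inside ∷_))
∑S-suc {n} f = trans (∑-++ (map (outside ∷_) (allSubsets n)) _ f)
                     (cong₂ _+_ (∑-map _ (allSubsets n) f) (∑-map _ (allSubsets n) f))

∑F-const : (c : ℕ) → ∑F {n} (λ _ → c) ≡ n * c
∑F-const {n} c = trans (∑-const (allFin n) c) (cong (_* c) (Listₚ.length-tabulate {n = n} id))

-- Adding and removing an element

infixl 6 _⊕_ _⊖_

_⊕_ _⊖_ : Subset n → Fin n → Subset n
D ⊕ a = D [ a ]≔ inside
E ⊖ a = E [ a ]≔ outside

∈⊕-self : (D : Subset n) (a : Fin n) → a ∈ D ⊕ a
∈⊕-self D a = Vecₚ.[]≔-updates D a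

∉⊖-self : (E : Subset n) (a : Fin n) → a ∉ E ⊖ a
∉⊖-self (x ∷ E) (suc a) (there h) = ∉⊖-self E a h

∈⊕-other : {D : Subset n} {x : Fin n} (a : Fin n) → x ∈ D → x ∈ D ⊕ a
∈⊕-other zero    here      = here
∈⊕-other zero    (there h) = there h
∈⊕-other (suc a) here      = here
∈⊕-other (suc a) (there h) = there (∈⊕-other a h)

∈⊕⁻ : {D : Subset n} {x a : Fin n} → x ∈ D ⊕ a → x ≡ a ⊎ x ∈ D
∈⊕⁻ {D = _ ∷ _} {zero}  {zero}  h         = inj₁ refl
∈⊕⁻ {D = _ ∷ _} {suc x} {zero}  (there h) = inj₂ (there h)
∈⊕⁻ {D = _ ∷ _} {zero}  {suc a} here      = inj₂ here
∈⊕⁻ {D = _ ∷ _} {suc x} {suc a} (there h) = [ inj₁ ∘ cong suc , inj₂ ∘ there ]′ (∈⊕⁻ h)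

∈⊕-≢ : {D : Subset n} {x a : Fin n} → x ∈ D ⊕ a → x ≢ a → x ∈ D
∈⊕-≢ h x≢a = [ (λ e → contradiction e x≢a) , id ]′ (∈⊕⁻ h)

∈⊖⁻ : {E : Subset n} {x : Fin n} (a : Fin n) → x ∈ E ⊖ a → x ∈ E
∈⊖⁻ {E = _ ∷ _} zero    (there h) = there h
∈⊖⁻ {E = _ ∷ _} (suc a) here      = here
∈⊖⁻ {E = _ ∷ _} (suc a) (there h) = there (∈⊖⁻ a h)

∈⊖-≢ : {E : Subset n} {x a : Fin n} → x ∈ E ⊖ a → x ≢ a
∈⊖-≢ {E = E} h refl = ∉⊖-self E _ h

∈⊖⁺ : {E : Subset n} {x a : Fin n} → x ∈ E → x ≢ a → x ∈ E ⊖ a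
∈⊖⁺ {a = zero}  here      x≢a = contradiction refl x≢a
∈⊖⁺ {a = suc a} here      x≢a = here
∈⊖⁺ {a = zero}  (there h) x≢a = there h
∈⊖⁺ {a = suc a} (there h) x≢a = there (∈⊖⁺ h (x≢a ∘ cong suc))

⊕⊖ : {D : Subset n} {a : Fin n} → a ∉ D → (D ⊕ a) ⊖ a ≡ D
⊕⊖ {D = inside ∷ D}  {zero}  h = contradiction here h
⊕⊖ {D = outside ∷ D} {zero}  h = refl
⊕⊖ {D = x ∷ D}       {suc a} h = cong (x ∷_) (⊕⊖ (h ∘ there))

⊖⊕ : {E : Subset n} {a : Fin n} → a ∈ E → (E ⊖ a) ⊕ a ≡ E
⊖⊕ here      = refl
⊖⊕ (there h) = cong (_ ∷_) (⊖⊕ h)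

⊕⊖-comm : (D : Subset n) {a b : Fin n} → a ≢ b → (D ⊕ a) ⊖ b ≡ (D ⊖ b) ⊕ a
⊕⊖-comm D a≢b = Vecₚ.[]≔-commutes D _ _ a≢b

⊖⊖-comm : (D : Subset n) {a b : Fin n} → a ≢ b → (D ⊖ a) ⊖ b ≡ (D ⊖ b) ⊖ a
⊖⊖-comm D a≢b = Vecₚ.[]≔-commutes D _ _ a≢b

∪⁅⁆≡⊕ : (D : Subset n) (a : Fin n) → D ∪ ⁅ a ⁆ ≡ D ⊕ a
∪⁅⁆≡⊕ (outside ∷ D) zero    = cong (inside ∷_) (∪-identityʳ D)
∪⁅⁆≡⊕ (inside ∷ D)  zero    = cong (inside ∷_) (∪-identityʳ D)
∪⁅⁆≡⊕ (outside ∷ D) (suc a) = cong (outside ∷_) (∪⁅⁆≡⊕ D a)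
∪⁅⁆≡⊕ (inside ∷ D)  (suc a) = cong (inside ∷_) (∪⁅⁆≡⊕ D a)

∣⊕∣ : {D : Subset n} {a : Fin n} → a ∉ D → ∣ D ⊕ a ∣ ≡ suc ∣ D ∣
∣⊕∣ {D = inside ∷ D}  {zero}  h = contradiction here h
∣⊕∣ {D = outside ∷ D} {zero}  h = refl
∣⊕∣ {D = inside ∷ D}  {suc a} h = cong suc (∣⊕∣ (h ∘ there))
∣⊕∣ {D = outside ∷ D} {suc a} h = ∣⊕∣ (h ∘ there)

∣⊖∣ : {E : Subset n} {a : Fin n} → a ∈ E → suc ∣ E ⊖ a ∣ ≡ ∣ E ∣
∣⊖∣ {E = E} {a} a∈E = trans (sym (∣⊕∣ (∉⊖-self E a))) (cong ∣_∣ (⊖⊕ a∈E))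

∣⊕∣≤ : (D : Subset n) (a : Fin n) → ∣ D ⊕ a ∣ ≤ suc ∣ D ∣
∣⊕∣≤ D a with a ∈? D
... | no a∉D  = ≤-reflexive (∣⊕∣ a∉D)
... | yes a∈D = m≤n⇒m≤1+n (p⊆q⇒∣p∣≤∣q∣ {p = D ⊕ a} {D} (λ h → [ (λ { refl → a∈D }) , id ]′ (∈⊕⁻ h)))

∣∣≡∑ : (p : Subset n) → ∣ p ∣ ≡ ∑F (λ x → ⟦ x ∈? p ⟧)
∣∣≡∑ []            = refl
∣∣≡∑ (inside ∷ p)  = trans (cong suc (∣∣≡∑ p)) (sym (∑F-suc (λ x → ⟦ x ∈? (inside ∷ p) ⟧)))
∣∣≡∑ (outside ∷ p) = trans (∣∣≡∑ p) (sym (∑F-suc (λ x → ⟦ x ∈? (outside ∷ p) ⟧)))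

∑∉ : (p : Subset n) → ∣ p ∣ + ∑F (λ x → ⟦ ¬? (x ∈? p) ⟧) ≡ n
∑∉ {n} p = begin
  ∣ p ∣ + ∑F (λ x → ⟦ ¬? (x ∈? p) ⟧)                          ≡⟨ cong (_+ ∑F (λ x → ⟦ ¬? (x ∈? p) ⟧)) (∣∣≡∑ p) ⟩
  ∑F (λ x → ⟦ x ∈? p ⟧) + ∑F (λ x → ⟦ ¬? (x ∈? p) ⟧)          ≡⟨ sym (∑-+ (allFin n) _ _) ⟩
  ∑F (λ x → ⟦ x ∈? p ⟧ + ⟦ ¬? (x ∈? p) ⟧)                     ≡⟨ ∑-cong (allFin n) (λ x → one (x ∈? p)) ⟩
  ∑F {n} (λ _ → 1)                                            ≡⟨ ∑F-const {n} 1 ⟩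
  n * 1                                                       ≡⟨ *-identityʳ n ⟩
  n                                                           ∎
  where
  open ≡-Reasoning
  one : ∀ {P : Set} (d : Dec P) → ⟦ d ⟧ + ⟦ ¬? d ⟧ ≡ 1
  one (yes _) = refl
  one (no _)  = refl

-- Double counting of the pairs D ⊂ D ⊕ a, for one fixed a.
∑S-shift : (a : Fin n) (h : Subset n → ℕ) →
           ∑S (λ D → ⟦ ¬? (a ∈? D) ⟧ * h (D ⊕ a)) ≡ ∑S (λ E → ⟦ a ∈? E ⟧ * h E)
∑S-shift {suc n} zero h = begin
  ∑S (λ D → ⟦ ¬? (zero ∈? D) ⟧ * h (D ⊕ zero))
    ≡⟨ ∑S-suc (λ D → ⟦ ¬? (zero ∈? D) ⟧ * h (D ⊕ zero)) ⟩
  ∑S (λ D → 1 * h (inside ∷ D)) + ∑ (allSubsets n) (λ _ → 0)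
    ≡⟨ +-comm _ (∑ (allSubsets n) (λ _ → 0)) ⟩
  ∑ (allSubsets n) (λ _ → 0) + ∑S (λ D → 1 * h (inside ∷ D))
    ≡⟨ sym (∑S-suc (λ E → ⟦ zero ∈? E ⟧ * h E)) ⟩
  ∑S (λ E → ⟦ zero ∈? E ⟧ * h E) ∎
  where open ≡-Reasoning
∑S-shift {suc n} (suc a) h = begin
  ∑S (λ D → ⟦ ¬? (suc a ∈? D) ⟧ * h (D ⊕ suc a))
    ≡⟨ ∑S-suc (λ D → ⟦ ¬? (suc a ∈? D) ⟧ * h (D ⊕ suc a)) ⟩
  ∑S (λ D → ⟦ ¬? (a ∈? D) ⟧ * h (outside ∷ (D ⊕ a))) + ∑S (λ D → ⟦ ¬? (a ∈? D) ⟧ * h (inside ∷ (D ⊕ a)))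
    ≡⟨ cong₂ _+_ (∑S-shift a (h ∘ (outside ∷_))) (∑S-shift a (h ∘ (inside ∷_))) ⟩
  ∑S (λ E → ⟦ a ∈? E ⟧ * h (outside ∷ E)) + ∑S (λ E → ⟦ a ∈? E ⟧ * h (inside ∷ E))
    ≡⟨ sym (∑S-suc (λ E → ⟦ suc a ∈? E ⟧ * h E)) ⟩
  ∑S (λ E → ⟦ suc a ∈? E ⟧ * h E) ∎
  where open ≡-Reasoning

-- Both sides run over the same pairs of sets that differ in one vertex a. Since `h` sees a and both
-- sets, any weight on such pairs can be moved between adjacent layers.
double-count : (h : Fin n → Subset n → Subset n → ℕ) →
  ∑S (λ D → ∑F (λ a → ⟦ ¬? (a ∈? D) ⟧ * h a D (D ⊕ a))) ≡ ∑S (λ E → ∑F (λ a → ⟦ a ∈? E ⟧ * h a (E ⊖ a) E))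
double-count {n} h = begin
  ∑S (λ D → ∑F (λ a → ⟦ ¬? (a ∈? D) ⟧ * h a D (D ⊕ a)))
    ≡⟨ ∑-swap (allSubsets n) (allFin n) _ ⟩
  ∑F (λ a → ∑S (λ D → ⟦ ¬? (a ∈? D) ⟧ * h a D (D ⊕ a)))
    ≡⟨ ∑-cong (allFin n) (λ a → ∑-cong (allSubsets n) (λ D → rewr a D (a ∈? D))) ⟩
  ∑F (λ a → ∑S (λ D → ⟦ ¬? (a ∈? D) ⟧ * h a ((D ⊕ a) ⊖ a) (D ⊕ a)))
    ≡⟨ ∑-cong (allFin n) (λ a → ∑S-shift a (λ E → h a (E ⊖ a) E)) ⟩
  ∑F (λ a → ∑S (λ E → ⟦ a ∈? E ⟧ * h a (E ⊖ a) E))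
    ≡⟨ ∑-swap (allFin n) (allSubsets n) _ ⟩
  ∑S (λ E → ∑F (λ a → ⟦ a ∈? E ⟧ * h a (E ⊖ a) E)) ∎
  where
  open ≡-Reasoning
  rewr : ∀ a D (d : Dec (a ∈ D)) → ⟦ ¬? d ⟧ * h a D (D ⊕ a) ≡ ⟦ ¬? d ⟧ * h a ((D ⊕ a) ⊖ a) (D ⊕ a)
  rewr a D (yes _) = refl
  rewr a D (no a∉) = cong (λ D′ → 1 * h a D′ (D ⊕ a)) (sym (⊕⊖ a∉))

-- Subsets and families given by decidable predicates

comprehension : {P : Pred (Fin n) 0ℓ} → Decidable P → Subset n
comprehension P? = tabulate (λ x → does (P? x))

does-true : ∀ {P : Set} (d : Dec P) → does d ≡ true → P
does-true (yes p) _ = p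

true-does : ∀ {P : Set} (d : Dec P) → P → does d ≡ true
true-does (yes _) _ = refl
true-does (no ¬p) p = contradiction p ¬p

∈-comprehension⁺ : {P : Pred (Fin n) 0ℓ} (P? : Decidable P) {x : Fin n} → P x → x ∈ comprehension P?
∈-comprehension⁺ P? {x} px = Vecₚ.lookup⇒[]= x _ (trans (Vecₚ.lookup∘tabulate _ x) (true-does (P? x) px))

∈-comprehension⁻ : {P : Pred (Fin n) 0ℓ} (P? : Decidable P) {x : Fin n} → x ∈ comprehension P? → P x
∈-comprehension⁻ P? {x} h = does-true (P? x) (trans (sym (Vecₚ.lookup∘tabulate _ x)) (Vecₚ.[]=⇒lookup h))

∣comprehension∣ : {P : Pred (Fin n) 0ℓ} (P? : Decidable P) → ∣ comprehension P? ∣ ≡ ∑F (λ x → ⟦ P? x ⟧)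
∣comprehension∣ {n} P? = trans (∣∣≡∑ (comprehension P?))
  (∑-cong (allFin n) (λ x → ⟦⟧-cong (x ∈? comprehension P?) (P? x) (∈-comprehension⁻ P?) (∈-comprehension⁺ P?)))

size-nonempty : {E : Subset n} → ∣ E ∣ ≡ suc k → ∃[ a ] a ∈ E
size-nonempty {n} {E = E} eq with nonempty? E
... | yes ne = ne
... | no ¬ne with Empty-unique ¬ne
...   | refl = contradiction (trans (sym eq) (∣⊥∣≡0 n)) λ ()

size-zero : {E : Subset n} → ∣ E ∣ ≡ 0 → E ≡ ⊥
size-zero {E = E} eq with nonempty? E
... | no ¬ne = Empty-unique ¬ne
... | yes (a , a∈E) = contradiction (trans (∣⊖∣ a∈E) eq) λ ()

⊆∧≤⇒≡ : {p q : Subset n} → p ⊆ q → ∣ q ∣ ≤ ∣ p ∣ → p ≡ q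
⊆∧≤⇒≡ {p = p} {q} p⊆q le with q ⊆? p
... | yes q⊆p = ⊆-antisym p⊆q q⊆p
... | no q⊈p  = contradiction (p⊂q⇒∣p∣<∣q∣ (p⊆q , strict)) (≤⇒≯ le)
  where
  strict : ∃[ x ] (x ∈ q × x ∉ p)
  strict with any? (λ x → (x ∈? q) ×-dec ¬? (x ∈? p))
  ... | yes w = w
  ... | no ¬w = contradiction (λ {x} x∈q → case x ∈? p of λ
                  { (yes x∈p) → x∈p ; (no x∉p) → contradiction (x , x∈q , x∉p) ¬w }) q⊈p

#_ : {𝒟 : Pred (Subset n) 0ℓ} → Decidable 𝒟 → ℕ
# 𝒟? = ∑S (λ D → ⟦ 𝒟? D ⟧)

#-mono : {𝒟 ℰ : Pred (Subset n) 0ℓ} (𝒟? : Decidable 𝒟) (ℰ? : Decidable ℰ) → (∀ {D} → 𝒟 D → ℰ D) → # 𝒟? ≤ # ℰ?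
#-mono {n} 𝒟? ℰ? h = ∑-mono (allSubsets n) (λ D → ⟦⟧-mono (𝒟? D) (ℰ? D) h)

#-empty : {𝒟 : Pred (Subset n) 0ℓ} (𝒟? : Decidable 𝒟) → (∀ D → ¬ 𝒟 D) → # 𝒟? ≡ 0
#-empty {n} 𝒟? h = trans (∑-cong (allSubsets n) (λ D → ⟦⟧≡0 (𝒟? D) (h D))) (∑-zero (allSubsets n))

#-member : {𝒟 : Pred (Subset n) 0ℓ} (𝒟? : Decidable 𝒟) {D : Subset n} → 𝒟 D → 1 ≤ # 𝒟?
#-member 𝒟? {D} h = ≤-trans (1≤⟦⟧ (𝒟? D) h) (∑S-member _ D)

#-witness : {𝒟 : Pred (Subset n) 0ℓ} (𝒟? : Decidable 𝒟) → 1 ≤ # 𝒟? → ∃[ D ] 𝒟 D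
#-witness 𝒟? le with anySubset? 𝒟?
... | yes w = w
... | no ¬w = contradiction le (<⇒≱ (s≤s (≤-reflexive (#-empty 𝒟? (λ D h → ¬w (D , h))))))

handshake : {𝒟 : Pred (Subset n) 0ℓ} (𝒟? : Decidable 𝒟) → (∀ {D} → 𝒟 D → ∣ D ∣ ≡ j) →
            ∑S (λ E → ∑F (λ a → ⟦ a ∈? E ⟧ * ⟦ 𝒟? E ⟧)) ≡ j * # 𝒟?
handshake {n} {j} 𝒟? size = trans (∑-cong (allSubsets n) step) (∑-*ˡ (allSubsets n) j _)
  where
  step : ∀ E → ∑F (λ a → ⟦ a ∈? E ⟧ * ⟦ 𝒟? E ⟧) ≡ j * ⟦ 𝒟? E ⟧
  step E with 𝒟? E
  ... | yes h = trans (∑-*ʳ (allFin n) 1 _) (cong (_* 1) (trans (sym (∣∣≡∑ E)) (size h)))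
  ... | no _  = trans (∑-*ʳ (allFin n) 0 _) (trans (*-zeroʳ (∑F (λ a → ⟦ a ∈? E ⟧))) (sym (*-zeroʳ j)))

-- Layers of the Boolean lattice

layer : ℕ → ℕ → ℕ
layer n k = #_ {n} (λ D → ∣ D ∣ ≟ k)

layer-pascal : ∀ n k → layer (suc n) (suc k) ≡ layer n (suc k) + layer n k
layer-pascal n k = ∑S-suc {n} (λ D → ⟦ ∣ D ∣ ≟ suc k ⟧)

layer-0 : ∀ n → layer n 0 ≡ 1
layer-0 zero    = refl
layer-0 (suc n) = trans (∑S-suc {n} (λ D → ⟦ ∣ D ∣ ≟ 0 ⟧)) (cong₂ _+_ (layer-0 n) (∑-zero (allSubsets n)))

layer≡C : ∀ n k → layer n k ≡ n C k
layer≡C zero    zero    = refl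
layer≡C (suc n) zero    = layer-0 (suc n)
layer≡C zero    (suc k) = sym (k>n⇒nCk≡0 {0} {suc k} (s≤s z≤n))
layer≡C (suc n) (suc k) = trans (layer-pascal n k) (trans (cong₂ _+_ (layer≡C n (suc k)) (layer≡C n k))
  (trans (+-comm (n C suc k) (n C k)) (nCk+nC[k+1]≡[n+1]C[k+1] n k)))

-- The pairs (D, a) with D of size k are split by whether a lies outside D or in D; those with a
-- outside correspond to the sets of size k + 1 with a marked element.
layer-rec : ∀ n k → suc k * layer n (suc k) + k * layer n k ≡ n * layer n k
layer-rec n k = begin
  suc k * layer n (suc k) + k * layer n k
    ≡⟨ cong₂ _+_ (sym (handshake {n} (λ D → ∣ D ∣ ≟ suc k) id)) (sym (handshake {n} (λ D → ∣ D ∣ ≟ k) id)) ⟩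
  ∑S {n} (λ E → ∑F (λ a → ⟦ a ∈? E ⟧ * ⟦ ∣ E ∣ ≟ suc k ⟧)) + low
    ≡⟨ cong (_+ low) (∑-cong (allSubsets n) (λ E → ∑-cong (allFin n) (λ a → lower a E (a ∈? E)))) ⟩
  ∑S {n} (λ E → ∑F (λ a → ⟦ a ∈? E ⟧ * ⟦ ∣ E ⊖ a ∣ ≟ k ⟧)) + low
    ≡⟨ cong (_+ low) (sym (double-count {n} (λ a D E → ⟦ ∣ D ∣ ≟ k ⟧))) ⟩
  ∑S {n} (λ D → ∑F (λ a → ⟦ ¬? (a ∈? D) ⟧ * ⟦ ∣ D ∣ ≟ k ⟧)) + low
    ≡⟨ sym (∑-+ (allSubsets n) _ _) ⟩
  ∑S {n} (λ D → ∑F (λ a → ⟦ ¬? (a ∈? D) ⟧ * ⟦ ∣ D ∣ ≟ k ⟧) + ∑F (λ a → ⟦ a ∈? D ⟧ * ⟦ ∣ D ∣ ≟ k ⟧))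
    ≡⟨ ∑-cong (allSubsets n) total ⟩
  ∑S {n} (λ D → n * ⟦ ∣ D ∣ ≟ k ⟧)
    ≡⟨ ∑-*ˡ (allSubsets n) n (λ D → ⟦ ∣ D ∣ ≟ k ⟧) ⟩
  n * layer n k ∎
  where
  open ≡-Reasoning
  low = ∑S {n} (λ E → ∑F (λ a → ⟦ a ∈? E ⟧ * ⟦ ∣ E ∣ ≟ k ⟧))
  lower : ∀ a E (d : Dec (a ∈ E)) → ⟦ d ⟧ * ⟦ ∣ E ∣ ≟ suc k ⟧ ≡ ⟦ d ⟧ * ⟦ ∣ E ⊖ a ∣ ≟ k ⟧
  lower a E (no _)    = refl
  lower a E (yes a∈E) = cong (1 *_) (⟦⟧-cong (∣ E ∣ ≟ suc k) (∣ E ⊖ a ∣ ≟ k)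
    (λ e → suc-injective (trans (∣⊖∣ a∈E) e)) (λ e → trans (sym (∣⊖∣ a∈E)) (cong suc e)))
  total : ∀ D → ∑F (λ a → ⟦ ¬? (a ∈? D) ⟧ * ⟦ ∣ D ∣ ≟ k ⟧) + ∑F (λ a → ⟦ a ∈? D ⟧ * ⟦ ∣ D ∣ ≟ k ⟧) ≡ n * ⟦ ∣ D ∣ ≟ k ⟧
  total D = begin
    ∑F (λ a → ⟦ ¬? (a ∈? D) ⟧ * c) + ∑F (λ a → ⟦ a ∈? D ⟧ * c)
      ≡⟨ cong₂ _+_ (∑-*ʳ (allFin n) c _) (∑-*ʳ (allFin n) c _) ⟩
    ∑F (λ a → ⟦ ¬? (a ∈? D) ⟧) * c + ∑F (λ a → ⟦ a ∈? D ⟧) * c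
      ≡⟨ sym (*-distribʳ-+ c (∑F (λ a → ⟦ ¬? (a ∈? D) ⟧)) (∑F (λ a → ⟦ a ∈? D ⟧))) ⟩
    (∑F (λ a → ⟦ ¬? (a ∈? D) ⟧) + ∑F (λ a → ⟦ a ∈? D ⟧)) * c
      ≡⟨ cong (_* c) (trans (+-comm (∑F (λ a → ⟦ ¬? (a ∈? D) ⟧)) _) (trans (cong (_+ ∑F (λ a → ⟦ ¬? (a ∈? D) ⟧)) (sym (∣∣≡∑ D))) (∑∉ D))) ⟩
    n * c ∎
    where c = ⟦ ∣ D ∣ ≟ k ⟧

!*layer≤^ : ∀ n k → k ! * layer n k ≤ n ^ k
!*layer≤^ n zero    = ≤-reflexive (trans (+-identityʳ _) (layer-0 n))
!*layer≤^ n (suc k) = begin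
  suc k * k ! * layer n (suc k)    ≡⟨ solve 3 (λ a b c → a :* b :* c := b :* (a :* c)) refl (suc k) (k !) (layer n (suc k)) ⟩
  k ! * (suc k * layer n (suc k))  ≤⟨ *-monoʳ-≤ (k !) (≤-trans (m≤m+n _ (k * layer n k)) (≤-reflexive (layer-rec n k))) ⟩
  k ! * (n * layer n k)            ≡⟨ solve 3 (λ a b c → a :* (b :* c) := b :* (a :* c)) refl (k !) n (layer n k) ⟩
  n * (k ! * layer n k)            ≤⟨ *-monoʳ-≤ n (!*layer≤^ n k) ⟩
  n * n ^ k                        ∎
  where
  open ≤-Reasoning
  open +-*-Solver

1≤! : ∀ k → 1 ≤ k !
1≤! zero    = ≤-refl
1≤! (suc k) = 1≤* (s≤s {n = k} z≤n) (1≤! k)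

m≤n*m′ : ∀ {m n} → 1 ≤ n → m ≤ n * m
m≤n*m′ {m} le = ≤-trans (≤-reflexive (sym (+-identityʳ m))) (*-monoˡ-≤ m le)

layer≤^ : ∀ n k → layer n k ≤ n ^ k
layer≤^ n k = ≤-trans (m≤n*m′ (1≤! k)) (!*layer≤^ n k)

-- The factorial times the layer is a falling factorial. With K = k + 1, passing to the next
-- exponent adds K to the coefficient K², which (K + 1)² accommodates.
^≤!*layer+ : ∀ n k → n ^ suc k ≤ suc k ! * layer n (suc k) + suc k * suc k * n ^ k
^≤!*layer+ n zero    = begin
  n * 1                                ≡⟨ cong (n *_) (sym (layer-0 n)) ⟩
  n * layer n 0                        ≡⟨ sym (layer-rec n 0) ⟩
  1 * layer n 1 + 0                    ≤⟨ +-monoʳ-≤ (1 * layer n 1) z≤n ⟩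
  1 * layer n 1 + 1                    ∎
  where open ≤-Reasoning
^≤!*layer+ n (suc k) = begin
  n * n ^ suc k
    ≤⟨ *-monoʳ-≤ n (^≤!*layer+ n k) ⟩
  n * (F * L + K * K * n ^ k)
    ≡⟨ solve 5 (λ n F L K p → n :* (F :* L :+ K :* K :* p) := F :* (n :* L) :+ K :* K :* (n :* p)) refl n F L K (n ^ k) ⟩
  F * (n * L) + K * K * n ^ suc k
    ≡⟨ cong (λ z → F * z + K * K * n ^ suc k) (sym (layer-rec n K)) ⟩
  F * (suc K * L′ + K * L) + K * K * n ^ suc k
    ≡⟨ solve 5 (λ F K L L′ p → F :* ((con 1 :+ K) :* L′ :+ K :* L) :+ K :* K :* p
                           := (con 1 :+ K) :* F :* L′ :+ (K :* (F :* L) :+ K :* K :* p)) refl F K L L′ (n ^ suc k) ⟩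
  suc K * F * L′ + (K * (F * L) + K * K * n ^ suc k)
    ≤⟨ +-monoʳ-≤ (suc K * F * L′) (+-monoˡ-≤ (K * K * n ^ suc k) (*-monoʳ-≤ K (!*layer≤^ n K))) ⟩
  suc K * F * L′ + (K * n ^ suc k + K * K * n ^ suc k)
    ≤⟨ +-monoʳ-≤ (suc K * F * L′) (m≤m+n _ (suc K * n ^ suc k)) ⟩
  suc K * F * L′ + (K * n ^ suc k + K * K * n ^ suc k + suc K * n ^ suc k)
    ≡⟨ cong (suc K * F * L′ +_) (solve 2 (λ K p → K :* p :+ K :* K :* p :+ (con 1 :+ K) :* p
                                              := (con 1 :+ K) :* (con 1 :+ K) :* p) refl K (n ^ suc k)) ⟩
  suc K * F * L′ + suc K * suc K * n ^ suc k ∎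
  where
  open ≤-Reasoning
  open +-*-Solver
  K = suc k
  F = suc k !
  L = layer n (suc k)
  L′ = layer n (suc (suc k))

-- A set of size j + 1 arises from a smaller one by adding an element of `W`; the multiplicity j + 1
-- is not divided out.
subsets≤^ : (W : Subset n) (j : ℕ) → # (λ S → (∣ S ∣ ≟ j) ×-dec (S ⊆? W)) ≤ ∣ W ∣ ^ j
subsets≤^ {n} W zero    = ≤-trans (#-mono (λ S → (∣ S ∣ ≟ 0) ×-dec (S ⊆? W)) (λ S → ∣ S ∣ ≟ 0) proj₁) (≤-reflexive (layer-0 n))
subsets≤^ {n} W (suc j) = begin
  ∑S (λ S → ⟦ (∣ S ∣ ≟ suc j) ×-dec (S ⊆? W) ⟧)
    ≤⟨ ∑-mono (allSubsets n) pick ⟩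
  ∑S (λ S → ∑F (λ a → ⟦ a ∈? S ⟧ * (⟦ a ∈? W ⟧ * ⟦ (∣ S ⊖ a ∣ ≟ j) ×-dec (S ⊖ a ⊆? W) ⟧)))
    ≡⟨ sym (double-count {n} (λ a T S → ⟦ a ∈? W ⟧ * ⟦ (∣ T ∣ ≟ j) ×-dec (T ⊆? W) ⟧)) ⟩
  ∑S (λ T → ∑F (λ a → ⟦ ¬? (a ∈? T) ⟧ * (⟦ a ∈? W ⟧ * ⟦ (∣ T ∣ ≟ j) ×-dec (T ⊆? W) ⟧)))
    ≤⟨ ∑-mono (allSubsets n) (λ T → ≤-trans (∑-mono (allFin n) (λ a → ⟦⟧*≤ (¬? (a ∈? T)) (λ _ → ≤-refl)))
         (≤-reflexive (trans (∑-*ʳ (allFin n) ⟦ (∣ T ∣ ≟ j) ×-dec (T ⊆? W) ⟧ (λ a → ⟦ a ∈? W ⟧)) (cong (_* ⟦ (∣ T ∣ ≟ j) ×-dec (T ⊆? W) ⟧) (sym (∣∣≡∑ W)))))) ⟩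
  ∑S (λ T → ∣ W ∣ * ⟦ (∣ T ∣ ≟ j) ×-dec (T ⊆? W) ⟧)
    ≡⟨ ∑-*ˡ (allSubsets n) ∣ W ∣ _ ⟩
  ∣ W ∣ * # (λ S → (∣ S ∣ ≟ j) ×-dec (S ⊆? W))
    ≤⟨ *-monoʳ-≤ ∣ W ∣ (subsets≤^ W j) ⟩
  ∣ W ∣ * ∣ W ∣ ^ j ∎
  where
  open ≤-Reasoning
  pick : ∀ S → ⟦ (∣ S ∣ ≟ suc j) ×-dec (S ⊆? W) ⟧ ≤
               ∑F (λ a → ⟦ a ∈? S ⟧ * (⟦ a ∈? W ⟧ * ⟦ (∣ S ⊖ a ∣ ≟ j) ×-dec (S ⊖ a ⊆? W) ⟧))
  pick S = ⟦⟧≤ ((∣ S ∣ ≟ suc j) ×-dec (S ⊆? W)) λ (eq , S⊆W) →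
    let a , a∈S = size-nonempty eq in
    ≤-trans (1≤* (1≤⟦⟧ (a ∈? S) a∈S) (1≤* (1≤⟦⟧ (a ∈? W) (S⊆W a∈S))
              (1≤⟦⟧ ((∣ S ⊖ a ∣ ≟ j) ×-dec (S ⊖ a ⊆? W)) (suc-injective (trans (∣⊖∣ a∈S) eq) , (λ h → S⊆W (∈⊖⁻ a h))))))
      (∑F-member (λ a → ⟦ a ∈? S ⟧ * (⟦ a ∈? W ⟧ * ⟦ (∣ S ⊖ a ∣ ≟ j) ×-dec (S ⊖ a ⊆? W) ⟧)) a)

-- A Kruskal–Katona type inequality

link? : {𝒟 : Pred (Subset n) 0ℓ} → Decidable 𝒟 → (v : Fin n) → Decidable (λ D → v ∉ D × 𝒟 (D ⊕ v))
link? 𝒟? v D = ¬? (v ∈? D) ×-dec 𝒟? (D ⊕ v)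

∑-link : {𝒟 : Pred (Subset n) 0ℓ} (𝒟? : Decidable 𝒟) → (∀ {D} → 𝒟 D → ∣ D ∣ ≡ j) →
         ∑F (λ v → # (link? 𝒟? v)) ≡ j * # 𝒟?
∑-link {n} {j} 𝒟? size = begin
  ∑F (λ v → # (link? 𝒟? v))
    ≡⟨ ∑-swap (allFin n) (allSubsets n) _ ⟩
  ∑S (λ D → ∑F (λ v → ⟦ link? 𝒟? v D ⟧))
    ≡⟨ ∑-cong (allSubsets n) (λ D → ∑-cong (allFin n) (λ v → ⟦⟧-× (¬? (v ∈? D)) (𝒟? (D ⊕ v)))) ⟩
  ∑S (λ D → ∑F (λ v → ⟦ ¬? (v ∈? D) ⟧ * ⟦ 𝒟? (D ⊕ v) ⟧))
    ≡⟨ double-count {n} (λ v D E → ⟦ 𝒟? E ⟧) ⟩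
  ∑S (λ E → ∑F (λ v → ⟦ v ∈? E ⟧ * ⟦ 𝒟? E ⟧))
    ≡⟨ handshake 𝒟? size ⟩
  j * # 𝒟? ∎
  where open ≡-Reasoning

-- Either every link is small, and the links give the inequality by induction,
-- or one link is large, and the shadow contains that link.
shadow-bound : ∀ k x {𝒟 𝒫 : Pred (Subset n) 0ℓ} (𝒟? : Decidable 𝒟) (𝒫? : Decidable 𝒫) →
               (∀ {D} → 𝒟 D → ∣ D ∣ ≡ suc k) → (∀ {P} → 𝒫 P → ∣ P ∣ ≡ k) →
               (∀ {D a} → 𝒟 D → a ∈ D → 𝒫 (D ⊖ a)) →
               suc k ! * # 𝒟? ≤ x ^ suc k → suc k * # 𝒟? ≤ x * # 𝒫?
shadow-bound zero x 𝒟? 𝒫? size𝒟 size𝒫 shadow le with anySubset? 𝒟?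
... | no ¬w = ≤-trans (≤-reflexive (trans (+-identityʳ _) (#-empty 𝒟? (λ D h → ¬w (D , h))))) z≤n
... | yes (D , h) with size-nonempty (size𝒟 h)
...   | a , a∈D = ≤-trans le (*-monoʳ-≤ x (#-member 𝒫? (shadow h a∈D)))
shadow-bound {n} (suc k) x {𝒫 = 𝒫} 𝒟? 𝒫? size𝒟 size𝒫 shadow le with all? (λ v → suc k ! * # (link? 𝒟? v) ≤? x ^ suc k)
-- Summing the links counts each member of `𝒟` suc (suc k) times, but each member of `𝒫` only suc k
-- times. The factor suc k of the induction hypothesis makes up for this difference.
... | yes small = *-cancelˡ-≤ (suc k) (begin
  suc k * (suc (suc k) * # 𝒟?)           ≡⟨ cong (suc k *_) (sym (∑-link 𝒟? size𝒟)) ⟩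
  suc k * ∑F (λ v → # (link? 𝒟? v))      ≡⟨ sym (∑-*ˡ (allFin n) (suc k) _) ⟩
  ∑F (λ v → suc k * # (link? 𝒟? v))      ≤⟨ ∑-mono (allFin n) (λ v → shadow-bound k x (link? 𝒟? v) (link? 𝒫? v)
                                              (λ (v∉ , d) → suc-injective (trans (sym (∣⊕∣ v∉)) (size𝒟 d)))
                                              (λ (v∉ , p) → suc-injective (trans (sym (∣⊕∣ v∉)) (size𝒫 p)))
                                              (λ (v∉ , d) a∈D → (v∉ ∘ ∈⊖⁻ _) ,
                                                 subst 𝒫 (⊕⊖-comm _ (λ { refl → v∉ a∈D })) (shadow d (∈⊕-other v a∈D)))
                                              (small v)) ⟩
  ∑F (λ v → x * # (link? 𝒫? v))          ≡⟨ ∑-*ˡ (allFin n) x _ ⟩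
  x * ∑F (λ v → # (link? 𝒫? v))          ≡⟨ cong (x *_) (∑-link 𝒫? size𝒫) ⟩
  x * (suc k * # 𝒫?)                     ≡⟨ solve 3 (λ x k p → x :* (k :* p) := k :* (x :* p)) refl x (suc k) (# 𝒫?) ⟩
  suc k * (x * # 𝒫?)                     ∎)
  where
  open ≤-Reasoning
  open +-*-Solver
... | no ¬small with any? (λ v → ¬? (suc k ! * # (link? 𝒟? v) ≤? x ^ suc k))
...   | no ¬w = contradiction (λ v → case suc k ! * # (link? 𝒟? v) ≤? x ^ suc k of λ
                  { (yes h) → h ; (no ¬h) → contradiction (v , ¬h) ¬w }) ¬small
...   | yes (v , big) = *-cancelˡ-≤ (suc k !) ⦃ >-nonZero (1≤! (suc k)) ⦄ (begin
  suc k ! * (suc (suc k) * # 𝒟?)    ≡⟨ solve 3 (λ f k d → f :* (k :* d) := k :* f :* d) refl (suc k !) (suc (suc k)) (# 𝒟?) ⟩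
  suc (suc k) ! * # 𝒟?              ≤⟨ le ⟩
  x * x ^ suc k                     ≤⟨ *-monoʳ-≤ x (≤-trans (<⇒≤ (≰⇒> big)) (*-monoʳ-≤ (suc k !) (#-mono (link? 𝒟? v) 𝒫?
                                         (λ (v∉ , d) → subst 𝒫 (⊕⊖ v∉) (shadow d (∈⊕-self _ v)))))) ⟩
  x * (suc k ! * # 𝒫?)              ≡⟨ solve 3 (λ x f p → x :* (f :* p) := f :* (x :* p)) refl x (suc k !) (# 𝒫?) ⟩
  suc k ! * (x * # 𝒫?)              ∎)
  where
  open ≤-Reasoning
  open +-*-Solver

-- Choosing elements

∑F-≟ : (a : Fin n) → ∑F (λ x → ⟦ x ≟ᶠ a ⟧) ≡ 1
∑F-≟ {n} a = trans (∑-cong (allFin n) (λ x → ⟦⟧-cong (x ≟ᶠ a) (x ∈? ⁅ a ⁆) (λ { refl → x∈⁅x⁆ a }) (x∈⁅y⁆⇒x≡y a)))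
                   (trans (sym (∣∣≡∑ ⁅ a ⁆)) (∣⁅x⁆∣≡1 a))

-- Pigeonhole: each element of `U` strikes out at most one candidate.
fresh : (U : Subset t) (φ : Fin t → Fin n) {P : Pred (Fin n) 0ℓ} (P? : Decidable P) →
        ∣ U ∣ < ∑F (λ z → ⟦ P? z ⟧) → ∃[ z ] (P z × (∀ {u} → u ∈ U → φ u ≢ z))
fresh {n = n} [] φ P? lt with any? P?
... | yes (z , pz) = z , pz , λ ()
... | no ¬w = contradiction lt (≤⇒≯ (≤-reflexive (trans (∑-cong (allFin n) (λ z → ⟦⟧≡0 (P? z) (λ pz → ¬w (z , pz)))) (∑-zero (allFin n)))))
fresh (outside ∷ U) φ P? lt with fresh U (φ ∘ suc) P? lt
... | z , pz , h = z , pz , λ { (there u∈U) → h u∈U }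
fresh {n = n} (inside ∷ U) φ {P} P? lt
  with fresh U (φ ∘ suc) (λ z → P? z ×-dec ¬? (z ≟ᶠ φ zero)) (≤-pred (≤-trans lt (begin
    ∑F (λ z → ⟦ P? z ⟧)
      ≤⟨ ∑-mono (allFin n) (λ z → split z (P? z) (z ≟ᶠ φ zero)) ⟩
    ∑F (λ z → ⟦ z ≟ᶠ φ zero ⟧ + ⟦ P? z ×-dec ¬? (z ≟ᶠ φ zero) ⟧)
      ≡⟨ ∑-+ (allFin n) _ _ ⟩
    ∑F (λ z → ⟦ z ≟ᶠ φ zero ⟧) + ∑F (λ z → ⟦ P? z ×-dec ¬? (z ≟ᶠ φ zero) ⟧)
      ≡⟨ cong (_+ ∑F (λ z → ⟦ P? z ×-dec ¬? (z ≟ᶠ φ zero) ⟧)) (∑F-≟ (φ zero)) ⟩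
    suc (∑F (λ z → ⟦ P? z ×-dec ¬? (z ≟ᶠ φ zero) ⟧)) ∎)))
  where
  open ≤-Reasoning
  split : ∀ z (d : Dec (P z)) (e : Dec (z ≡ φ zero)) → ⟦ d ⟧ ≤ ⟦ e ⟧ + ⟦ d ×-dec ¬? e ⟧
  split z (no _)  e       = z≤n
  split z (yes _) (yes _) = s≤s z≤n
  split z (yes _) (no _)  = s≤s z≤n
... | z , (pz , z≢) , h = z , pz , λ { here e → z≢ (sym e) ; (there u∈U) → h u∈U }

InjectiveOn : (Fin s → Fin n) → Subset s → Set
InjectiveOn φ X = ∀ {u v} → u ∈ X → v ∈ X → φ u ≡ φ v → u ≡ v

inject : (X : Subset s) (Z : Subset n) → Fin n → ∣ X ∣ ≤ ∣ Z ∣ →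
         ∃[ χ ] ((∀ {u} → u ∈ X → χ u ∈ Z) × InjectiveOn χ X)
inject []            Z d le = (λ ()) , (λ ()) , λ ()
inject (outside ∷ X) Z d le with inject X Z d le
... | χ , χ∈ , inj = (λ { zero → d ; (suc u) → χ u }) , (λ { (there h) → χ∈ h }) ,
                     λ { (there h) (there h′) e → cong suc (inj h h′ e) }
inject {n = n} (inside ∷ X) Z d le with nonempty? Z
... | no ¬ne = contradiction (subst (λ Z → suc ∣ X ∣ ≤ ∣ Z ∣) (Empty-unique ¬ne) le) (<⇒≱ (s≤s (≤-trans (≤-reflexive (∣⊥∣≡0 n)) z≤n)))
... | yes (a , a∈Z) with inject X (Z ⊖ a) d (≤-pred (≤-trans le (≤-reflexive (sym (∣⊖∣ a∈Z)))))
...   | χ , χ∈ , inj = (λ { zero → a ; (suc u) → χ u }) ,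
                       (λ { here → a∈Z ; (there h) → ∈⊖⁻ a (χ∈ h) }) ,
                       λ { here here e → refl
                         ; here (there h′) e → contradiction (sym e) (∈⊖-≢ (χ∈ h′))
                         ; (there h) here e → contradiction e (∈⊖-≢ (χ∈ h))
                         ; (there h) (there h′) e → cong suc (inj h h′ e) }

subset-of-size : (Z : Subset n) (j : ℕ) → j ≤ ∣ Z ∣ → ∃[ X ] (X ⊆ Z × ∣ X ∣ ≡ j)
subset-of-size {n} Z zero le = ⊥ , (λ h → contradiction h ∉⊥) , ∣⊥∣≡0 n
subset-of-size (outside ∷ Z) (suc j) le with subset-of-size Z (suc j) le
... | X , X⊆ , eq = outside ∷ X , (λ { (there h) → there (X⊆ h) }) , eq
subset-of-size (inside ∷ Z) (suc j) (s≤s le) with subset-of-size Z j le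
... | X , X⊆ , eq = inside ∷ X , (λ { here → here ; (there h) → there (X⊆ h) }) , cong suc eq

_∖_ : Subset n → Subset n → Subset n
E ∖ R = comprehension (λ v → (v ∈? E) ×-dec ¬? (v ∈? R))

∈∖⁺ : {E R : Subset n} {v : Fin n} → v ∈ E → v ∉ R → v ∈ E ∖ R
∈∖⁺ {E = E} {R} h h′ = ∈-comprehension⁺ (λ v → (v ∈? E) ×-dec ¬? (v ∈? R)) (h , h′)

∈∖⁻ : (E R : Subset n) {v : Fin n} → v ∈ E ∖ R → v ∈ E × v ∉ R
∈∖⁻ E R = ∈-comprehension⁻ (λ v → (v ∈? E) ×-dec ¬? (v ∈? R))

∣∣-split : (E R : Subset n) → ∣ E ∣ ≡ ∣ E ∩ R ∣ + ∣ E ∖ R ∣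
∣∣-split {n} E R = begin
  ∣ E ∣                                                     ≡⟨ ∣∣≡∑ E ⟩
  ∑F (λ v → ⟦ v ∈? E ⟧)                                     ≡⟨ ∑-cong (allFin n) (λ v → split v (v ∈? E) (v ∈? R)) ⟩
  ∑F (λ v → ⟦ v ∈? (E ∩ R) ⟧ + ⟦ v ∈? (E ∖ R) ⟧)            ≡⟨ ∑-+ (allFin n) _ _ ⟩
  ∑F (λ v → ⟦ v ∈? (E ∩ R) ⟧) + ∑F (λ v → ⟦ v ∈? (E ∖ R) ⟧) ≡⟨ sym (cong₂ _+_ (∣∣≡∑ (E ∩ R)) (∣∣≡∑ (E ∖ R))) ⟩
  ∣ E ∩ R ∣ + ∣ E ∖ R ∣                                     ∎
  where
  open ≡-Reasoning
  split : ∀ v (d : Dec (v ∈ E)) (e : Dec (v ∈ R)) → ⟦ d ⟧ ≡ ⟦ v ∈? (E ∩ R) ⟧ + ⟦ v ∈? (E ∖ R) ⟧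
  split v (yes h) (yes h′) = sym (cong₂ _+_ (⟦⟧≡1 (v ∈? (E ∩ R)) (x∈p∩q⁺ (h , h′))) (⟦⟧≡0 (v ∈? (E ∖ R)) (λ x → proj₂ (∈∖⁻ E R x) h′)))
  split v (yes h) (no h′)  = sym (cong₂ _+_ (⟦⟧≡0 (v ∈? (E ∩ R)) (h′ ∘ proj₂ ∘ x∈p∩q⁻ E R)) (⟦⟧≡1 (v ∈? (E ∖ R)) (∈∖⁺ h h′)))
  split v (no h)  _        = sym (cong₂ _+_ (⟦⟧≡0 (v ∈? (E ∩ R)) (h ∘ proj₁ ∘ x∈p∩q⁻ E R)) (⟦⟧≡0 (v ∈? (E ∖ R)) (h ∘ proj₁ ∘ ∈∖⁻ E R)))

-- Subfamilies with large degrees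

-- Describes the members that survive when only the sets of `𝒬` are still allowed as shadows, so
-- that pruning has to change `𝒬` alone.
Closed : Pred (Subset n) 0ℓ → Pred (Subset n) 0ℓ → Pred (Subset n) 0ℓ
Closed 𝒢 𝒬 g = 𝒢 g × (∀ a → a ∈ g → 𝒬 (g ⊖ a))

closed? : {𝒢 𝒬 : Pred (Subset n) 0ℓ} → Decidable 𝒢 → Decidable 𝒬 → Decidable (Closed 𝒢 𝒬)
closed? 𝒢? 𝒬? g = 𝒢? g ×-dec all? (λ a → (a ∈? g) →-dec 𝒬? (g ⊖ a))

extensions : {𝒢 : Pred (Subset n) 0ℓ} → Decidable 𝒢 → Subset n → ℕ
extensions 𝒢? P = ∑F (λ y → ⟦ ¬? (y ∈? P) ×-dec 𝒢? (P ⊕ y) ⟧)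

-- The exchange property behind the greedy embedding: any element of a member can be replaced in
-- more than `c` ways, itself included.
record FullSubfamily (c : ℕ) (𝒢 : Pred (Subset n) 0ℓ) : Set₁ where
  field
    ℱ        : Pred (Subset n) 0ℓ
    ℱ?       : Decidable ℱ
    ℱ⊆𝒢      : ∀ {g} → ℱ g → 𝒢 g
    nonempty : ∃[ g ] ℱ g
    full     : ∀ {g a} → ℱ g → a ∈ g → c < extensions ℱ? (g ⊖ a)

#-≟ˢ≡1 : (P : Subset n) → # (λ S → S ≟ˢ P) ≡ 1
#-≟ˢ≡1 []            = refl
#-≟ˢ≡1 {suc n} (outside ∷ P) = trans (∑S-suc (λ S → ⟦ S ≟ˢ (outside ∷ P) ⟧)) (cong₂ _+_
  (trans (∑-cong (allSubsets n) (λ S → ⟦⟧-cong ((outside ∷ S) ≟ˢ (outside ∷ P)) (S ≟ˢ P) (λ { refl → refl }) (cong (outside ∷_)))) (#-≟ˢ≡1 P))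
  (trans (∑-cong (allSubsets n) (λ S → ⟦⟧≡0 ((inside ∷ S) ≟ˢ (outside ∷ P)) λ ())) (∑-zero (allSubsets n))))
#-≟ˢ≡1 {suc n} (inside ∷ P) = trans (∑S-suc (λ S → ⟦ S ≟ˢ (inside ∷ P) ⟧)) (cong₂ _+_
  (trans (∑-cong (allSubsets n) (λ S → ⟦⟧≡0 ((outside ∷ S) ≟ˢ (inside ∷ P)) λ ())) (∑-zero (allSubsets n)))
  (trans (∑-cong (allSubsets n) (λ S → ⟦⟧-cong ((inside ∷ S) ≟ˢ (inside ∷ P)) (S ≟ˢ P) (λ { refl → refl }) (cong (inside ∷_)))) (#-≟ˢ≡1 P)))

-- Discard one by one the members of 𝒬 with few extensions.
full-subfamily : (c fuel : ℕ) {𝒢 𝒬 : Pred (Subset n) 0ℓ} (𝒢? : Decidable 𝒢) (𝒬? : Decidable 𝒬) →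
                 # 𝒬? ≤ fuel → c * # 𝒬? < # (closed? 𝒢? 𝒬?) → FullSubfamily c 𝒢
full-subfamily {n} c fuel {𝒢} {𝒬} 𝒢? 𝒬? le lt
  with anySubset? (λ P → 𝒬? P ×-dec (extensions (closed? 𝒢? 𝒬?) P ≤? c))
... | no ¬w = record
  { ℱ = Closed 𝒢 𝒬 ; ℱ? = closed? 𝒢? 𝒬? ; ℱ⊆𝒢 = proj₁
  ; nonempty = #-witness (closed? 𝒢? 𝒬?) (≤-trans (s≤s z≤n) lt)
  ; full = λ (_ , h) a∈g → ≰⇒> (λ few → ¬w (_ , h _ a∈g , few)) }
full-subfamily {n} c zero 𝒢? 𝒬? le lt | yes (P₀ , q , few) = contradiction (≤-trans (#-member 𝒬? q) le) λ ()
full-subfamily {n} c (suc fuel) {𝒢} {𝒬} 𝒢? 𝒬? le lt | yes (P₀ , q , few) =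
  full-subfamily c fuel 𝒢? 𝒬′? (≤-pred (≤-trans smaller le))
    -- Deleting `P₀` lowers the left side of the strict inequality by at least c and the right side
    -- by at most the extensions of `P₀`, which number at most c.
    (+-cancelˡ-< c (c * # 𝒬′?) _ (begin-strict
      c + c * # 𝒬′?      ≡⟨ sym (*-suc c (# 𝒬′?)) ⟩
      c * suc (# 𝒬′?)    ≤⟨ *-monoʳ-≤ c smaller ⟩
      c * # 𝒬?           <⟨ lt ⟩
      # (closed? 𝒢? 𝒬?)  ≤⟨ loss ⟩
      extensions (closed? 𝒢? 𝒬?) P₀ + # (closed? 𝒢? 𝒬′?) ≤⟨ +-monoˡ-≤ (# (closed? 𝒢? 𝒬′?)) few ⟩
      c + # (closed? 𝒢? 𝒬′?) ∎))
  where
  open ≤-Reasoning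
  𝒬′? : Decidable (λ P → 𝒬 P × P ≢ P₀)
  𝒬′? P = 𝒬? P ×-dec ¬? (P ≟ˢ P₀)
  smaller : suc (# 𝒬′?) ≤ # 𝒬?
  smaller = begin
    1 + # 𝒬′?                             ≤⟨ +-monoˡ-≤ (# 𝒬′?) (≤-reflexive (sym (#-≟ˢ≡1 P₀))) ⟩
    # (λ P → P ≟ˢ P₀) + # 𝒬′?             ≡⟨ sym (∑-+ (allSubsets n) _ _) ⟩
    ∑S (λ P → ⟦ P ≟ˢ P₀ ⟧ + ⟦ 𝒬′? P ⟧)    ≤⟨ ∑-mono (allSubsets n) (λ P → split P (𝒬? P) (P ≟ˢ P₀)) ⟩
    # 𝒬?                                  ∎
    where
    split : ∀ P (d : Dec (𝒬 P)) (e : Dec (P ≡ P₀)) → ⟦ e ⟧ + ⟦ d ×-dec ¬? e ⟧ ≤ ⟦ d ⟧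
    split P (yes _) (yes _) = ≤-refl
    split P (yes _) (no _)  = ≤-refl
    split P (no ¬q) (yes refl) = contradiction q ¬q
    split P (no _)  (no _)  = z≤n
  -- A member disappears only if it is `P₀` with one vertex added.
  loss : # (closed? 𝒢? 𝒬?) ≤ extensions (closed? 𝒢? 𝒬?) P₀ + # (closed? 𝒢? 𝒬′?)
  loss = begin
    # (closed? 𝒢? 𝒬?)
      ≤⟨ ∑-mono (allSubsets n) pointwise ⟩
    ∑S (λ g → ∑F (λ a → ⟦ a ∈? g ⟧ * (⟦ (g ⊖ a) ≟ˢ P₀ ⟧ * ⟦ closed? 𝒢? 𝒬? g ⟧)) + ⟦ closed? 𝒢? 𝒬′? g ⟧)
      ≡⟨ ∑-+ (allSubsets n) _ _ ⟩
    ∑S (λ g → ∑F (λ a → ⟦ a ∈? g ⟧ * (⟦ (g ⊖ a) ≟ˢ P₀ ⟧ * ⟦ closed? 𝒢? 𝒬? g ⟧))) + # (closed? 𝒢? 𝒬′?)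
      ≡⟨ cong (_+ # (closed? 𝒢? 𝒬′?)) (sym (double-count {n} (λ a P g → ⟦ P ≟ˢ P₀ ⟧ * ⟦ closed? 𝒢? 𝒬? g ⟧))) ⟩
    ∑S (λ P → ∑F (λ a → ⟦ ¬? (a ∈? P) ⟧ * (⟦ P ≟ˢ P₀ ⟧ * ⟦ closed? 𝒢? 𝒬? (P ⊕ a) ⟧))) + # (closed? 𝒢? 𝒬′?)
      ≤⟨ +-monoˡ-≤ (# (closed? 𝒢? 𝒬′?)) (∑-mono (allSubsets n) localize) ⟩
    ∑S (λ P → ⟦ P ≟ˢ P₀ ⟧ * extensions (closed? 𝒢? 𝒬?) P₀) + # (closed? 𝒢? 𝒬′?)
      ≡⟨ cong (_+ # (closed? 𝒢? 𝒬′?)) (trans (∑-*ʳ (allSubsets n) _ _) (trans (cong (_* extensions (closed? 𝒢? 𝒬?) P₀) (#-≟ˢ≡1 P₀)) (+-identityʳ _))) ⟩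
    extensions (closed? 𝒢? 𝒬?) P₀ + # (closed? 𝒢? 𝒬′?) ∎
    where
    pointwise : ∀ g → ⟦ closed? 𝒢? 𝒬? g ⟧ ≤
      ∑F (λ a → ⟦ a ∈? g ⟧ * (⟦ (g ⊖ a) ≟ˢ P₀ ⟧ * ⟦ closed? 𝒢? 𝒬? g ⟧)) + ⟦ closed? 𝒢? 𝒬′? g ⟧
    pointwise g with any? (λ a → (a ∈? g) ×-dec ((g ⊖ a) ≟ˢ P₀))
    ... | yes (a , a∈g , e) = ⟦⟧≤ (closed? 𝒢? 𝒬? g) (λ h → ≤-trans (≤-trans
            (1≤* (1≤⟦⟧ (a ∈? g) a∈g) (1≤* (1≤⟦⟧ ((g ⊖ a) ≟ˢ P₀) e) (1≤⟦⟧ (closed? 𝒢? 𝒬? g) h)))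
            (∑F-member (λ a → ⟦ a ∈? g ⟧ * (⟦ (g ⊖ a) ≟ˢ P₀ ⟧ * ⟦ closed? 𝒢? 𝒬? g ⟧)) a)) (m≤m+n _ _))
    ... | no ¬w = ≤-trans (⟦⟧-mono (closed? 𝒢? 𝒬? g) (closed? 𝒢? 𝒬′? g)
            (λ (h , h′) → h , λ a a∈g → h′ a a∈g , λ e → ¬w (a , a∈g , e))) (m≤n+m _ _)
    localize : ∀ P → ∑F (λ a → ⟦ ¬? (a ∈? P) ⟧ * (⟦ P ≟ˢ P₀ ⟧ * ⟦ closed? 𝒢? 𝒬? (P ⊕ a) ⟧)) ≤
                     ⟦ P ≟ˢ P₀ ⟧ * extensions (closed? 𝒢? 𝒬?) P₀
    localize P with P ≟ˢ P₀
    ... | no _ = ≤-reflexive (trans (∑-cong (allFin n) (λ a → *-zeroʳ ⟦ ¬? (a ∈? P) ⟧)) (∑-zero (allFin n)))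
    ... | yes refl = ≤-trans (≤-reflexive (∑-cong (allFin n) (λ a →
            trans (cong (⟦ ¬? (a ∈? P) ⟧ *_) (+-identityʳ _)) (sym (⟦⟧-× (¬? (a ∈? P)) (closed? 𝒢? 𝒬? (P ⊕ a))))))) (m≤m+n _ 0)

-- Greedy embedding of trees

update : (Fin t → Fin n) → Fin t → Fin n → Fin t → Fin n
update φ v y u with u ≟ᶠ v
... | yes _ = y
... | no _  = φ u

update-other : (φ : Fin t → Fin n) {v u : Fin t} (y : Fin n) → u ≢ v → update φ v y u ≡ φ u
update-other φ {v} {u} y u≢v with u ≟ᶠ v
... | yes e = contradiction e u≢v
... | no _  = refl

∈⋃-take : (L : List (Subset n)) (i : ℕ) (j : Fin (length L)) {v : Fin n} → toℕ j < i → v ∈ lookup L j → v ∈ ⋃ (take i L)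
∈⋃-take (E ∷ L) (suc i) zero    lt       h = x∈p∪q⁺ (inj₁ h)
∈⋃-take (E ∷ L) (suc i) (suc j) (s≤s lt) h = x∈p∪q⁺ (inj₂ (∈⋃-take L i j lt h))

-- `B` may be only part of an edge; the elements of `g` outside its image are then free to be
-- exchanged.
record Fits (ℱ : Pred (Subset n) 0ℓ) (φ : Fin t → Fin n) (B : Subset t) (g : Subset n) : Set where
  constructor fits
  field
    member    : ℱ g
    maps      : ∀ {v} → v ∈ B → φ v ∈ g
    distinct  : InjectiveOn φ B

open Fits

Fits-restrict : {ℱ : Pred (Subset n) 0ℓ} {φ ψ : Fin t → Fin n} {B B′ : Subset t} {g : Subset n} →
                (∀ {v} → v ∈ B′ → v ∈ B) → (∀ {v} → v ∈ B′ → ψ v ≡ φ v) → Fits ℱ φ B g → Fits ℱ ψ B′ g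
Fits-restrict {g = g} sub agree F = fits (member F)
  (λ h → subst (_∈ g) (sym (agree h)) (maps F (sub h)))
  (λ h h′ e → distinct F (sub h) (sub h′) (trans (sym (agree h)) (trans e (agree h′))))

module Greedy
  {s t n : ℕ} (f : Fin s → Fin t) (f-injective : ∀ {u v} → f u ≡ f v → u ≡ v)
  (k : ℕ) (Safe : Pred (Fin n) 0ℓ) (ℱ : Pred (Subset n) 0ℓ) (ℱ? : Decidable ℱ)
  (uniform : ∀ {g} → ℱ g → ∣ g ∣ ≡ k)
  (full : ∀ {g a} → ℱ g → a ∈ g → s < extensions ℱ? (g ⊖ a))
  (ℱ-safe : ∀ {g v} → ℱ g → v ∈ g → Safe v)
  where

  -- Only the composite with `f` is injective: tree vertices that do not come from H may share
  -- values as long as each edge is mapped injectively. As `φ` is total from the start, injectivity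
  -- includes the provisional values of vertices not yet placed.
  record Admissible (φ : Fin t → Fin n) : Set where
    constructor admissible
    field
      injects : ∀ {u v} → φ (f u) ≡ φ (f v) → u ≡ v
      safe    : ∀ v → Safe (φ v)

  open Admissible

  -- The member g of ℱ that contains the image of U is exchanged for one that leaves room for a new value at v.
  extend-vertex : (B U : Subset t) → ∣ B ∣ ≤ k → U ⊆ B → {v : Fin t} → v ∈ B → v ∉ U →
                  {φ : Fin t → Fin n} {g : Subset n} → Admissible φ → Fits ℱ φ U g →
                  ∃[ y ] (Admissible (update φ v y) × ∃[ g′ ] Fits ℱ (update φ v y) (U ⊕ v) g′)
  extend-vertex B U B≤k U⊆B {v} v∈B v∉U {φ} {g} ad F
    -- `U` misses `v`, so it has fewer than k elements and some z in `g` is not the image of any of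
    -- them.
    with fresh U φ (_∈? g) (subst (∣ U ∣ <_) (trans (sym (uniform (member F))) (∣∣≡∑ g))
                              (≤-trans (p⊂q⇒∣p∣<∣q∣ (U⊆B , v , v∈B , v∉U)) B≤k))
  ... | z , z∈g , z-free
    -- More than s candidates against the s current images of the vertices of H.
    with fresh ⊤ (φ ∘ f) (λ y → ¬? (y ∈? (g ⊖ z)) ×-dec ℱ? ((g ⊖ z) ⊕ y))
           (≤-trans (≤-reflexive (cong suc (∣⊤∣≡n s))) (full (member F) z∈g))
  ...   | y , (y∉ , ℱg′) , y-free = y , admissible inj′ safe′ , (g ⊖ z) ⊕ y , fits ℱg′ maps′ injective′
    where
    φ′ = update φ v y
    inj′ : ∀ {a b} → φ′ (f a) ≡ φ′ (f b) → a ≡ b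
    inj′ {a} {b} e with f a ≟ᶠ v | f b ≟ᶠ v
    ... | yes p | yes q = f-injective (trans p (sym q))
    ... | yes p | no _  = contradiction (sym e) (y-free ∈⊤)
    ... | no _  | yes q = contradiction e (y-free ∈⊤)
    ... | no _  | no _  = injects ad e
    safe′ : ∀ u → Safe (φ′ u)
    safe′ u with u ≟ᶠ v
    ... | yes _ = ℱ-safe ℱg′ (∈⊕-self (g ⊖ z) y)
    ... | no _  = safe ad u
    old : ∀ {u} → u ∈ U → φ u ∈ g ⊖ z
    old u∈U = ∈⊖⁺ (maps F u∈U) (z-free u∈U)
    maps′ : ∀ {u} → u ∈ U ⊕ v → φ′ u ∈ (g ⊖ z) ⊕ y
    maps′ {u} h with u ≟ᶠ v
    ... | yes _  = ∈⊕-self (g ⊖ z) y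
    ... | no u≢v = ∈⊕-other y (old (∈⊕-≢ h u≢v))
    injective′ : InjectiveOn φ′ (U ⊕ v)
    injective′ {a} {b} h h′ e with a ≟ᶠ v | b ≟ᶠ v
    ... | yes p | yes q = trans p (sym q)
    ... | yes p | no b≢ = contradiction (subst (_∈ g ⊖ z) (sym e) (old (∈⊕-≢ h′ b≢))) y∉
    ... | no a≢ | yes q = contradiction (subst (_∈ g ⊖ z) e (old (∈⊕-≢ h a≢))) y∉
    ... | no a≢ | no b≢ = distinct F (∈⊕-≢ h a≢) (∈⊕-≢ h′ b≢) e

  -- Freezing the values on `U` and outside `B` is what protects earlier edges: when `U` is the old
  -- part of the new edge `B`, every old vertex is of one of these two kinds.
  extend-set : (B : Subset t) → ∣ B ∣ ≤ k → (vs : List (Fin t)) (U : Subset t) → U ⊆ B →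
               {φ : Fin t → Fin n} {g : Subset n} → Admissible φ → Fits ℱ φ U g →
               ∃[ φ′ ] (Admissible φ′ × (∀ {u} → u ∈ U ⊎ u ∉ B → φ′ u ≡ φ u) ×
                 ∃[ U′ ] ∃[ g′ ] (U ⊆ U′ × (∀ {v} → v List∈.∈ vs → v ∈ B → v ∈ U′) × Fits ℱ φ′ U′ g′))
  extend-set B B≤k [] U U⊆B {φ} {g} ad F = φ , ad , (λ _ → refl) , U , g , id , (λ ()) , F
  extend-set B B≤k (v ∷ vs) U U⊆B {φ} {g} ad F with v ∈? B | v ∈? U
  ... | no v∉B | _ with extend-set B B≤k vs U U⊆B ad F
  ...   | φ′ , ad′ , agree , U′ , g′ , U⊆ , covers , F′ =
          φ′ , ad′ , agree , U′ , g′ , U⊆ , (λ { (here refl) h → contradiction h v∉B ; (there h) → covers h }) , F′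
  extend-set B B≤k (v ∷ vs) U U⊆B {φ} {g} ad F | yes v∈B | yes v∈U with extend-set B B≤k vs U U⊆B ad F
  ...   | φ′ , ad′ , agree , U′ , g′ , U⊆ , covers , F′ =
          φ′ , ad′ , agree , U′ , g′ , U⊆ , (λ { (here refl) _ → U⊆ v∈U ; (there h) → covers h }) , F′
  extend-set B B≤k (v ∷ vs) U U⊆B {φ} {g} ad F | yes v∈B | no v∉U
    with extend-vertex B U B≤k U⊆B v∈B v∉U ad F
  ... | y , ad₁ , g₁ , F₁
    with extend-set B B≤k vs (U ⊕ v) (λ h → [ (λ { refl → v∈B }) , U⊆B ]′ (∈⊕⁻ h)) ad₁ F₁
  ...   | φ′ , ad′ , agree , U′ , g′ , U⊆ , covers , F′ =
          φ′ , ad′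
          , (λ { (inj₁ u∈U) → trans (agree (inj₁ (∈⊕-other v u∈U))) (update-other φ y (λ { refl → v∉U u∈U }))
               ; (inj₂ u∉B) → trans (agree (inj₂ u∉B)) (update-other φ y (λ { refl → u∉B v∈B })) })
          , U′ , g′ , (U⊆ ∘ ∈⊕-other v)
          , (λ { (here refl) _ → U⊆ (∈⊕-self U v) ; (there h) → covers h }) , F′

  extend-edge : (B O : Subset t) → ∣ B ∣ ≤ k → {φ : Fin t → Fin n} {g : Subset n} →
                Admissible φ → Fits ℱ φ (B ∩ O) g →
                ∃[ φ′ ] (Admissible φ′ × (∀ {u} → u ∈ O → φ′ u ≡ φ u) × ∃[ g′ ] Fits ℱ φ′ B g′)
  extend-edge B O B≤k ad F with extend-set B B≤k (allFin t) (B ∩ O) (proj₁ ∘ x∈p∩q⁻ B O) ad F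
  ... | φ′ , ad′ , agree , U′ , g′ , _ , covers , F′ =
    φ′ , ad′
    , (λ {u} u∈O → agree (case u ∈? B of λ { (yes u∈B) → inj₁ (x∈p∩q⁺ (u∈B , u∈O)) ; (no u∉B) → inj₂ u∉B }))
    , g′ , Fits-restrict (λ {v} → covers (∈-allFin v)) (λ _ → refl) F′

  -- By the tree order, the old part of a new edge lies in a single earlier edge, so the member of
  -- `ℱ` found for that edge can serve as the starting point. The first edge has no old part and
  -- starts from an arbitrary member.
  embed-tree : ∃[ g ] ℱ g → (L : List (Subset t)) → TreeOrdered L → (R : Subset t) →
               (∀ j → ∣ lookup L j ∖ R ∣ ≤ k) → {φ₀ : Fin t → Fin n} → Admissible φ₀ →
               ∀ i → i ≤ length L →
               ∃[ φ ] (Admissible φ × (∀ j → toℕ j < i → ∃[ g ] Fits ℱ φ (lookup L j ∖ R) g))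
  embed-tree _ L tree R small {φ₀} ad₀ zero le = φ₀ , ad₀ , λ j ()
  embed-tree (g₀ , ℱg₀) L tree R small ad₀ (suc i) i<len
    with embed-tree (g₀ , ℱg₀) L tree R small ad₀ i (<⇒≤ i<len)
  ... | φ , ad , placed = conclude (extend-edge B O (small ix) ad (proj₂ start))
    where
    ix = fromℕ< i<len
    ix≡i : toℕ ix ≡ i
    ix≡i = toℕ-fromℕ< i<len
    B = lookup L ix ∖ R
    O = ⋃ (take i L)
    start : ∃[ g ] Fits ℱ φ (B ∩ O) g
    start with i ≟ 0
    ... | yes refl = g₀ , fits ℱg₀ (λ h → contradiction (proj₂ (x∈p∩q⁻ B O h)) ∉⊥)
                              (λ h → contradiction (proj₂ (x∈p∩q⁻ B O h)) ∉⊥)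
    ... | no i≢0 with tree ix (subst (0 <_) (sym ix≡i) (n≢0⇒n>0 i≢0))
    ...   | j , j<ix , sub with placed j (subst (toℕ j <_) ix≡i j<ix)
    ...     | g , F = g , Fits-restrict (λ {v} h → let h₁ , h₂ = x∈p∩q⁻ B O h
                                                       h₃ , h₄ = ∈∖⁻ (lookup L ix) R h₁ in
                ∈∖⁺ (sub (x∈p∩q⁺ (h₃ , subst (λ z → v ∈ ⋃ (take z L)) (sym ix≡i) h₂))) h₄) (λ _ → refl) F
    conclude : ∃[ φ′ ] (Admissible φ′ × (∀ {u} → u ∈ O → φ′ u ≡ φ u) × ∃[ g′ ] Fits ℱ φ′ B g′) →
               ∃[ φ ] (Admissible φ × (∀ j → toℕ j < suc i → ∃[ g ] Fits ℱ φ (lookup L j ∖ R) g))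
    conclude (φ′ , ad′ , agree , g′ , F′) = φ′ , ad′ , λ j j<1+i → case toℕ j ≟ i of λ
      { (yes j≡i) → g′ , subst (λ j → Fits ℱ φ′ (lookup L j ∖ R) g′) (toℕ-injective (trans ix≡i (sym j≡i))) F′
      ; (no j≢i) → let j<i = ≤∧≢⇒< (≤-pred j<1+i) j≢i
                       g , F = placed j j<i in
          g , Fits-restrict id (λ h → agree (∈⋃-take L i j j<i (proj₁ (∈∖⁻ (lookup L j) R h)))) F }

-- Trimming a two-reducible tree

hit? : (f : Fin s → Fin t) (e : Subset s) → Decidable (λ w → ∃[ v ] (v ∈ e × f v ≡ w))
hit? f e w = any? (λ v → (v ∈? e) ×-dec (f v ≟ᶠ w))

image≡ : (f : Fin s → Fin t) (e : Subset s) → image f e ≡ comprehension (hit? f e)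
image≡ f e = Vecₚ.tabulate-cong (λ w → isYes≗does (hit? f e w))

image⁺ : (f : Fin s → Fin t) {e : Subset s} {v : Fin s} → v ∈ e → f v ∈ image f e
image⁺ f {e} {v} v∈e = subst (f v ∈_) (sym (image≡ f e)) (∈-comprehension⁺ (hit? f e) (v , v∈e , refl))

image⁻ : (f : Fin s → Fin t) {e : Subset s} {w : Fin t} → w ∈ image f e → ∃[ v ] (v ∈ e × f v ≡ w)
image⁻ f {e} h = ∈-comprehension⁻ (hit? f e) (subst (_ ∈_) (image≡ f e) h)

injectiveOn⇒∣∣≤ : (A : Subset s) {B : Subset t} (φ : Fin s → Fin t) → (∀ {v} → v ∈ A → φ v ∈ B) →
                  InjectiveOn φ A → ∣ A ∣ ≤ ∣ B ∣
injectiveOn⇒∣∣≤ []            φ sub inj = z≤n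
injectiveOn⇒∣∣≤ (outside ∷ A) φ sub inj = injectiveOn⇒∣∣≤ A (φ ∘ suc) (sub ∘ there) (λ h h′ e → suc-injectiveᶠ (inj (there h) (there h′) e))
injectiveOn⇒∣∣≤ (inside ∷ A) {B} φ sub inj = ≤-trans (s≤s (injectiveOn⇒∣∣≤ A {B ⊖ φ zero} (φ ∘ suc)
    (λ h → ∈⊖⁺ (sub (there h)) (λ e → case inj (there h) here e of λ ()))
    (λ h h′ e → suc-injectiveᶠ (inj (there h) (there h′) e)))) (≤-reflexive (∣⊖∣ (sub here)))

∣image∣≤ : (f : Fin s → Fin t) (e : Subset s) → ∣ image f e ∣ ≤ ∣ e ∣
∣image∣≤ {t = t} f [] = ≤-reflexive (trans (cong ∣_∣ (Empty-unique {p = image f []} (λ (w , h) → case proj₁ (image⁻ f {[]} h) of λ ()))) (∣⊥∣≡0 t))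
∣image∣≤ f (outside ∷ e) = ≤-trans (p⊆q⇒∣p∣≤∣q∣ {p = image f (outside ∷ e)} {image (f ∘ suc) e}
  (λ h → case image⁻ f {outside ∷ e} h of λ { (suc v , there v∈e , refl) → image⁺ (f ∘ suc) v∈e })) (∣image∣≤ (f ∘ suc) e)
∣image∣≤ f (inside ∷ e) = ≤-trans (p⊆q⇒∣p∣≤∣q∣ {p = image f (inside ∷ e)} {image (f ∘ suc) e ⊕ f zero}
  (λ h → case image⁻ f {inside ∷ e} h of λ { (zero , here , refl) → ∈⊕-self (image (f ∘ suc) e) (f zero)
                                           ; (suc v , there v∈e , refl) → ∈⊕-other (f zero) (image⁺ (f ∘ suc) v∈e) }))
  (≤-trans (∣⊕∣≤ (image (f ∘ suc) e) (f zero)) (s≤s (∣image∣≤ (f ∘ suc) e)))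

∣image∣ : (f : Fin s → Fin t) → (∀ {u v} → f u ≡ f v → u ≡ v) → (e : Subset s) → ∣ image f e ∣ ≡ ∣ e ∣
∣image∣ f f-inj e = ≤-antisym (∣image∣≤ f e) (injectiveOn⇒∣∣≤ e f (image⁺ f) (λ _ _ → f-inj))

∈image-injective : (f : Fin s → Fin t) → (∀ {u v} → f u ≡ f v → u ≡ v) → {e : Subset s} {v : Fin s} → f v ∈ image f e → v ∈ e
∈image-injective f f-inj {e} h with image⁻ f h
... | u , u∈e , eq = subst (_∈ e) (f-inj eq) u∈e

image-injective : (f : Fin s → Fin t) → (∀ {u v} → f u ≡ f v → u ≡ v) → {e e′ : Subset s} → image f e ≡ image f e′ → e ≡ e′
image-injective f f-inj eq = ⊆-antisym (λ h → ∈image-injective f f-inj (subst (_ ∈_) eq (image⁺ f h)))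
                                       (λ h → ∈image-injective f f-inj (subst (_ ∈_) (sym eq) (image⁺ f h)))

filter-unique : {A : Set} {P : Pred A 0ℓ} (P? : Decidable P) (xs : List A) → length (filter P? xs) ≡ 1 →
                ∀ {x y} → x List∈.∈ xs → y List∈.∈ xs → P x → P y → x ≡ y
filter-unique P? xs len x∈ y∈ px py with filter P? xs | ∈-filter⁺ P? x∈ px | ∈-filter⁺ P? y∈ py
... | _ ∷ [] | here refl | here refl = refl

degree-one : (T : List (Subset t)) {v : Fin t} {E E′ : Subset t} → degree T v ≡ 1 →
             E List∈.∈ T → E′ List∈.∈ T → v ∈ E → v ∈ E′ → E ≡ E′
degree-one T {v} deg = filter-unique (v ∈?_) T deg

module Trim {t r k : ℕ} (T : List (Subset t)) (uniform : ∀ {E} → E List∈.∈ T → ∣ E ∣ ≡ r)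
            (reducible : ∀ {E} → E List∈.∈ T → 2 ≤ degOneCount T E) (r≤2+k : r ≤ 2 + k) (R₀ : Subset t) where

  privates : Subset t → Subset t
  privates E = comprehension (λ v → (v ∈? E) ×-dec (degree T v ≟ 1))

  available : Subset t → Subset t
  available E = privates E ∖ R₀

  private⁻ : ∀ {E v} → v ∈ privates E → v ∈ E × degree T v ≡ 1
  private⁻ {E} = ∈-comprehension⁻ (λ v → (v ∈? E) ×-dec (degree T v ≟ 1))

  -- The size is the excess over k of the part of E outside `R₀`. The minimum makes the choice
  -- possible for every set E; on edges of `T` it has no effect, by `enough`.
  trim : Subset t → Subset t
  trim E = proj₁ (subset-of-size (available E) ((∣ E ∖ R₀ ∣ ∸ k) ⊓ ∣ available E ∣) (m⊓n≤n _ _))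

  trim⊆ : ∀ {E} → trim E ⊆ available E
  trim⊆ {E} = proj₁ (proj₂ (subset-of-size (available E) ((∣ E ∖ R₀ ∣ ∸ k) ⊓ ∣ available E ∣) (m⊓n≤n _ _)))

  trim-private : ∀ {E v} → v ∈ trim E → v ∈ E × degree T v ≡ 1 × v ∉ R₀
  trim-private {E} h = let h₁ , h₂ = ∈∖⁻ (privates E) R₀ (trim⊆ h)
                           h₃ , h₄ = private⁻ h₁ in h₃ , h₄ , h₂

  -- An edge has at most r - 2 ≤ k vertices that are not private, so everything beyond k can be
  -- taken from the private ones.
  enough : ∀ {E} → E List∈.∈ T → ∣ E ∖ R₀ ∣ ∸ k ≤ ∣ available E ∣
  enough {E} E∈T = m≤n+o⇒m∸n≤o ∣ E ∖ R₀ ∣ k (begin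
    ∣ E ∖ R₀ ∣
      ≡⟨ ∣∣-split (E ∖ R₀) (privates E) ⟩
    ∣ (E ∖ R₀) ∩ privates E ∣ + ∣ (E ∖ R₀) ∖ privates E ∣
      ≤⟨ +-mono-≤ (p⊆q⇒∣p∣≤∣q∣ {p = (E ∖ R₀) ∩ privates E} {available E}
            (λ h → let h₁ , h₂ = x∈p∩q⁻ (E ∖ R₀) (privates E) h in ∈∖⁺ h₂ (proj₂ (∈∖⁻ E R₀ h₁))))
          (p⊆q⇒∣p∣≤∣q∣ {p = (E ∖ R₀) ∖ privates E} {E ∖ privates E}
            (λ h → let h₁ , h₂ = ∈∖⁻ (E ∖ R₀) (privates E) h in ∈∖⁺ (proj₁ (∈∖⁻ E R₀ h₁)) h₂)) ⟩
    ∣ available E ∣ + ∣ E ∖ privates E ∣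
      ≤⟨ +-monoʳ-≤ ∣ available E ∣ (≤-pred (≤-pred (begin
            2 + ∣ E ∖ privates E ∣
              ≤⟨ +-monoˡ-≤ ∣ E ∖ privates E ∣ (≤-trans (reducible E∈T) (≤-trans (≤-reflexive (trans
                   (length-filter (λ v → (v ∈? E) ×-dec (degree T v ≟ 1)) (allFin t)) (sym (∣comprehension∣ (λ v → (v ∈? E) ×-dec (degree T v ≟ 1))))))
                   (p⊆q⇒∣p∣≤∣q∣ {p = privates E} {E ∩ privates E} (λ h → x∈p∩q⁺ (proj₁ (private⁻ h) , h))))) ⟩
            ∣ E ∩ privates E ∣ + ∣ E ∖ privates E ∣ ≡⟨ sym (∣∣-split E (privates E)) ⟩
            ∣ E ∣ ≡⟨ uniform E∈T ⟩
            r ≤⟨ r≤2+k ⟩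
            2 + k ∎))) ⟩
    ∣ available E ∣ + k ≡⟨ +-comm ∣ available E ∣ k ⟩
    k + ∣ available E ∣ ∎)
    where open ≤-Reasoning

  ∣trim∣ : ∀ {E} → E List∈.∈ T → ∣ trim E ∣ ≡ ∣ E ∖ R₀ ∣ ∸ k
  ∣trim∣ {E} E∈T = trans (proj₂ (proj₂ (subset-of-size (available E) ((∣ E ∖ R₀ ∣ ∸ k) ⊓ ∣ available E ∣) (m⊓n≤n _ _))))
                         (m≤n⇒m⊓n≡m (enough E∈T))

  removed? : Decidable (λ v → v ∈ R₀ ⊎ Any (λ E → v ∈ trim E) T)
  removed? v = (v ∈? R₀) ⊎-dec Any.any? (λ E → v ∈? trim E) T

  removed : Subset t
  removed = comprehension removed?

  R₀⊆removed : R₀ ⊆ removed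
  R₀⊆removed h = ∈-comprehension⁺ removed? (inj₁ h)

  removed-private : ∀ {v} → v ∈ removed → v ∉ R₀ → degree T v ≡ 1
  removed-private {v} h v∉R₀ with ∈-comprehension⁻ removed? h
  ... | inj₁ v∈R₀ = contradiction v∈R₀ v∉R₀
  ... | inj₂ any with List∈.find any
  ...   | E , E∈T , v∈trim = proj₁ (proj₂ (trim-private v∈trim))

  -- A vertex trimmed from another edge has degree one and hence is not in E: the edges are trimmed
  -- independently.
  ∖removed : ∀ {E} → E List∈.∈ T → E ∖ removed ≡ (E ∖ R₀) ∖ trim E
  ∖removed {E} E∈T = ⊆-antisym
    (λ h → let h₁ , h₂ = ∈∖⁻ E removed h in
       ∈∖⁺ (∈∖⁺ h₁ (h₂ ∘ R₀⊆removed)) (λ h₃ → h₂ (∈-comprehension⁺ removed? (inj₂ (List∈.lose E∈T h₃)))))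
    (λ h → let h₁ , h₂ = ∈∖⁻ (E ∖ R₀) (trim E) h
               h₃ , h₄ = ∈∖⁻ E R₀ h₁ in
       ∈∖⁺ h₃ (λ h₅ → [ h₄ , (λ any → let E′ , E′∈T , h₆ = List∈.find any
                                          h₇ , deg , _ = trim-private h₆ in
                               h₂ (subst (λ E → _ ∈ trim E) (degree-one T deg E′∈T E∈T h₇ h₃) h₆)) ]′
                        (∈-comprehension⁻ removed? h₅)))

  ∣∖removed∣ : ∀ {E} → E List∈.∈ T → ∣ E ∖ removed ∣ ≡ ∣ E ∖ R₀ ∣ ∸ (∣ E ∖ R₀ ∣ ∸ k)
  ∣∖removed∣ {E} E∈T = begin
    ∣ E ∖ removed ∣                               ≡⟨ cong ∣_∣ (∖removed E∈T) ⟩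
    ∣ (E ∖ R₀) ∖ trim E ∣                         ≡⟨ sym (m+n∸m≡n ∣ trim E ∣ _) ⟩
    ∣ trim E ∣ + ∣ (E ∖ R₀) ∖ trim E ∣ ∸ ∣ trim E ∣ ≡⟨ cong (λ z → ∣ z ∣ + ∣ (E ∖ R₀) ∖ trim E ∣ ∸ ∣ trim E ∣) (sym absorb) ⟩
    ∣ (E ∖ R₀) ∩ trim E ∣ + ∣ (E ∖ R₀) ∖ trim E ∣ ∸ ∣ trim E ∣ ≡⟨ cong₂ _∸_ (sym (∣∣-split (E ∖ R₀) (trim E))) (∣trim∣ E∈T) ⟩
    ∣ E ∖ R₀ ∣ ∸ (∣ E ∖ R₀ ∣ ∸ k) ∎
    where
    open ≡-Reasoning
    absorb : (E ∖ R₀) ∩ trim E ≡ trim E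
    absorb = ⊆-antisym (proj₂ ∘ x∈p∩q⁻ (E ∖ R₀) (trim E))
      (λ h → let h₁ , _ , h₂ = trim-private h in x∈p∩q⁺ (∈∖⁺ h₁ h₂ , h))

  ∣∖removed∣≤ : ∀ {E} → E List∈.∈ T → ∣ E ∖ removed ∣ ≤ k
  ∣∖removed∣≤ {E} E∈T = ≤-trans (≤-reflexive (∣∖removed∣ E∈T))
    (m≤n+o⇒m∸n≤o ∣ E ∖ R₀ ∣ (∣ E ∖ R₀ ∣ ∸ k) (≤-trans (m≤n+m∸n ∣ E ∖ R₀ ∣ k) (≤-reflexive (+-comm k _))))

  ∣∖removed∣≡ : ∀ {E} → E List∈.∈ T → k ≤ ∣ E ∖ R₀ ∣ → ∣ E ∖ removed ∣ ≡ k
  ∣∖removed∣≡ E∈T le = trans (∣∖removed∣ E∈T) (m∸[m∸n]≡n le)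

-- `X` will be a cross-cut or empty, and `reserved` holds the trimmed vertices of H. The map `ψ` is
-- defined and injective on these as well, but its values there are provisional.
record Placement (H : List (Subset s)) (X : Subset s) (k : ℕ) (Safe : Pred (Fin n) 0ℓ) (𝒢 : Pred (Subset n) 0ℓ) : Set where
  field
    ψ         : Fin s → Fin n
    injective : ∀ {u v} → ψ u ≡ ψ v → u ≡ v
    safe      : ∀ v → Safe (ψ v)
    reserved  : Subset s
    disjoint  : ∀ {v} → v ∈ reserved → v ∉ X
    private-to : ∀ {v e e′} → v ∈ reserved → e List∈.∈ H → e′ List∈.∈ H → v ∈ e → v ∈ e′ → e ≡ e′
    core-size : ∀ {e} → e List∈.∈ H → ∣ (e ∖ X) ∖ reserved ∣ ≡ k
    placed    : ∀ {e} → e List∈.∈ H → ∃[ g ] (𝒢 g × (∀ {v} → v ∈ (e ∖ X) ∖ reserved → ψ v ∈ g))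

place : {r k : ℕ} {H : List (Subset s)} (T : List (Subset t)) → IsRTree r T → TwoReducible T → Embeds H T →
        r ≤ 2 + k → (X : Subset s) → (∀ {e} → e List∈.∈ H → k ≤ ∣ e ∖ X ∣) →
        {𝒢 : Pred (Subset n) 0ℓ} → FullSubfamily s 𝒢 → (∀ {g} → 𝒢 g → ∣ g ∣ ≡ k) →
        {Safe : Pred (Fin n) 0ℓ} → (∀ {g v} → 𝒢 g → v ∈ g → Safe v) →
        (φ₀ : Fin s → Fin n) → (∀ {u v} → φ₀ u ≡ φ₀ v → u ≡ v) → (∀ v → Safe (φ₀ v)) → ∃[ d ] Safe d →
        Placement H X k Safe 𝒢
place {s = s} {t = t} {n = n} {r} {k} {H} T ((_ , uniform) , L , L↭T , ordered) reducible (f , f-injective , H⊆T) r≤2+k X core {𝒢} 𝓕 size {Safe} 𝒢-safe φ₀ φ₀-inj φ₀-safe (d , d-safe) =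
  conclude (embed-tree nonempty L ordered removed (λ j → ∣∖removed∣≤ (∈-resp-↭ L↭T (∈-lookup j)))
             (admissible start-inj start-safe) (length L) ≤-refl)
  where
  open FullSubfamily 𝓕
  R₀ = image f X
  open Trim {k = k} T (All.lookup uniform) (All.lookup reducible) r≤2+k R₀
  open Greedy f f-injective k Safe ℱ ℱ? (size ∘ ℱ⊆𝒢) full (𝒢-safe ∘ ℱ⊆𝒢)
  open Admissible
  preimage? : ∀ w → Dec (∃[ u ] f u ≡ w)
  preimage? w = any? (λ u → f u ≟ᶠ w)
  -- The greedy embedding needs a total admissible map to begin with: the vertices coming from H get
  -- distinct safe values, all other tree vertices the same safe value `d`.
  start : Fin t → Fin n
  start w with preimage? w
  ... | yes (u , _) = φ₀ u
  ... | no _        = d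
  start-f : ∀ u → start (f u) ≡ φ₀ u
  start-f u with preimage? (f u)
  ... | yes (u′ , e) = cong φ₀ (f-injective e)
  ... | no ¬w        = contradiction (u , refl) ¬w
  start-inj : ∀ {u v} → start (f u) ≡ start (f v) → u ≡ v
  start-inj {u} {v} e = φ₀-inj (trans (sym (start-f u)) (trans e (start-f v)))
  start-safe : ∀ w → Safe (start w)
  start-safe w with preimage? w
  ... | yes (u , _) = φ₀-safe u
  ... | no _        = d-safe
  reserved? : Decidable (λ v → f v ∈ removed × v ∉ X)
  reserved? v = (f v ∈? removed) ×-dec ¬? (v ∈? X)
  Q = comprehension reserved?
  image∈T : ∀ {e} → e List∈.∈ H → image f e List∈.∈ T
  image∈T = All.lookup H⊆T
  ∉R₀ : ∀ {v} → v ∉ X → f v ∉ R₀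
  ∉R₀ v∉X h = v∉X (∈image-injective f f-injective h)
  image-∖R₀ : ∀ e → image f (e ∖ X) ≡ image f e ∖ R₀
  image-∖R₀ e = ⊆-antisym
    (λ h → let v , h₁ , eq = image⁻ f h ; h₂ , h₃ = ∈∖⁻ e X h₁ in
       subst (_∈ image f e ∖ R₀) eq (∈∖⁺ (image⁺ f h₂) (∉R₀ h₃)))
    (λ h → let h₁ , h₂ = ∈∖⁻ (image f e) R₀ h ; v , h₃ , eq = image⁻ f h₁ in
       subst (_∈ image f (e ∖ X)) eq (image⁺ f (∈∖⁺ h₃ (λ v∈X → h₂ (subst (_∈ R₀) eq (image⁺ f v∈X))))))
  core⁻ : ∀ {e v} → v ∈ (e ∖ X) ∖ Q → v ∈ e × f v ∉ removed
  core⁻ {e} h = let h₁ , h₂ = ∈∖⁻ (e ∖ X) Q h ; h₃ , h₄ = ∈∖⁻ e X h₁ in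
    h₃ , λ h₅ → h₂ (∈-comprehension⁺ reserved? (h₅ , h₄))
  image-core : ∀ e → image f ((e ∖ X) ∖ Q) ≡ image f e ∖ removed
  image-core e = ⊆-antisym
    (λ h → let v , h₁ , eq = image⁻ f h ; h₂ , h₃ = core⁻ {e} h₁ in
       subst (_∈ image f e ∖ removed) eq (∈∖⁺ (image⁺ f h₂) h₃))
    (λ h → let h₁ , h₂ = ∈∖⁻ (image f e) removed h ; v , h₃ , eq = image⁻ f h₁ in
       subst (_∈ image f ((e ∖ X) ∖ Q)) eq (image⁺ f (∈∖⁺ (∈∖⁺ h₃
         (λ v∈X → h₂ (subst (_∈ removed) eq (R₀⊆removed (image⁺ f v∈X)))))
         (λ v∈Q → h₂ (subst (_∈ removed) eq (proj₁ (∈-comprehension⁻ reserved? v∈Q)))))))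
  conclude : ∃[ φ ] (Admissible φ × (∀ j → toℕ j < length L → ∃[ g ] Fits ℱ φ (lookup L j ∖ removed) g)) →
             Placement H X k Safe 𝒢
  conclude (φ , ad , fit) = record
    { ψ = φ ∘ f ; injective = injects ad ; safe = λ v → safe ad (f v) ; reserved = Q
    ; disjoint = proj₂ ∘ ∈-comprehension⁻ reserved?
    ; private-to = λ v∈Q e∈H e′∈H v∈e v∈e′ → let h , v∉X = ∈-comprehension⁻ reserved? v∈Q in
        image-injective f f-injective (degree-one T (removed-private h (∉R₀ v∉X)) (image∈T e∈H) (image∈T e′∈H) (image⁺ f v∈e) (image⁺ f v∈e′))
    ; core-size = λ {e} e∈H → trans (sym (∣image∣ f f-injective ((e ∖ X) ∖ Q))) (trans (cong ∣_∣ (image-core e))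
        (∣∖removed∣≡ (image∈T e∈H) (subst (k ≤_) (trans (sym (∣image∣ f f-injective (e ∖ X))) (cong ∣_∣ (image-∖R₀ e))) (core e∈H))))
    ; placed = λ {e} e∈H →
        let e∈L = ∈-resp-↭ (↭-sym L↭T) (image∈T e∈H)
            g , F = fit (Any.index e∈L) (toℕ<n _)
            eq = lookup-index e∈L
        in g , ℱ⊆𝒢 (Fits.member F) , λ h → let h₁ , h₂ = core⁻ {e} h in
             Fits.maps F (∈∖⁺ (subst (_ ∈_) eq (image⁺ f h₁)) h₂) }

-- Completing a placement by the reserved vertices

module Completion {s n r : ℕ} {H : List (Subset s)} {F : List (Subset n)}
  (H-uniform : ∀ {e} → e List∈.∈ H → ∣ e ∣ ≡ r) (F-uniform : ∀ {E} → E List∈.∈ F → ∣ E ∣ ≡ r)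
  (Q : Subset s)
  (private-to : ∀ {v e e′} → v ∈ Q → e List∈.∈ H → e′ List∈.∈ H → v ∈ e → v ∈ e′ → e ≡ e′) where

  -- `Y` is the current map on all vertices of H. New values avoid all of its values, even those
  -- about to be overwritten, so the replacement keeps the map injective.
  Extension : (Fin s → Fin n) → Subset s → (Fin s → Fin n) → Set
  Extension ψ e Y = ∃[ χ ] ((∀ {v} → v ∈ e ∩ Q → ∀ u → χ v ≢ Y u) × InjectiveOn χ (e ∩ Q) ×
    ∃[ E ] (E List∈.∈ F × (∀ {v} → v ∈ e ∩ Q → χ v ∈ E) × (∀ {v} → v ∈ e → v ∉ Q → ψ v ∈ E)))

  -- A reserved vertex lies in only one edge of H, so giving it its final value cannot spoil an edge
  -- completed before.
  complete-list : (ψ : Fin s → Fin n) → (∀ {u v} → ψ u ≡ ψ v → u ≡ v) →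
                  (∀ {e} → e List∈.∈ H → ∀ Y → Extension ψ e Y) →
                  (es : List (Subset s)) → (∀ {e} → e List∈.∈ es → e List∈.∈ H) →
                  ∃[ θ ] ((∀ {u v} → θ u ≡ θ v → u ≡ v) × (∀ {v} → v ∉ Q → θ v ≡ ψ v) ×
                    (∀ {e} → e List∈.∈ es → ∃[ E ] (E List∈.∈ F × (∀ {v} → v ∈ e → θ v ∈ E))))
  complete-list ψ inj extend [] sub = ψ , inj , (λ _ → refl) , λ ()
  complete-list ψ inj extend (e ∷ es) sub with complete-list ψ inj extend es (sub ∘ there)
  ... | θ , θ-inj , agree , done with extend (sub (here refl)) θ
  ...   | χ , avoids , χ-inj , E , E∈F , new∈E , old∈E = θ′ , θ′-inj , agree′ , done′
    where
    θ′ : Fin s → Fin n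
    θ′ v with v ∈? (e ∩ Q)
    ... | yes _ = χ v
    ... | no _  = θ v
    θ′-inj : ∀ {u v} → θ′ u ≡ θ′ v → u ≡ v
    θ′-inj {u} {v} eq with u ∈? (e ∩ Q) | v ∈? (e ∩ Q)
    ... | yes p | yes q = χ-inj p q eq
    ... | yes p | no _  = contradiction eq (avoids p v)
    ... | no _  | yes q = contradiction (sym eq) (avoids q u)
    ... | no _  | no _  = θ-inj eq
    agree′ : ∀ {v} → v ∉ Q → θ′ v ≡ ψ v
    agree′ {v} v∉Q with v ∈? (e ∩ Q)
    ... | yes p = contradiction (proj₂ (x∈p∩q⁻ e Q p)) v∉Q
    ... | no _  = agree v∉Q
    this : ∀ {v} → v ∈ e → θ′ v ∈ E
    this {v} v∈e with v ∈? (e ∩ Q)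
    ... | yes p = new∈E p
    ... | no ¬p = let v∉Q = λ v∈Q → ¬p (x∈p∩q⁺ (v∈e , v∈Q)) in subst (_∈ E) (sym (agree v∉Q)) (old∈E v∈e v∉Q)
    done′ : ∀ {e′} → e′ List∈.∈ (e ∷ es) → ∃[ E ] (E List∈.∈ F × (∀ {v} → v ∈ e′ → θ′ v ∈ E))
    done′ (here refl) = E , E∈F , this
    done′ {e′} (there e′∈) with e′ ≟ˢ e
    ... | yes refl = E , E∈F , this
    ... | no e′≢e with done e′∈
    ...   | E′ , E′∈F , old = E′ , E′∈F , λ {v} v∈e′ → keep v v∈e′ (old v∈e′)
      where
      keep : ∀ v → v ∈ e′ → θ v ∈ E′ → θ′ v ∈ E′
      keep v v∈e′ h with v ∈? (e ∩ Q)
      ... | yes p = let h₁ , h₂ = x∈p∩q⁻ e Q p in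
                    contradiction (private-to h₂ (sub (there e′∈)) (sub (here refl)) v∈e′ h₁) e′≢e
      ... | no _  = h

  -- Containment of the image in an edge is enough, since both have r elements.
  embeds : (ψ : Fin s → Fin n) → (∀ {u v} → ψ u ≡ ψ v → u ≡ v) →
           (∀ {e} → e List∈.∈ H → ∃[ E ] (E List∈.∈ F × (∀ {v} → v ∈ e → ψ v ∈ E))) → Embeds H F
  embeds ψ inj into = ψ , inj , All.tabulate λ {e} e∈H → let E , E∈F , sub = into e∈H in
    subst (List∈._∈ F) (sym (⊆∧≤⇒≡ {p = image ψ e} {E}
        (λ h → let v , v∈e , eq = image⁻ ψ h in subst (_∈ E) eq (sub v∈e))
        (≤-reflexive (trans (F-uniform E∈F) (sym (trans (∣image∣ ψ inj e) (H-uniform e∈H))))))) E∈F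

  complete : (ψ : Fin s → Fin n) → (∀ {u v} → ψ u ≡ ψ v → u ≡ v) →
             (∀ {e} → e List∈.∈ H → ∀ Y → Extension ψ e Y) → Embeds H F
  complete ψ inj extend with complete-list ψ inj extend H id
  ... | θ , θ-inj , _ , done = embeds θ θ-inj done

-- Consequences of not containing a subgraph of a two-reducible tree

∖⊥≡ : (E : Subset n) → E ∖ ⊥ ≡ E
∖⊥≡ E = ⊆-antisym (proj₁ ∘ ∈∖⁻ E ⊥) (λ h → ∈∖⁺ h ∉⊥)

size-one : {Z : Subset n} → ∣ Z ∣ ≡ 1 → ∀ {u v} → u ∈ Z → v ∈ Z → u ≡ v
size-one {Z = Z} eq {u} {v} u∈Z v∈Z with v ≟ᶠ u
... | yes e = sym e
... | no v≢u = contradiction (subst (v ∈_) (size-zero (suc-injective (trans (∣⊖∣ u∈Z) eq))) (∈⊖⁺ v∈Z v≢u)) ∉⊥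

injection-avoiding : (S : Subset n) → 1 ≤ s → ∣ S ∣ + s ≤ n →
  ∃[ d ] d ∉ S × ∃[ φ ] ((∀ {u v : Fin s} → φ u ≡ φ v → u ≡ v) × (∀ v → φ v ∉ S))
injection-avoiding {n} {s} S 1≤s le = d , outside-S d∈ , φ , (λ e → inj ∈⊤ ∈⊤ e) , λ v → outside-S (φ∈ {v} ∈⊤)
  where
  Z = comprehension (λ z → ¬? (z ∈? S))
  outside-S : ∀ {z} → z ∈ Z → z ∉ S
  outside-S = ∈-comprehension⁻ (λ z → ¬? (z ∈? S))
  s≤∣Z∣ : s ≤ ∣ Z ∣
  s≤∣Z∣ = +-cancelˡ-≤ (∣ S ∣) s (∣ Z ∣) (≤-trans le (≤-reflexive (sym (trans (cong (∣ S ∣ +_) (∣comprehension∣ (λ z → ¬? (z ∈? S)))) (∑∉ S)))))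
  element : ∃[ d ] d ∈ Z
  element with nonempty? Z
  ... | yes ne = ne
  ... | no ¬ne = contradiction (≤-trans 1≤s (≤-trans s≤∣Z∣ (≤-reflexive (trans (cong ∣_∣ (Empty-unique ¬ne)) (∣⊥∣≡0 n))))) λ ()
  d = proj₁ element
  d∈ = proj₂ element
  injection = inject (⊤ {s}) Z d (≤-trans (≤-reflexive (∣⊤∣≡n s)) s≤∣Z∣)
  φ = proj₁ injection
  φ∈ = proj₁ (proj₂ injection)
  inj = proj₂ (proj₂ injection)

-- High sets, expandable sets and common links

module Degrees {n : ℕ} (s ρ : ℕ) (F : List (Subset n)) where

  edge? : Decidable (λ E → E List∈.∈ F)
  edge? E = E ∈ᴱ? F

  deg : Subset n → ℕ
  deg = extensions edge?

  High : Pred (Subset n) 0ℓ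
  High D = ∣ D ∣ ≡ 2 + ρ × s < deg D

  high? : Decidable High
  high? D = (∣ D ∣ ≟ 2 + ρ) ×-dec (s <? deg D)

  -- `Y` is a vertex cover of the link graph of P, whose edges are the pairs {x, y} that complete P
  -- to an edge of `F`.
  Covers : Subset n → Subset n → Set
  Covers P Y = ∣ Y ∣ ≤ s × (∀ x → x ∉ P → ∀ y → y ∉ P ⊕ x → (P ⊕ x) ⊕ y List∈.∈ F → x ∈ Y ⊎ y ∈ Y)

  covers? : ∀ P → Decidable (Covers P)
  covers? P Y = (∣ Y ∣ ≤? s) ×-dec all? (λ x → ¬? (x ∈? P) →-dec all? (λ y → ¬? (y ∈? (P ⊕ x)) →-dec
                  (edge? ((P ⊕ x) ⊕ y) →-dec ((x ∈? Y) ⊎-dec (y ∈? Y)))))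

  Expandable : Pred (Subset n) 0ℓ
  Expandable P = ∣ P ∣ ≡ 1 + ρ × ¬ (∃[ Y ] Covers P Y)

  expandable? : Decidable Expandable
  expandable? P = (∣ P ∣ ≟ 1 + ρ) ×-dec ¬? (anySubset? (covers? P))

  CommonLink : Subset n → Pred (Subset n) 0ℓ
  CommonLink S P = ∣ P ∣ ≡ 1 + ρ × (∀ w → w ∈ S → w ∉ P × High (P ⊕ w))

  commonLink? : ∀ S → Decidable (CommonLink S)
  commonLink? S P = (∣ P ∣ ≟ 1 + ρ) ×-dec all? (λ w → (w ∈? S) →-dec (¬? (w ∈? P) ×-dec high? (P ⊕ w)))

  -- When `Y` fails to be a cover, a link edge is disjoint from it. This supplies two new vertices
  -- at once for an edge of H that has been trimmed by two.
  expand : {P : Subset n} → Expandable P → (Y : Subset n) → ∣ Y ∣ ≤ s →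
           ∃[ x ] ∃[ y ] (x ∉ P × y ∉ P ⊕ x × (P ⊕ x) ⊕ y List∈.∈ F × x ∉ Y × y ∉ Y)
  expand {P} (_ , ¬cover) Y le with any? (λ x → any? (λ y → ¬? (x ∈? P) ×-dec (¬? (y ∈? (P ⊕ x)) ×-dec
                                         (edge? ((P ⊕ x) ⊕ y) ×-dec (¬? (x ∈? Y) ×-dec ¬? (y ∈? Y))))))
  ... | yes w = w
  ... | no ¬w = contradiction (Y , le , λ x x∉ y y∉ h → case x ∈? Y of λ
          { (yes x∈Y) → inj₁ x∈Y
          ; (no x∉Y) → case y ∈? Y of λ { (yes y∈Y) → inj₂ y∈Y ; (no y∉Y) → contradiction (x , y , x∉ , y∉ , h , x∉Y , y∉Y) ¬w } }) ¬cover

module Free {s n ρ : ℕ} (H : List (Subset s)) (H-uniform : ∀ {e} → e List∈.∈ H → ∣ e ∣ ≡ 3 + ρ)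
  {t : ℕ} (T : List (Subset t)) (tree : IsRTree (3 + ρ) T) (reducible : TwoReducible T) (H⊆T : Embeds H T)
  (1≤s : 1 ≤ s) (F : List (Subset n)) (F-uniform : ∀ {E} → E List∈.∈ F → ∣ E ∣ ≡ 3 + ρ) (free : ¬ Embeds H F) where

  open Degrees s ρ F

  place-in : (S : Subset n) → ∣ S ∣ + s ≤ n → ∀ {k} → 3 + ρ ≤ 2 + k → (X : Subset s) →
             (∀ {e} → e List∈.∈ H → k ≤ ∣ e ∖ X ∣) →
             {𝒢 : Pred (Subset n) 0ℓ} → FullSubfamily s 𝒢 → (∀ {g} → 𝒢 g → ∣ g ∣ ≡ k) →
             (∀ {g v} → 𝒢 g → v ∈ g → v ∉ S) → Placement H X k (_∉ S) 𝒢
  place-in S le r≤ X core 𝓕 size 𝒢-safe with injection-avoiding S 1≤s le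
  ... | d , d∉ , φ , inj , φ∉ = place T tree reducible H⊆T r≤ X core 𝓕 size 𝒢-safe φ inj φ∉ (d , d∉)

  module _ (s≤n : s ≤ n) where

    ⊥-room : ∣ ⊥ {n} ∣ + s ≤ n
    ⊥-room = ≤-trans (≤-reflexive (cong (_+ s) (∣⊥∣≡0 n))) s≤n

    place-freely : ∀ {k} → 3 + ρ ≤ 2 + k → k ≤ 3 + ρ → {𝒢 : Pred (Subset n) 0ℓ} → FullSubfamily s 𝒢 →
                   (∀ {g} → 𝒢 g → ∣ g ∣ ≡ k) → Placement H ⊥ k (_∉ ⊥) 𝒢
    place-freely r≤ k≤ 𝓕 size = place-in ⊥ ⊥-room r≤ ⊥
      (λ {e} e∈H → ≤-trans k≤ (≤-reflexive (sym (trans (cong ∣_∣ (∖⊥≡ e)) (H-uniform e∈H))))) 𝓕 size (λ _ _ → ∉⊥)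

    -- The case k = r, where nothing is trimmed: a full family of edges contains H directly. Pruning
    -- over the high sets alone gives a bound in terms of their number.
    full-edges-bound : # (closed? edge? high?) ≤ s * # high?
    full-edges-bound = ≮⇒≥ λ lt → free (from-placement
      (place-freely {k = 3 + ρ} (m≤n+m _ 2) ≤-refl (full-subfamily s (# high?) edge? high? ≤-refl lt) F-uniform))
      where
      from-placement : Placement H ⊥ (3 + ρ) (_∉ ⊥) (List∈._∈ F) → Embeds H F
      from-placement pl = embeds ψ injective (λ {e} e∈H → let E , E∈F , sub = placed e∈H in
          E , E∈F , λ v∈e → sub (subst (_ ∈_) (sym (⊆∧≤⇒≡ {p = (e ∖ ⊥) ∖ reserved} {e}
            (λ h → proj₁ (∈∖⁻ e ⊥ (proj₁ (∈∖⁻ (e ∖ ⊥) reserved h))))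
            (≤-reflexive (trans (H-uniform e∈H) (sym (core-size e∈H)))))) v∈e))
        where
        open Placement pl
        open Completion {H = H} {F} H-uniform F-uniform reserved private-to

    -- Each edge lacks exactly one reserved vertex, and a high set has more than s extensions in
    -- `F`, of which the current map blocks at most s.
    embeds-from-high : (ψ : Fin s → Fin n) → (∀ {u v} → ψ u ≡ ψ v → u ≡ v) → (Q : Subset s) →
      (∀ {v e e′} → v ∈ Q → e List∈.∈ H → e′ List∈.∈ H → v ∈ e → v ∈ e′ → e ≡ e′) →
      (∀ {e} → e List∈.∈ H → ∣ e ∖ Q ∣ ≡ 2 + ρ) →
      (∀ {e} → e List∈.∈ H → ∃[ g ] (High g × (∀ {v} → v ∈ e → v ∉ Q → ψ v ∈ g))) → Embeds H F
    embeds-from-high ψ inj Q private-to core placed = complete ψ inj extend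
      where
      open Completion {H = H} {F} H-uniform F-uniform Q private-to
      extend : ∀ {e} → e List∈.∈ H → ∀ Y → Extension ψ e Y
      extend {e} e∈H Y with placed e∈H
      ... | g , (_ , high) , sub
        with fresh ⊤ Y (λ y → ¬? (y ∈? g) ×-dec edge? (g ⊕ y)) (≤-trans (≤-reflexive (cong suc (∣⊤∣≡n s))) high)
      ...   | y , (y∉g , gy∈F) , y-free = (λ _ → y) , (λ _ u eq → y-free ∈⊤ (sym eq))
              , (λ h h′ _ → size-one one h h′) , g ⊕ y , gy∈F , (λ _ → ∈⊕-self g y) , λ h h′ → ∈⊕-other y (sub h h′)
        where
        one : ∣ e ∩ Q ∣ ≡ 1
        one = +-cancelʳ-≡ (2 + ρ) (∣ e ∩ Q ∣) 1 (trans (cong (∣ e ∩ Q ∣ +_) (sym (core e∈H))) (trans (sym (∣∣-split e Q)) (H-uniform e∈H)))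

    -- Pruning starts from the whole layer below, so that `Closed` initially excludes no member of
    -- `𝒢`.
    sparse : ∀ {k} {𝒢 : Pred (Subset n) 0ℓ} (𝒢? : Decidable 𝒢) → (∀ {g} → 𝒢 g → ∣ g ∣ ≡ suc k) →
             ¬ FullSubfamily s 𝒢 → # 𝒢? ≤ s * layer n k
    sparse {k} 𝒢? size none = ≮⇒≥ λ lt → none (full-subfamily s (layer n k) 𝒢? (λ P → ∣ P ∣ ≟ k) ≤-refl
      (≤-trans lt (#-mono 𝒢? (closed? 𝒢? (λ P → ∣ P ∣ ≟ k))
        (λ h → h , λ a a∈g → suc-injective (trans (∣⊖∣ a∈g) (size h))))))

    high-bound : # high? ≤ s * layer n (1 + ρ)
    high-bound = sparse high? proj₁ λ 𝓕 → free (from-placement (place-freely {k = 2 + ρ} (m≤n+m _ 1) (m≤n+m _ 1) 𝓕 proj₁))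
      where
      from-placement : Placement H ⊥ (2 + ρ) (_∉ ⊥) High → Embeds H F
      from-placement pl = embeds-from-high ψ injective reserved private-to
          (λ {e} e∈H → trans (cong (λ z → ∣ z ∖ reserved ∣) (sym (∖⊥≡ e))) (core-size e∈H))
          (λ {e} e∈H → let g , hi , sub = placed e∈H in g , hi , λ h h′ → sub (∈∖⁺ (∈∖⁺ h ∉⊥) h′))
        where
        open Placement pl

    expandable-bound : # expandable? ≤ s * layer n ρ
    expandable-bound = sparse expandable? proj₁ λ 𝓕 → free (from-placement (place-freely {k = 1 + ρ} ≤-refl (m≤n+m _ 2) 𝓕 proj₁))
      where
      from-placement : Placement H ⊥ (1 + ρ) (_∉ ⊥) Expandable → Embeds H F
      from-placement pl = complete ψ injective extend
        where
        open Placement pl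
        open Completion {H = H} {F} H-uniform F-uniform reserved private-to
        extend : ∀ {e} → e List∈.∈ H → ∀ Y → Extension ψ e Y
        extend {e} e∈H Y with placed e∈H
        -- The values of the current map form a set of at most s vertices, hence not a cover.
        ... | P , ex , sub with expand ex (image Y ⊤) (≤-trans (∣image∣≤ Y ⊤) (≤-reflexive (∣⊤∣≡n s)))
        ...   | x , y , x∉P , y∉Px , E∈F , x∉Y , y∉Y with inject (e ∩ reserved) ((⊥ ⊕ x) ⊕ y) x two
          where
          two : ∣ e ∩ reserved ∣ ≤ ∣ (⊥ ⊕ x) ⊕ y ∣
          two = ≤-reflexive (trans (+-cancelʳ-≡ (1 + ρ) (∣ e ∩ reserved ∣) 2 (trans (cong (∣ e ∩ reserved ∣ +_)
                  (sym (trans (cong (λ z → ∣ z ∖ reserved ∣) (sym (∖⊥≡ e))) (core-size e∈H)))) (trans (sym (∣∣-split e reserved)) (H-uniform e∈H))))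
                (sym (trans (∣⊕∣ {D = ⊥ ⊕ x} (λ h → y∉Px ([ (λ { refl → ∈⊕-self P x }) , (λ h → contradiction h ∉⊥) ]′ (∈⊕⁻ h))))
                            (cong suc (trans (∣⊕∣ {D = ⊥ {n}} {x} ∉⊥) (cong suc (∣⊥∣≡0 n)))))))
        ...     | χ , χ∈ , χ-inj = χ , (λ h u eq → avoid (∈⊕⁻ (χ∈ h)) u eq) , χ-inj , (P ⊕ x) ⊕ y , E∈F
                  , (λ h → into (∈⊕⁻ (χ∈ h))) , λ h h′ → ∈⊕-other y (∈⊕-other x (sub (∈∖⁺ (∈∖⁺ h ∉⊥) h′)))
          where
          pair : ∀ {z} → z ∈ ⊥ ⊕ x → z ≡ x
          pair h = [ id , (λ h → contradiction h ∉⊥) ]′ (∈⊕⁻ h)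
          avoid : ∀ {z} → z ≡ y ⊎ z ∈ ⊥ ⊕ x → ∀ u → z ≢ Y u
          avoid (inj₁ refl) u refl = y∉Y (image⁺ Y ∈⊤)
          avoid (inj₂ h) u eq = x∉Y (subst (_∈ image Y ⊤) (trans (sym eq) (pair h)) (image⁺ Y ∈⊤))
          into : ∀ {z} → z ≡ y ⊎ z ∈ ⊥ ⊕ x → z ∈ (P ⊕ x) ⊕ y
          into (inj₁ refl) = ∈⊕-self (P ⊕ x) y
          into (inj₂ h) = subst (_∈ (P ⊕ x) ⊕ y) (sym (pair h)) (∈⊕-other y (∈⊕-self P x))

    -- Otherwise H embeds with `X` going to `S`: an edge without its cross-cut vertex and one
    -- private vertex is placed in a set P of the common link, adding the image of the cross-cut
    -- vertex makes it high, and the high degree restores the private vertex. Taking the vertices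
    -- outside `S` as safe keeps the two parts of the map apart.
    common-link-bound : (X : Subset s) → IsCrossCut H X → (S : Subset n) → ∣ S ∣ ≡ ∣ X ∣ → ∣ S ∣ + s ≤ n →
                        # (commonLink? S) ≤ s * layer n ρ
    common-link-bound X cut S S≡X room = sparse (commonLink? S) proj₁ λ 𝓕 →
      free (from-placement (place-in S room ≤-refl X core 𝓕 proj₁ (λ {g} {v} (_ , h) v∈g v∈S → proj₁ (h v v∈S) v∈g)))
      where
      meet : ∀ {e} → e List∈.∈ H → ∣ e ∩ X ∣ ≡ 1
      meet {e} e∈H = trans (cong ∣_∣ (∩-comm e X)) (All.lookup cut e∈H)
      core : ∀ {e} → e List∈.∈ H → 1 + ρ ≤ ∣ e ∖ X ∣
      core {e} e∈H = ≤-trans (m≤n+m (1 + ρ) 1) (≤-reflexive (suc-injective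
        (trans (sym (H-uniform e∈H)) (trans (∣∣-split e X) (cong (_+ ∣ e ∖ X ∣) (meet e∈H))))))
      from-placement : Placement H X (1 + ρ) (_∉ S) (CommonLink S) → Embeds H F
      from-placement pl = embeds-from-high ψ′ inj′ reserved private-to core′ placed′
        where
        open Placement pl
        default : Fin n
        default = proj₁ (injection-avoiding S 1≤s room)
        assign = inject X S default (≤-reflexive (sym S≡X))
        χ = proj₁ assign
        χ∈ = proj₁ (proj₂ assign)
        χ-inj = proj₂ (proj₂ assign)
        ψ′ : Fin s → Fin n
        ψ′ v with v ∈? X
        ... | yes _ = χ v
        ... | no _  = ψ v
        inj′ : ∀ {u v} → ψ′ u ≡ ψ′ v → u ≡ v
        inj′ {u} {v} eq with u ∈? X | v ∈? X
        ... | yes p | yes q = χ-inj p q eq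
        ... | yes p | no _  = contradiction (subst (_∈ S) eq (χ∈ p)) (safe v)
        ... | no _  | yes q = contradiction (subst (_∈ S) (sym eq) (χ∈ q)) (safe u)
        ... | no _  | no _  = injective eq
        core′ : ∀ {e} → e List∈.∈ H → ∣ e ∖ reserved ∣ ≡ 2 + ρ
        core′ {e} e∈H = trans (∣∣-split (e ∖ reserved) X) (cong₂ _+_
          (trans (cong ∣_∣ (⊆-antisym {i = (e ∖ reserved) ∩ X} {e ∩ X}
             (λ h → let h₁ , h₂ = x∈p∩q⁻ (e ∖ reserved) X h in x∈p∩q⁺ (proj₁ (∈∖⁻ e reserved h₁) , h₂))
             (λ h → let h₁ , h₂ = x∈p∩q⁻ e X h in x∈p∩q⁺ (∈∖⁺ h₁ (λ h₃ → disjoint h₃ h₂) , h₂)))) (meet e∈H))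
          (trans (cong ∣_∣ (⊆-antisym {i = (e ∖ reserved) ∖ X} {(e ∖ X) ∖ reserved}
             (λ h → let h₁ , h₂ = ∈∖⁻ (e ∖ reserved) X h ; h₃ , h₄ = ∈∖⁻ e reserved h₁ in ∈∖⁺ (∈∖⁺ h₃ h₂) h₄)
             (λ h → let h₁ , h₂ = ∈∖⁻ (e ∖ X) reserved h ; h₃ , h₄ = ∈∖⁻ e X h₁ in ∈∖⁺ (∈∖⁺ h₃ h₂) h₄))) (core-size e∈H)))
        placed′ : ∀ {e} → e List∈.∈ H → ∃[ g ] (High g × (∀ {v} → v ∈ e → v ∉ reserved → ψ′ v ∈ g))
        placed′ {e} e∈H with placed e∈H | size-nonempty (meet e∈H)
        ... | P , (_ , link) , sub | x , x∈ = P ⊕ χ x , proj₂ (link (χ x) (χ∈ (proj₂ (x∈p∩q⁻ e X x∈)))) , into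
          where
          into : ∀ {v} → v ∈ e → v ∉ reserved → ψ′ v ∈ P ⊕ χ x
          into {v} v∈e v∉Q with v ∈? X
          ... | yes v∈X = subst (λ u → χ u ∈ P ⊕ χ x) (size-one (meet e∈H) x∈ (x∈p∩q⁺ (v∈e , v∈X))) (∈⊕-self P (χ x))
          ... | no v∉X  = ∈⊕-other (χ x) (sub (∈∖⁺ (∈∖⁺ v∈e v∉X) v∉Q))

-- Counting edges

∑-⊆ : (g : Subset n) → # (_⊆? g) ≤ 2 ^ ∣ g ∣
∑-⊆ []            = ≤-refl
∑-⊆ {suc n} (outside ∷ g) = begin
  # (_⊆? (outside ∷ g))                                              ≡⟨ ∑S-suc (λ Q → ⟦ Q ⊆? (outside ∷ g) ⟧) ⟩
  # (_⊆? g) + ∑ (allSubsets n) (λ _ → 0)                             ≡⟨ cong (# (_⊆? g) +_) (∑-zero (allSubsets n)) ⟩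
  # (_⊆? g) + 0                                                      ≡⟨ +-identityʳ _ ⟩
  # (_⊆? g)                                                          ≤⟨ ∑-⊆ g ⟩
  2 ^ ∣ g ∣                                                          ∎
  where open ≤-Reasoning
∑-⊆ {suc n} (inside ∷ g) = begin
  # (_⊆? (inside ∷ g))                                               ≡⟨ ∑S-suc (λ Q → ⟦ Q ⊆? (inside ∷ g) ⟧) ⟩
  # (_⊆? g) + # (_⊆? g)                                              ≤⟨ +-mono-≤ (∑-⊆ g) (∑-⊆ g) ⟩
  2 ^ ∣ g ∣ + 2 ^ ∣ g ∣                                              ≡⟨ cong (2 ^ ∣ g ∣ +_) (sym (+-identityʳ _)) ⟩
  2 * 2 ^ ∣ g ∣                                                      ∎
  where open ≤-Reasoning

∑-shadow≤ : {𝒫 : Pred (Subset n) 0ℓ} (𝒫? : Decidable 𝒫) → ∑S (λ D → ∑F (λ x → ⟦ x ∈? D ⟧ * ⟦ 𝒫? (D ⊖ x) ⟧)) ≤ n * # 𝒫?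
∑-shadow≤ {n} 𝒫? = begin
  ∑S (λ D → ∑F (λ x → ⟦ x ∈? D ⟧ * ⟦ 𝒫? (D ⊖ x) ⟧))     ≡⟨ sym (double-count {n} (λ x P D → ⟦ 𝒫? P ⟧)) ⟩
  ∑S (λ P → ∑F (λ x → ⟦ ¬? (x ∈? P) ⟧ * ⟦ 𝒫? P ⟧))      ≤⟨ ∑-mono (allSubsets n) (λ P → ≤-trans (∑-mono (allFin n) (λ x → ⟦⟧*≤ (¬? (x ∈? P)) (λ _ → ≤-refl)))
                                                            (≤-reflexive (∑F-const {n} ⟦ 𝒫? P ⟧))) ⟩
  ∑S (λ P → n * ⟦ 𝒫? P ⟧)                               ≡⟨ ∑-*ˡ (allSubsets n) n _ ⟩
  n * # 𝒫?                                              ∎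
  where open ≤-Reasoning

outsider : {Q E : Subset n} → ∣ Q ∣ < ∣ E ∣ → ∃[ x ] (x ∈ E × x ∉ Q)
outsider {Q = Q} {E} lt with any? (λ x → (x ∈? E) ×-dec ¬? (x ∈? Q))
... | yes w = w
... | no ¬w = contradiction (p⊆q⇒∣p∣≤∣q∣ {p = E} {Q} (λ {x} x∈E → case x ∈? Q of λ
                { (yes h) → h ; (no ¬h) → contradiction (x , x∈E , ¬h) ¬w })) (<⇒≱ lt)

module Counting {n : ℕ} (s ρ τ b : ℕ) (F : List (Subset n)) (F-uniform : ∀ {E} → E List∈.∈ F → ∣ E ∣ ≡ 3 + ρ) where

  open Degrees s ρ F

  low⇒deg≤ : {D : Subset n} → ∣ D ∣ ≡ 2 + ρ → ¬ High D → deg D ≤ s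
  low⇒deg≤ size ¬high = ≮⇒≥ (λ lt → ¬high (size , lt))

  LowPair : Pred (Subset n) 0ℓ
  LowPair E = E List∈.∈ F × ∃[ y ] (y ∈ E × ¬ High (E ⊖ y) × ∃[ x ] (x ∈ E ⊖ y × ¬ High (E ⊖ x)))

  lowPair? : Decidable LowPair
  lowPair? E = edge? E ×-dec any? (λ y → (y ∈? E) ×-dec (¬? (high? (E ⊖ y)) ×-dec
                 any? (λ x → (x ∈? (E ⊖ y)) ×-dec ¬? (high? (E ⊖ x)))))

  coverFrom : ∀ {P} → Dec (∃[ Y ] Covers P Y) → Subset n
  coverFrom (yes (Y , _)) = Y
  coverFrom (no _)        = ⊤

  -- For an expandable P the whole vertex set is used; its size n is affordable because such P are
  -- rare.
  cover : Subset n → Subset n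
  cover P = coverFrom (anySubset? (covers? P))

  cover-size : ∀ P → ∣ P ∣ ≡ 1 + ρ → ∣ cover P ∣ ≤ s + n * ⟦ expandable? P ⟧
  cover-size P size = from (anySubset? (covers? P))
    where
    from : (d : Dec (∃[ Y ] Covers P Y)) → ∣ coverFrom d ∣ ≤ s + n * ⟦ expandable? P ⟧
    from (yes (Y , le , _)) = ≤-trans le (m≤m+n s _)
    from (no ¬w) = ≤-trans (≤-reflexive (∣⊤∣≡n n)) (≤-trans
      (≤-reflexive (sym (trans (cong (n *_) (⟦⟧≡1 (expandable? P) (size , ¬w))) (*-identityʳ n)))) (m≤n+m _ s))

  covered : ∀ {P x y} → x ∉ P → y ∉ P ⊕ x → (P ⊕ x) ⊕ y List∈.∈ F → x ∈ cover P ⊎ y ∈ cover P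
  covered {P} {x} {y} x∉ y∉ h = from (anySubset? (covers? P))
    where
    from : (d : Dec (∃[ Y ] Covers P Y)) → x ∈ coverFrom d ⊎ y ∈ coverFrom d
    from (yes (Y , _ , cov)) = cov _ x∉ _ y∉ h
    from (no _)              = inj₁ ∈⊤

  -- Counts the ways to reach D from a set of size 1 + ρ by adding an element of its cover.
  coverWeight : Subset n → ℕ
  coverWeight D = ∑F (λ x → ⟦ x ∈? D ⟧ * (⟦ ∣ D ⊖ x ∣ ≟ 1 + ρ ⟧ * ⟦ x ∈? cover (D ⊖ x) ⟧))

  lowEdge? : ∀ D → Decidable (λ E → (∣ D ∣ ≡ 2 + ρ × ¬ High D) × E List∈.∈ F)
  lowEdge? D E = ((∣ D ∣ ≟ 2 + ρ) ×-dec ¬? (high? D)) ×-dec edge? E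

  -- For P = E without x and y, the pair {x, y} is an edge of the link graph of P, so the cover of P
  -- contains x or y. The set P plus that vertex is one of the two low sets, which makes the cases
  -- symmetric.
  lowPair-pointwise : ∀ E → ⟦ lowPair? E ⟧ ≤ ∑F (λ y → ⟦ y ∈? E ⟧ * (⟦ lowEdge? (E ⊖ y) E ⟧ * coverWeight (E ⊖ y)))
  lowPair-pointwise E = ⟦⟧≤ (lowPair? E) λ (E∈F , y , y∈E , low-y , x , x∈Ey , low-x) →
    let x≢y  = ∈⊖-≢ x∈Ey
        x∈E  = ∈⊖⁻ y x∈Ey
        y∈Ex = ∈⊖⁺ {x = y} {x} y∈E (x≢y ∘ sym)
    in case covered {(E ⊖ y) ⊖ x} {x} {y} (∉⊖-self (E ⊖ y) x)
              (λ h → ∉⊖-self E y (subst (y ∈_) (⊖⊕ x∈Ey) h))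
              (subst (List∈._∈ F) (sym (trans (cong (_⊕ y) (⊖⊕ x∈Ey)) (⊖⊕ y∈E))) E∈F) of λ
      { (inj₁ x∈Y) → witness E∈F y∈E low-y x∈Ey x∈Y
      ; (inj₂ y∈Y) → witness E∈F x∈E low-x y∈Ex (subst (λ P → y ∈ cover P) (⊖⊖-comm E (x≢y ∘ sym)) y∈Y) }
    where
    witness : ∀ {x y} → E List∈.∈ F → y ∈ E → ¬ High (E ⊖ y) → x ∈ E ⊖ y → x ∈ cover ((E ⊖ y) ⊖ x) →
              1 ≤ ∑F (λ y → ⟦ y ∈? E ⟧ * (⟦ lowEdge? (E ⊖ y) E ⟧ * coverWeight (E ⊖ y)))
    witness {x} {y} E∈F y∈E low x∈Ey x∈Y = ≤-trans
      (1≤* (1≤⟦⟧ (y ∈? E) y∈E) (1≤* (1≤⟦⟧ (lowEdge? (E ⊖ y) E) ((size , low) , E∈F)) (≤-trans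
        (1≤* (1≤⟦⟧ (x ∈? (E ⊖ y)) x∈Ey) (1≤* (1≤⟦⟧ (∣ (E ⊖ y) ⊖ x ∣ ≟ 1 + ρ) (suc-injective (trans (∣⊖∣ x∈Ey) size))) (1≤⟦⟧ (x ∈? cover ((E ⊖ y) ⊖ x)) x∈Y)))
        (∑F-member (λ x → ⟦ x ∈? (E ⊖ y) ⟧ * (⟦ ∣ (E ⊖ y) ⊖ x ∣ ≟ 1 + ρ ⟧ * ⟦ x ∈? cover ((E ⊖ y) ⊖ x) ⟧)) x))))
      (∑F-member (λ y → ⟦ y ∈? E ⟧ * (⟦ lowEdge? (E ⊖ y) E ⟧ * coverWeight (E ⊖ y))) y)
      where
      size : ∣ E ⊖ y ∣ ≡ 2 + ρ
      size = suc-injective (trans (∣⊖∣ y∈E) (F-uniform E∈F))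

  few-lowEdges : ∀ D → ∑F (λ y → ⟦ ¬? (y ∈? D) ⟧ * ⟦ lowEdge? D (D ⊕ y) ⟧) ≤ s
  few-lowEdges D = from ((∣ D ∣ ≟ 2 + ρ) ×-dec ¬? (high? D))
    where
    from : (d : Dec (∣ D ∣ ≡ 2 + ρ × ¬ High D)) → ∑F (λ y → ⟦ ¬? (y ∈? D) ⟧ * ⟦ d ×-dec edge? (D ⊕ y) ⟧) ≤ s
    from (yes (size , ¬high)) = ≤-trans (≤-reflexive (∑-cong (allFin n) (λ y → sym (⟦⟧-× (¬? (y ∈? D)) (edge? (D ⊕ y)))))) (low⇒deg≤ size ¬high)
    from (no _) = ≤-trans (≤-reflexive (trans (∑-cong (allFin n) (λ y → *-zeroʳ ⟦ ¬? (y ∈? D) ⟧)) (∑-zero (allFin n)))) z≤n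

  -- Choose P, then a vertex of its cover, which gives a low set, and then one of the at most s
  -- edges containing this low set.
  lowPair-bound : # lowPair? ≤ s * (s * layer n (1 + ρ) + n * # expandable?)
  lowPair-bound = begin
    # lowPair?
      ≤⟨ ∑-mono (allSubsets n) lowPair-pointwise ⟩
    ∑S (λ E → ∑F (λ y → ⟦ y ∈? E ⟧ * (⟦ lowEdge? (E ⊖ y) E ⟧ * coverWeight (E ⊖ y))))
      ≡⟨ sym (double-count {n} (λ y D E → ⟦ lowEdge? D E ⟧ * coverWeight D)) ⟩
    ∑S (λ D → ∑F (λ y → ⟦ ¬? (y ∈? D) ⟧ * (⟦ lowEdge? D (D ⊕ y) ⟧ * coverWeight D)))
      ≤⟨ ∑-mono (allSubsets n) (λ D → ≤-trans (≤-reflexive (trans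
           (∑-cong (allFin n) (λ y → sym (*-assoc ⟦ ¬? (y ∈? D) ⟧ ⟦ lowEdge? D (D ⊕ y) ⟧ (coverWeight D))))
           (∑-*ʳ (allFin n) (coverWeight D) (λ y → ⟦ ¬? (y ∈? D) ⟧ * ⟦ lowEdge? D (D ⊕ y) ⟧))))
           (*-monoˡ-≤ (coverWeight D) (few-lowEdges D))) ⟩
    ∑S (λ D → s * coverWeight D)
      ≡⟨ ∑-*ˡ (allSubsets n) s coverWeight ⟩
    s * ∑S coverWeight
      ≡⟨ cong (s *_) (sym (double-count {n} (λ x P D → ⟦ ∣ P ∣ ≟ 1 + ρ ⟧ * ⟦ x ∈? cover P ⟧))) ⟩
    s * ∑S (λ P → ∑F (λ x → ⟦ ¬? (x ∈? P) ⟧ * (⟦ ∣ P ∣ ≟ 1 + ρ ⟧ * ⟦ x ∈? cover P ⟧)))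
      ≤⟨ *-monoʳ-≤ s (∑-mono (allSubsets n) (λ P → ≤-trans (∑-mono (allFin n) (λ x → ⟦⟧*≤ (¬? (x ∈? P)) (λ _ → ≤-refl)))
           (≤-trans (≤-reflexive (trans (∑-*ˡ (allFin n) ⟦ ∣ P ∣ ≟ 1 + ρ ⟧ (λ x → ⟦ x ∈? cover P ⟧)) (cong (⟦ ∣ P ∣ ≟ 1 + ρ ⟧ *_) (sym (∣∣≡∑ (cover P))))))
                    (per P (∣ P ∣ ≟ 1 + ρ))))) ⟩
    s * ∑S (λ P → s * ⟦ ∣ P ∣ ≟ 1 + ρ ⟧ + n * ⟦ expandable? P ⟧)
      ≡⟨ cong (s *_) (trans (∑-+ (allSubsets n) (λ P → s * ⟦ ∣ P ∣ ≟ 1 + ρ ⟧) _) (cong₂ _+_ (∑-*ˡ (allSubsets n) s _) (∑-*ˡ (allSubsets n) n _))) ⟩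
    s * (s * layer n (1 + ρ) + n * # expandable?) ∎
    where
    open ≤-Reasoning
    per : ∀ P (d : Dec (∣ P ∣ ≡ 1 + ρ)) → ⟦ d ⟧ * ∣ cover P ∣ ≤ s * ⟦ d ⟧ + n * ⟦ expandable? P ⟧
    per P (no _)     = z≤n
    per P (yes size) = ≤-trans (≤-reflexive (+-identityʳ _)) (≤-trans (cover-size P size) (≤-reflexive (cong (_+ n * ⟦ expandable? P ⟧) (sym (*-identityʳ s)))))

  -- heavy i Q: the set Q of size 2 + ρ ∸ i extends to at least n / b sets of the level below.
  heavy : ℕ → Pred (Subset n) 0ℓ
  heavy? : ∀ i → Decidable (heavy i)
  heavy zero    Q = High Q
  heavy (suc i) Q = n ≤ b * extensions (heavy? i) Q
  heavy? zero    Q = high? Q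
  heavy? (suc i) Q = n ≤? b * extensions (heavy? i) Q

  level? : ∀ i → Decidable (λ Q → ∣ Q ∣ + i ≡ 2 + ρ × heavy i Q)
  level? i Q = (∣ Q ∣ + i ≟ 2 + ρ) ×-dec heavy? i Q

  level-size : ∀ i {Q} → ∣ Q ∣ + i ≡ 2 + ρ × heavy i Q → ∣ Q ∣ ≡ 2 + ρ ∸ i
  level-size i {Q} (e , _) = trans (sym (m+n∸n≡m ∣ Q ∣ i)) (cong (_∸ i) e)

  -- A set of level i + 1 has at least n / b extensions in level i, and a set of level i extends at
  -- most 2 + ρ smaller sets.
  level-step : ∀ i → n * # (level? (suc i)) ≤ (b * (2 + ρ)) * # (level? i)
  level-step i = begin
    n * # (level? (suc i))
      ≡⟨ sym (∑-*ˡ (allSubsets n) n _) ⟩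
    ∑S (λ Q → n * ⟦ level? (suc i) Q ⟧)
      ≤⟨ ∑-mono (allSubsets n) (λ Q → ≤-trans (≤-reflexive (*-comm n ⟦ level? (suc i) Q ⟧)) (⟦⟧*≤ (level? (suc i) Q) (λ (e , h) →
           ≤-trans h (*-monoʳ-≤ b (∑-mono (allFin n) (λ y → ≤-trans (⟦⟧-mono (¬? (y ∈? Q) ×-dec heavy? i (Q ⊕ y)) (¬? (y ∈? Q) ×-dec level? i (Q ⊕ y))
             (λ (y∉ , hv) → y∉ , trans (cong (_+ i) (∣⊕∣ y∉)) (trans (sym (+-suc ∣ Q ∣ i)) e) , hv))
             (≤-reflexive (⟦⟧-× (¬? (y ∈? Q)) (level? i (Q ⊕ y)))))))))) ⟩
    ∑S (λ Q → b * ∑F (λ y → ⟦ ¬? (y ∈? Q) ⟧ * ⟦ level? i (Q ⊕ y) ⟧))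
      ≡⟨ ∑-*ˡ (allSubsets n) b _ ⟩
    b * ∑S (λ Q → ∑F (λ y → ⟦ ¬? (y ∈? Q) ⟧ * ⟦ level? i (Q ⊕ y) ⟧))
      ≡⟨ cong (b *_) (trans (double-count {n} (λ y Q E → ⟦ level? i E ⟧)) (handshake (level? i) (level-size i))) ⟩
    b * ((2 + ρ ∸ i) * # (level? i))
      ≤⟨ *-monoʳ-≤ b (*-monoˡ-≤ (# (level? i)) (m∸n≤m (2 + ρ) i)) ⟩
    b * ((2 + ρ) * # (level? i))
      ≡⟨ sym (*-assoc b (2 + ρ) _) ⟩
    (b * (2 + ρ)) * # (level? i) ∎
    where open ≤-Reasoning

  level-bound : ∀ i → n ^ i * # (level? i) ≤ (b * (2 + ρ)) ^ i * # high?
  level-bound zero    = *-monoʳ-≤ 1 (#-mono (level? 0) high? proj₂)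
  level-bound (suc i) = begin
    n * n ^ i * # (level? (suc i))           ≡⟨ solve 3 (λ a b c → a :* b :* c := b :* (a :* c)) refl n (n ^ i) (# (level? (suc i))) ⟩
    n ^ i * (n * # (level? (suc i)))         ≤⟨ *-monoʳ-≤ (n ^ i) (level-step i) ⟩
    n ^ i * (c * # (level? i))               ≡⟨ solve 3 (λ a b c → a :* (b :* c) := b :* (a :* c)) refl (n ^ i) c (# (level? i)) ⟩
    c * (n ^ i * # (level? i))               ≤⟨ *-monoʳ-≤ c (level-bound i) ⟩
    c * (c ^ i * # high?)                    ≡⟨ sym (*-assoc c (c ^ i) _) ⟩
    c * c ^ i * # high?                      ∎
    where
    open ≤-Reasoning
    open +-*-Solver
    c = b * (2 + ρ)

  -- After 1 + ρ steps down from size 2 + ρ the level consists of singletons.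
  W : Subset n
  W = comprehension (λ w → heavy? (1 + ρ) (⊥ ⊕ w))

  W-bound : n ^ (1 + ρ) * ∣ W ∣ ≤ (b * (2 + ρ)) ^ (1 + ρ) * # high?
  W-bound = ≤-trans (*-monoʳ-≤ (n ^ (1 + ρ)) (begin
    ∣ W ∣
      ≡⟨ ∣comprehension∣ (λ w → heavy? (1 + ρ) (⊥ ⊕ w)) ⟩
    ∑F (λ w → ⟦ heavy? (1 + ρ) (⊥ ⊕ w) ⟧)
      ≤⟨ ∑-mono (allFin n) (λ w → ⟦⟧≤ (heavy? (1 + ρ) (⊥ ⊕ w)) (λ h → 1≤* (1≤⟦⟧ (¬? (w ∈? ⊥)) ∉⊥)
           (1≤⟦⟧ (level? (1 + ρ) (⊥ ⊕ w)) (cong (_+ (1 + ρ)) (trans (∣⊕∣ {D = ⊥} {w} ∉⊥) (cong suc (∣⊥∣≡0 n))) , h)))) ⟩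
    ∑F (λ w → ⟦ ¬? (w ∈? ⊥) ⟧ * ⟦ level? (1 + ρ) (⊥ ⊕ w) ⟧)
      ≤⟨ ∑S-member (λ Q → ∑F (λ w → ⟦ ¬? (w ∈? Q) ⟧ * ⟦ level? (1 + ρ) (Q ⊕ w) ⟧)) ⊥ ⟩
    ∑S (λ Q → ∑F (λ w → ⟦ ¬? (w ∈? Q) ⟧ * ⟦ level? (1 + ρ) (Q ⊕ w) ⟧))
      ≡⟨ trans (double-count {n} (λ w Q E → ⟦ level? (1 + ρ) E ⟧)) (handshake (level? (1 + ρ)) (λ {Q} h → trans (level-size (1 + ρ) {Q} h) (m+n∸n≡m 1 (1 + ρ)))) ⟩
    1 * # (level? (1 + ρ))
      ≡⟨ +-identityʳ _ ⟩
    # (level? (1 + ρ)) ∎)) (level-bound (1 + ρ))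
    where open ≤-Reasoning

  -- The chain of heavy sets breaks at Q: removing z makes it light. The index `1 + ρ ∸ ∣ Q ∣` is
  -- the level of `Q ⊕ z`, one less than that of Q.
  Drop : Subset n → Fin n → Subset n → Set
  Drop g z Q = (High g × Q ⊆ g) × (¬ heavy (suc (1 + ρ ∸ ∣ Q ∣)) Q × heavy (1 + ρ ∸ ∣ Q ∣) (Q ⊕ z))

  drop? : ∀ g z Q → Dec (Drop g z Q)
  drop? g z Q = (high? g ×-dec (Q ⊆? g)) ×-dec (¬? (heavy? (suc (1 + ρ ∸ ∣ Q ∣)) Q) ×-dec heavy? (1 + ρ ∸ ∣ Q ∣) (Q ⊕ z))

  Dropping : Pred (Subset n) 0ℓ
  Dropping E = ∃[ z ] (z ∈ E × ∃[ Q ] Drop (E ⊖ z) z Q)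

  dropping? : Decidable Dropping
  dropping? E = any? (λ z → (z ∈? E) ×-dec anySubset? (drop? (E ⊖ z) z))

  -- A high set has at most 2^(2 + ρ) subsets Q, and a light Q allows fewer than n / b vertices z.
  dropping-bound : b * # dropping? ≤ n * (2 ^ (2 + ρ) * # high?)
  dropping-bound = begin
    b * # dropping?
      ≤⟨ *-monoʳ-≤ b (∑-mono (allSubsets n) pointwise) ⟩
    b * ∑S (λ E → ∑F (λ z → ⟦ z ∈? E ⟧ * ∑S (λ Q → ⟦ drop? (E ⊖ z) z Q ⟧)))
      ≡⟨ cong (b *_) (sym (double-count {n} (λ z g E → ∑S (λ Q → ⟦ drop? g z Q ⟧)))) ⟩
    b * ∑S (λ g → ∑F (λ z → ⟦ ¬? (z ∈? g) ⟧ * ∑S (λ Q → ⟦ drop? g z Q ⟧)))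
      ≡⟨ cong (b *_) (∑-cong (allSubsets n) (λ g → trans (∑-cong (allFin n) (λ z → sym (∑-*ˡ (allSubsets n) ⟦ ¬? (z ∈? g) ⟧ (λ Q → ⟦ drop? g z Q ⟧))))
           (∑-swap (allFin n) (allSubsets n) (λ z Q → ⟦ ¬? (z ∈? g) ⟧ * ⟦ drop? g z Q ⟧)))) ⟩
    b * ∑S (λ g → ∑S (λ Q → ∑F (λ z → ⟦ ¬? (z ∈? g) ⟧ * ⟦ drop? g z Q ⟧)))
      ≡⟨ trans (sym (∑-*ˡ (allSubsets n) b _)) (∑-cong (allSubsets n) (λ g → sym (∑-*ˡ (allSubsets n) b _))) ⟩
    ∑S (λ g → ∑S (λ Q → b * ∑F (λ z → ⟦ ¬? (z ∈? g) ⟧ * ⟦ drop? g z Q ⟧)))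
      ≤⟨ ∑-mono (allSubsets n) (λ g → ∑-mono (allSubsets n) (few g)) ⟩
    ∑S (λ g → ∑S (λ Q → ⟦ high? g ⟧ * ⟦ Q ⊆? g ⟧ * n))
      ≡⟨ ∑-cong (allSubsets n) (λ g → trans (∑-*ʳ (allSubsets n) n _) (cong (_* n) (∑-*ˡ (allSubsets n) ⟦ high? g ⟧ _))) ⟩
    ∑S (λ g → ⟦ high? g ⟧ * # (_⊆? g) * n)
      ≤⟨ ∑-mono (allSubsets n) (λ g → *-monoˡ-≤ n (powers g (high? g))) ⟩
    ∑S (λ g → 2 ^ (2 + ρ) * ⟦ high? g ⟧ * n)
      ≡⟨ trans (∑-*ʳ (allSubsets n) n _) (trans (cong (_* n) (∑-*ˡ (allSubsets n) (2 ^ (2 + ρ)) _)) (*-comm _ n)) ⟩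
    n * (2 ^ (2 + ρ) * # high?) ∎
    where
    open ≤-Reasoning
    pointwise : ∀ E → ⟦ dropping? E ⟧ ≤ ∑F (λ z → ⟦ z ∈? E ⟧ * ∑S (λ Q → ⟦ drop? (E ⊖ z) z Q ⟧))
    pointwise E = ⟦⟧≤ (dropping? E) λ (z , z∈E , Q , h) → ≤-trans
      (1≤* (1≤⟦⟧ (z ∈? E) z∈E) (≤-trans (1≤⟦⟧ (drop? (E ⊖ z) z Q) h) (∑S-member (λ Q → ⟦ drop? (E ⊖ z) z Q ⟧) Q)))
      (∑F-member (λ z → ⟦ z ∈? E ⟧ * ∑S (λ Q → ⟦ drop? (E ⊖ z) z Q ⟧)) z)
    powers : ∀ g (d : Dec (High g)) → ⟦ d ⟧ * # (_⊆? g) ≤ 2 ^ (2 + ρ) * ⟦ d ⟧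
    powers g (no _)           = z≤n
    powers g (yes (size , _)) = ≤-trans (≤-reflexive (+-identityʳ _)) (≤-trans (∑-⊆ g) (≤-reflexive (trans (cong (2 ^_) size) (sym (*-identityʳ _)))))
    few : ∀ g Q → b * ∑F (λ z → ⟦ ¬? (z ∈? g) ⟧ * ⟦ drop? g z Q ⟧) ≤ ⟦ high? g ⟧ * ⟦ Q ⊆? g ⟧ * n
    few g Q with (high? g ×-dec (Q ⊆? g)) ×-dec ¬? (heavy? (suc (1 + ρ ∸ ∣ Q ∣)) Q)
    ... | no ¬h = ≤-trans (≤-reflexive (trans (cong (b *_) (trans (∑-cong (allFin n) (λ z → trans (cong (⟦ ¬? (z ∈? g) ⟧ *_)
                    (⟦⟧≡0 (drop? g z Q) (λ (h , h′ , _) → ¬h (h , h′)))) (*-zeroʳ ⟦ ¬? (z ∈? g) ⟧))) (∑-zero (allFin n)))) (*-zeroʳ b))) z≤n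
    ... | yes ((hg , sub) , light) = begin
      b * ∑F (λ z → ⟦ ¬? (z ∈? g) ⟧ * ⟦ drop? g z Q ⟧)
        ≤⟨ *-monoʳ-≤ b (∑-mono (allFin n) (λ z → ≤-trans (≤-reflexive (sym (⟦⟧-× (¬? (z ∈? g)) (drop? g z Q))))
             (⟦⟧-mono (¬? (z ∈? g) ×-dec drop? g z Q) (¬? (z ∈? Q) ×-dec heavy? (1 + ρ ∸ ∣ Q ∣) (Q ⊕ z)) (λ (z∉g , _ , _ , h) → (λ z∈Q → z∉g (sub z∈Q)) , h)))) ⟩
      b * extensions (heavy? (1 + ρ ∸ ∣ Q ∣)) Q
        ≤⟨ <⇒≤ (≰⇒> light) ⟩
      n
        ≡⟨ sym (trans (cong (_* n) (cong₂ _*_ (⟦⟧≡1 (high? g) hg) (⟦⟧≡1 (Q ⊆? g) sub))) (+-identityʳ n)) ⟩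
      ⟦ high? g ⟧ * ⟦ Q ⊆? g ⟧ * n ∎

  -- For z in E outside Q, the larger set `Q ⊕ z` is heavy by induction and `E ⊖ z` is high because
  -- z differs from w; if Q were light, these would show that E is dropping. Applied to the
  -- singleton of w, this puts w into `W`.
  heavy-subsets : ∀ {E w} → ∣ E ∣ ≡ 3 + ρ → ¬ Dropping E → (∀ {x} → x ∈ E → x ≢ w → High (E ⊖ x)) →
                  ∀ i {Q} → w ∈ Q → Q ⊆ E → ∣ Q ∣ + i ≡ 2 + ρ → heavy i Q
  heavy-subsets {E} {w} size ¬drop high zero {Q} w∈Q Q⊆E e
    with outsider {Q = Q} {E} (≤-reflexive (trans (cong suc (trans (sym (+-identityʳ _)) e)) (sym size)))
  ... | x , x∈E , x∉Q = subst High (sym (⊆∧≤⇒≡ {p = Q} {E ⊖ x} (λ h → ∈⊖⁺ (Q⊆E h) (λ { refl → x∉Q h }))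
          (≤-reflexive (trans (suc-injective (trans (∣⊖∣ x∈E) size)) (sym (trans (sym (+-identityʳ _)) e))))))
          (high x∈E (λ { refl → x∉Q w∈Q }))
  heavy-subsets {E} {w} size ¬drop high (suc i) {Q} w∈Q Q⊆E e
    with outsider {Q = Q} {E} (≤-trans (s≤s (m≤m+n ∣ Q ∣ (suc i))) (≤-reflexive (trans (cong suc e) (sym size))))
  ... | z , z∈E , z∉Q with heavy? (suc i) Q
  ...   | yes h = h
  ...   | no ¬h = contradiction (z , z∈E , Q , (high z∈E (λ { refl → z∉Q w∈Q }) , λ {_} h → ∈⊖⁺ (Q⊆E h) (λ { refl → z∉Q h })) ,
                    subst (λ i → ¬ heavy (suc i) Q) (sym i≡) ¬h ,
                    subst (λ i → heavy i (Q ⊕ z)) (sym i≡) (heavy-subsets size ¬drop high i (∈⊕-other z w∈Q)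
                      (λ h → [ (λ { refl → z∈E }) , Q⊆E ]′ (∈⊕⁻ h)) (trans (cong (_+ i) (∣⊕∣ z∉Q)) (trans (sym (+-suc ∣ Q ∣ i)) e)))) ¬drop
    where
    i≡ : 1 + ρ ∸ ∣ Q ∣ ≡ i
    i≡ = trans (cong (_∸ ∣ Q ∣) (sym (suc-injective (trans (sym (+-suc ∣ Q ∣ i)) e)))) (m+n∸m≡n ∣ Q ∣ i)

-- Summation over fibres and the tangent-line inequality

∑-fibres : {B : Set} (ys : List B) (_≟ᴮ_ : (x y : B) → Dec (x ≡ y)) → (∀ y → ∑ ys (λ z → ⟦ y ≟ᴮ z ⟧) ≡ 1) →
           {𝒟 : Pred (Subset n) 0ℓ} (𝒟? : Decidable 𝒟) (f : Subset n → B) →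
           ∑ ys (λ y → # (λ D → 𝒟? D ×-dec (f D ≟ᴮ y))) ≡ # 𝒟?
∑-fibres {n} ys _≟ᴮ_ delta 𝒟? f = begin
  ∑ ys (λ y → # (λ D → 𝒟? D ×-dec (f D ≟ᴮ y)))
    ≡⟨ ∑-swap ys (allSubsets n) _ ⟩
  ∑S (λ D → ∑ ys (λ y → ⟦ 𝒟? D ×-dec (f D ≟ᴮ y) ⟧))
    ≡⟨ ∑-cong (allSubsets n) (λ D → trans (∑-cong ys (λ y → ⟦⟧-× (𝒟? D) (f D ≟ᴮ y)))
         (trans (∑-*ˡ ys ⟦ 𝒟? D ⟧ _) (trans (cong (⟦ 𝒟? D ⟧ *_) (delta (f D))) (*-identityʳ _)))) ⟩
  # 𝒟? ∎
  where open ≡-Reasoning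

#-≟ˢ′≡1 : (P : Subset n) → ∑S (λ S → ⟦ P ≟ˢ S ⟧) ≡ 1
#-≟ˢ′≡1 {n} P = trans (∑-cong (allSubsets n) (λ S → ⟦⟧-cong (P ≟ˢ S) (S ≟ˢ P) sym sym)) (#-≟ˢ≡1 P)

2mx≤x²+m² : ∀ m x → 2 * (m * x) ≤ x * x + m * m
2mx≤x²+m² m x with ≤-total m x
... | inj₁ m≤x = subst (λ x → 2 * (m * x) ≤ x * x + m * m) (m+[n∸m]≡n m≤x) (≤-trans (m≤m+n _ (d * d))
        (≤-reflexive (solve 2 (λ m d → con 2 :* (m :* (m :+ d)) :+ d :* d := (m :+ d) :* (m :+ d) :+ m :* m) refl m d)))
  where
  open +-*-Solver
  d = x ∸ m
... | inj₂ x≤m = subst (λ m → 2 * (m * x) ≤ x * x + m * m) (m+[n∸m]≡n x≤m) (≤-trans (m≤m+n _ (d * d))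
        (≤-reflexive (solve 2 (λ x d → con 2 :* ((x :+ d) :* x) :+ d :* d := x :* x :+ (x :+ d) :* (x :+ d)) refl x d)))
  where
  open +-*-Solver
  d = m ∸ x

-- The convex function x^(j+1) lies above its tangent at m; the terms are arranged to avoid
-- subtraction.
amgm : ∀ j m x → suc j * m ^ j * x ≤ x ^ suc j + j * m ^ suc j
amgm zero    m x = ≤-reflexive (solve 1 (λ x → con 1 :* con 1 :* x := x :* con 1 :+ con 0) refl x)
  where open +-*-Solver
amgm (suc j) m x = +-cancelʳ-≤ (j * (m * p) * x) _ _ (begin
  (2 + j) * (m * p) * x + j * (m * p) * x
    ≡⟨ solve 4 (λ j m p x → (con 2 :+ j) :* (m :* p) :* x :+ j :* (m :* p) :* x := (con 1 :+ j) :* p :* (con 2 :* (m :* x))) refl j m p x ⟩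
  suc j * p * (2 * (m * x))
    ≤⟨ *-monoʳ-≤ (suc j * p) (2mx≤x²+m² m x) ⟩
  suc j * p * (x * x + m * m)
    ≡⟨ solve 4 (λ j m p x → (con 1 :+ j) :* p :* (x :* x :+ m :* m) := (con 1 :+ j) :* p :* x :* x :+ (con 1 :+ j) :* (m :* (m :* p))) refl j m p x ⟩
  suc j * p * x * x + suc j * (m * (m * p))
    ≤⟨ +-monoˡ-≤ (suc j * (m * (m * p))) (*-monoˡ-≤ x (amgm j m x)) ⟩
  (x ^ suc j + j * (m * p)) * x + suc j * (m * (m * p))
    ≡⟨ solve 5 (λ j m p x q → (q :+ j :* (m :* p)) :* x :+ (con 1 :+ j) :* (m :* (m :* p))
                 := x :* q :+ (con 1 :+ j) :* (m :* (m :* p)) :+ j :* (m :* p) :* x) refl j m p x (x ^ suc j) ⟩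
  x * x ^ suc j + suc j * (m * (m * p)) + j * (m * p) * x ∎)
  where
  open ≤-Reasoning
  open +-*-Solver
  p = m ^ j

-- Centers of low sets and the classes they define

module Classes {n : ℕ} (s ρ τ b : ℕ) (F : List (Subset n)) (F-uniform : ∀ {E} → E List∈.∈ F → ∣ E ∣ ≡ 3 + ρ) where

  open Degrees s ρ F
  open Counting s ρ τ b F F-uniform

  Center : Subset n → Fin n → Set
  Center D w = (∣ D ∣ ≡ 2 + ρ × ¬ High D) × (w ∉ D × D ⊕ w List∈.∈ F) × (w ∈ W × (∀ x → x ∈ D → High ((D ⊕ w) ⊖ x)))

  center? : ∀ D w → Dec (Center D w)
  center? D w = ((∣ D ∣ ≟ 2 + ρ) ×-dec ¬? (high? D)) ×-dec ((¬? (w ∈? D) ×-dec edge? (D ⊕ w)) ×-dec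
                ((w ∈? W) ×-dec all? (λ x → (x ∈? D) →-dec high? ((D ⊕ w) ⊖ x))))

  centers : Subset n → Subset n
  centers D = comprehension (center? D)

  neighbour? : ∀ P → Decidable (λ w → w ∈ W × (w ∉ P × High (P ⊕ w)))
  neighbour? P w = (w ∈? W) ×-dec (¬? (w ∈? P) ×-dec high? (P ⊕ w))

  -- An upper bound for the centers of every D above P that depends on P only; this is what forces
  -- sets with a common shadow element to have the same centers.
  neighbours : Subset n → Subset n
  neighbours P = comprehension (neighbour? P)

  centers⊆neighbours : ∀ {D x} → x ∈ D → centers D ⊆ neighbours (D ⊖ x)
  centers⊆neighbours {D} {x} x∈D h with ∈-comprehension⁻ (center? D) h
  ... | _ , (w∉D , _) , (w∈W , high) = ∈-comprehension⁺ (neighbour? (D ⊖ x))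
        (w∈W , (w∉D ∘ ∈⊖⁻ x) , subst High (⊕⊖-comm D (λ { refl → w∉D x∈D })) (high x x∈D))

  centers-size : ∀ {D} → ¬ (∣ D ∣ ≡ 2 + ρ) → ∣ centers D ∣ ≡ 0
  centers-size {D} ¬size = trans (cong ∣_∣ (Empty-unique (λ (w , h) → ¬size (proj₁ (proj₁ (∈-comprehension⁻ (center? D) h)))))) (∣⊥∣≡0 n)

  centers≤s : ∀ D → ∣ centers D ∣ ≤ s
  centers≤s D with nonempty? (centers D)
  ... | no ¬ne = ≤-trans (≤-reflexive (trans (cong ∣_∣ (Empty-unique ¬ne)) (∣⊥∣≡0 n))) z≤n
  ... | yes (w , h) = let (size , ¬high) , _ = ∈-comprehension⁻ (center? D) h in
    ≤-trans (≤-reflexive (∣comprehension∣ (center? D)))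
      (≤-trans (∑-mono (allFin n) (λ y → ⟦⟧-mono (center? D y) (¬? (y ∈? D) ×-dec edge? (D ⊕ y)) (λ (_ , h , _) → h))) (low⇒deg≤ size ¬high))

  -- An edge that escapes the first three families has exactly one low subset, and the vertex
  -- opposite to it belongs to `W` by `heavy-subsets`.
  edges-split : # edge? ≤ # (closed? edge? high?) + (# lowPair? + (# dropping? + ∑S (λ D → ∣ centers D ∣)))
  edges-split = begin
    # edge?
      ≤⟨ ∑-mono (allSubsets n) pointwise ⟩
    ∑S (λ E → ⟦ closed? edge? high? E ⟧ + (⟦ lowPair? E ⟧ + (⟦ dropping? E ⟧ + ∑F (λ w → ⟦ w ∈? E ⟧ * ⟦ center? (E ⊖ w) w ⟧))))
      ≡⟨ trans (∑-+ (allSubsets n) _ _) (cong (# (closed? edge? high?) +_) (trans (∑-+ (allSubsets n) _ _) (cong (# lowPair? +_) (∑-+ (allSubsets n) _ _)))) ⟩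
    # (closed? edge? high?) + (# lowPair? + (# dropping? + ∑S (λ E → ∑F (λ w → ⟦ w ∈? E ⟧ * ⟦ center? (E ⊖ w) w ⟧))))
      ≤⟨ +-monoʳ-≤ (# (closed? edge? high?)) (+-monoʳ-≤ (# lowPair?) (+-monoʳ-≤ (# dropping?) (begin
           ∑S (λ E → ∑F (λ w → ⟦ w ∈? E ⟧ * ⟦ center? (E ⊖ w) w ⟧))
             ≡⟨ sym (double-count {n} (λ w D E → ⟦ center? D w ⟧)) ⟩
           ∑S (λ D → ∑F (λ w → ⟦ ¬? (w ∈? D) ⟧ * ⟦ center? D w ⟧))
             ≤⟨ ∑-mono (allSubsets n) (λ D → ≤-trans (∑-mono (allFin n) (λ w → ⟦⟧*≤ (¬? (w ∈? D)) (λ _ → ≤-refl))) (≤-reflexive (sym (∣comprehension∣ (center? D))))) ⟩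
           ∑S (λ D → ∣ centers D ∣) ∎))) ⟩
    # (closed? edge? high?) + (# lowPair? + (# dropping? + ∑S (λ D → ∣ centers D ∣))) ∎
    where
    open ≤-Reasoning
    pointwise : ∀ E → ⟦ edge? E ⟧ ≤ ⟦ closed? edge? high? E ⟧ + (⟦ lowPair? E ⟧ + (⟦ dropping? E ⟧ + ∑F (λ w → ⟦ w ∈? E ⟧ * ⟦ center? (E ⊖ w) w ⟧)))
    pointwise E = ⟦⟧≤ (edge? E) (λ E∈F → classify E∈F (closed? edge? high? E) (lowPair? E) (dropping? E)
                                          (any? (λ w → (w ∈? E) ×-dec ¬? (high? (E ⊖ w)))))
      where
      A = ⟦ closed? edge? high? E ⟧
      B = ⟦ lowPair? E ⟧
      Z = ⟦ dropping? E ⟧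
      V = ∑F (λ w → ⟦ w ∈? E ⟧ * ⟦ center? (E ⊖ w) w ⟧)
      classify : E List∈.∈ F → Dec (Closed (List∈._∈ F) High E) → Dec (LowPair E) → Dec (Dropping E) →
                 Dec (∃[ w ] (w ∈ E × ¬ High (E ⊖ w))) → 1 ≤ A + (B + (Z + V))
      classify E∈F (yes h) _ _ _ = ≤-trans (1≤⟦⟧ (closed? edge? high? E) h) (m≤m+n A _)
      classify E∈F (no _) (yes h) _ _ = ≤-trans (1≤⟦⟧ (lowPair? E) h) (≤-trans (m≤m+n B _) (m≤n+m _ A))
      classify E∈F (no _) (no _) (yes h) _ = ≤-trans (1≤⟦⟧ (dropping? E) h) (≤-trans (m≤m+n Z V) (≤-trans (m≤n+m _ B) (m≤n+m _ A)))
      classify E∈F (no ¬closed) (no _) (no _) (no ¬w) = contradiction (E∈F , λ a a∈E → case high? (E ⊖ a) of λ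
                    { (yes h) → h ; (no ¬h) → contradiction (a , a∈E , ¬h) ¬w }) ¬closed
      classify E∈F (no _) (no ¬lowPair) (no ¬dropping) (yes (w , w∈E , ¬high)) = ≤-trans (≤-trans
                    (1≤* (1≤⟦⟧ (w ∈? E) w∈E) (1≤⟦⟧ (center? (E ⊖ w) w)
                      ((suc-injective (trans (∣⊖∣ w∈E) size) , ¬high) , (∉⊖-self E w , subst (List∈._∈ F) (sym (⊖⊕ w∈E)) E∈F)
                      , (w∈W , λ x x∈Ew → subst (λ E → High (E ⊖ x)) (sym (⊖⊕ w∈E)) (high (∈⊖⁻ w x∈Ew) (∈⊖-≢ x∈Ew))))))
                    (∑F-member (λ w → ⟦ w ∈? E ⟧ * ⟦ center? (E ⊖ w) w ⟧) w))
                    (≤-trans (m≤n+m V Z) (≤-trans (m≤n+m _ B) (m≤n+m _ A)))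
        where
        size : ∣ E ∣ ≡ 3 + ρ
        size = F-uniform E∈F
        high : ∀ {x} → x ∈ E → x ≢ w → High (E ⊖ x)
        high {x} x∈E x≢w with high? (E ⊖ x)
        ... | yes h = h
        ... | no ¬h = contradiction (E∈F , w , w∈E , ¬high , x , ∈⊖⁺ x∈E x≢w , ¬h) ¬lowPair
        w∈W : w ∈ W
        w∈W = ∈-comprehension⁺ (λ w → heavy? (1 + ρ) (⊥ ⊕ w)) (heavy-subsets size ¬dropping high (1 + ρ) (∈⊕-self ⊥ w)
                (λ h → [ (λ { refl → w∈E }) , (λ h → contradiction h ∉⊥) ]′ (∈⊕⁻ h))
                (cong (_+ (1 + ρ)) (trans (∣⊕∣ {D = ⊥} {w} ∉⊥) (cong suc (∣⊥∣≡0 n)))))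

  conflict? : Decidable (λ P → ∣ P ∣ ≡ 1 + ρ × 2 + τ ≤ ∣ neighbours P ∣)
  conflict? P = (∣ P ∣ ≟ 1 + ρ) ×-dec (2 + τ ≤? ∣ neighbours P ∣)

  -- A conflicting P lies in the common link of some set S of 2 + τ elements of `W`. The sum over
  -- all such S is affordable because `W` is small.
  conflict-bound : (∀ S → ∣ S ∣ ≡ 2 + τ → # (commonLink? S) ≤ s * layer n ρ) →
                   # conflict? ≤ ∣ W ∣ ^ (2 + τ) * (s * layer n ρ)
  conflict-bound sparse = begin
    # conflict?
      ≤⟨ ∑-mono (allSubsets n) pointwise ⟩
    ∑S (λ P → ∑S (λ S → ⟦ (∣ S ∣ ≟ 2 + τ) ×-dec (S ⊆? W) ⟧ * ⟦ commonLink? S P ⟧))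
      ≡⟨ ∑-swap (allSubsets n) (allSubsets n) _ ⟩
    ∑S (λ S → ∑S (λ P → ⟦ (∣ S ∣ ≟ 2 + τ) ×-dec (S ⊆? W) ⟧ * ⟦ commonLink? S P ⟧))
      ≤⟨ ∑-mono (allSubsets n) (λ S → ≤-trans (≤-reflexive (∑-*ˡ (allSubsets n) ⟦ (∣ S ∣ ≟ 2 + τ) ×-dec (S ⊆? W) ⟧ _))
           (restrict ((∣ S ∣ ≟ 2 + τ) ×-dec (S ⊆? W)))) ⟩
    ∑S (λ S → ⟦ (∣ S ∣ ≟ 2 + τ) ×-dec (S ⊆? W) ⟧ * (s * layer n ρ))
      ≡⟨ ∑-*ʳ (allSubsets n) (s * layer n ρ) _ ⟩
    # (λ S → (∣ S ∣ ≟ 2 + τ) ×-dec (S ⊆? W)) * (s * layer n ρ)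
      ≤⟨ *-monoˡ-≤ (s * layer n ρ) (subsets≤^ W (2 + τ)) ⟩
    ∣ W ∣ ^ (2 + τ) * (s * layer n ρ) ∎
    where
    open ≤-Reasoning
    restrict : ∀ {S} (d : Dec (∣ S ∣ ≡ 2 + τ × S ⊆ W)) → ⟦ d ⟧ * # (commonLink? S) ≤ ⟦ d ⟧ * (s * layer n ρ)
    restrict (no _)           = z≤n
    restrict {S} (yes (size , _)) = *-monoʳ-≤ 1 (sparse S size)
    pointwise : ∀ P → ⟦ conflict? P ⟧ ≤ ∑S (λ S → ⟦ (∣ S ∣ ≟ 2 + τ) ×-dec (S ⊆? W) ⟧ * ⟦ commonLink? S P ⟧)
    pointwise P = ⟦⟧≤ (conflict? P) λ (size , many) →
      let S , S⊆N , ∣S∣ = subset-of-size (neighbours P) (2 + τ) many in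
      ≤-trans (1≤* (1≤⟦⟧ ((∣ S ∣ ≟ 2 + τ) ×-dec (S ⊆? W)) (∣S∣ , (λ h → proj₁ (∈-comprehension⁻ (neighbour? P) (S⊆N h)))))
                   (1≤⟦⟧ (commonLink? S P) (size , λ w w∈S → proj₂ (∈-comprehension⁻ (neighbour? P) (S⊆N w∈S)))))
              (∑S-member (λ S → ⟦ (∣ S ∣ ≟ 2 + τ) ×-dec (S ⊆? W) ⟧ * ⟦ commonLink? S P ⟧) S)

  Bad : Pred (Subset n) 0ℓ
  Bad D = ∃[ x ] (x ∈ D × (∣ D ⊖ x ∣ ≡ 1 + ρ × 2 + τ ≤ ∣ neighbours (D ⊖ x) ∣))

  bad? : Decidable Bad
  bad? D = any? (λ x → (x ∈? D) ×-dec conflict? (D ⊖ x))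

  bad-bound : # bad? ≤ n * # conflict?
  bad-bound = ≤-trans (∑-mono (allSubsets n) (λ D → ⟦⟧≤ (bad? D) (λ (x , x∈D , h) →
      ≤-trans (1≤* (1≤⟦⟧ (x ∈? D) x∈D) (1≤⟦⟧ (conflict? (D ⊖ x)) h)) (∑F-member (λ x → ⟦ x ∈? D ⟧ * ⟦ conflict? (D ⊖ x) ⟧) x))))
    (∑-shadow≤ conflict?)

  Tight : Pred (Subset n) 0ℓ
  Tight D = ∣ D ∣ ≡ 2 + ρ × ¬ Bad D × ∣ centers D ∣ ≡ suc τ

  tight? : Decidable Tight
  tight? D = (∣ D ∣ ≟ 2 + ρ) ×-dec (¬? (bad? D) ×-dec (∣ centers D ∣ ≟ suc τ))

  neighbours≤ : ∀ {D x} → ∣ D ∣ ≡ 2 + ρ → ¬ Bad D → x ∈ D → ∣ neighbours (D ⊖ x) ∣ ≤ suc τ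
  neighbours≤ size ¬bad x∈D = ≤-pred (≰⇒> (λ many → ¬bad (_ , x∈D , suc-injective (trans (∣⊖∣ x∈D) size) , many)))

  -- If D is not bad, its centers lie among the at most 1 + τ neighbours of `D ⊖ x`, for any x in D.
  -- A bad set is charged the trivial bound s.
  centers-bound : ∑S (λ D → ∣ centers D ∣) ≤ s * # bad? + (τ * layer n (2 + ρ) + # tight?)
  centers-bound = begin
    ∑S (λ D → ∣ centers D ∣)
      ≤⟨ ∑-mono (allSubsets n) pointwise ⟩
    ∑S (λ D → s * ⟦ bad? D ⟧ + (τ * ⟦ ∣ D ∣ ≟ 2 + ρ ⟧ + ⟦ tight? D ⟧))
      ≡⟨ trans (∑-+ (allSubsets n) _ _) (cong₂ _+_ (∑-*ˡ (allSubsets n) s _) (trans (∑-+ (allSubsets n) (λ D → τ * ⟦ ∣ D ∣ ≟ 2 + ρ ⟧) _) (cong (_+ # tight?) (∑-*ˡ (allSubsets n) τ (λ D → ⟦ ∣ D ∣ ≟ 2 + ρ ⟧))))) ⟩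
    s * # bad? + (τ * layer n (2 + ρ) + # tight?) ∎
    where
    open ≤-Reasoning
    pointwise : ∀ D → ∣ centers D ∣ ≤ s * ⟦ bad? D ⟧ + (τ * ⟦ ∣ D ∣ ≟ 2 + ρ ⟧ + ⟦ tight? D ⟧)
    pointwise D = by-cases (bad? D) (∣ D ∣ ≟ 2 + ρ) (∣ centers D ∣ ≟ suc τ)
      where
      by-cases : (d₁ : Dec (Bad D)) (d₂ : Dec (∣ D ∣ ≡ 2 + ρ)) (d₃ : Dec (∣ centers D ∣ ≡ suc τ)) →
                 ∣ centers D ∣ ≤ s * ⟦ d₁ ⟧ + (τ * ⟦ d₂ ⟧ + ⟦ d₂ ×-dec (¬? d₁ ×-dec d₃) ⟧)
      by-cases (yes _) d₂ d₃ = ≤-trans (centers≤s D) (≤-trans (≤-reflexive (sym (*-identityʳ s))) (m≤m+n _ _))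
      by-cases (no _) (no ¬size) d₃ = ≤-trans (≤-reflexive (centers-size {D} ¬size)) z≤n
      by-cases (no ¬bad) (yes size) d₃ = ≤-trans (from d₃) (m≤n+m _ (s * 0))
        where
        ≤1+τ : ∣ centers D ∣ ≤ suc τ
        ≤1+τ = let x , x∈D = size-nonempty size in
          ≤-trans (p⊆q⇒∣p∣≤∣q∣ {p = centers D} {neighbours (D ⊖ x)} (centers⊆neighbours x∈D)) (neighbours≤ size ¬bad x∈D)
        from : (d₃ : Dec (∣ centers D ∣ ≡ suc τ)) → ∣ centers D ∣ ≤ τ * 1 + ⟦ yes size ×-dec (¬? (no ¬bad) ×-dec d₃) ⟧
        from (yes e) = ≤-reflexive (trans e (sym (trans (cong (_+ 1) (*-identityʳ τ)) (+-comm τ 1))))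
        from (no ¬e) = ≤-trans (≤-pred (≤∧≢⇒< ≤1+τ ¬e)) (≤-reflexive (sym (trans (+-identityʳ _) (*-identityʳ τ))))

  class? : ∀ A → Decidable (λ D → Tight D × centers D ≡ A)
  class? A D = tight? D ×-dec (centers D ≟ˢ A)

  base? : ∀ A → Decidable (λ P → ∣ P ∣ ≡ 1 + ρ × neighbours P ≡ A)
  base? A P = (∣ P ∣ ≟ 1 + ρ) ×-dec (neighbours P ≟ˢ A)

  -- The inclusion of the centers in the neighbours is an equality because a tight set already has
  -- the maximal number 1 + τ.
  class-shadow : ∀ {A D a} → Tight D × centers D ≡ A → a ∈ D → ∣ D ⊖ a ∣ ≡ 1 + ρ × neighbours (D ⊖ a) ≡ A
  class-shadow {A} {D} {a} ((size , ¬bad , e) , refl) a∈D = suc-injective (trans (∣⊖∣ a∈D) size) ,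
    sym (⊆∧≤⇒≡ {p = centers D} {neighbours (D ⊖ a)} (centers⊆neighbours a∈D) (≤-trans (neighbours≤ size ¬bad a∈D) (≤-reflexive (sym e))))

  -- If no class were that big, `shadow-bound` would apply to each of them with the same x; as the
  -- bases are disjoint, the sum contradicts the hypothesis.
  big-class : ∀ x → x * n ^ (1 + ρ) < (2 + ρ) ! * # tight? → ∃[ A ] x ^ (2 + ρ) < (2 + ρ) ! * # (class? A)
  big-class x lt with anySubset? (λ A → x ^ (2 + ρ) <? (2 + ρ) ! * # (class? A))
  ... | yes w = w
  ... | no ¬w = contradiction lt (≤⇒≯ (begin
    (2 + ρ) ! * # tight?
      ≡⟨ sym (trans (∑-*ˡ (allSubsets n) ((2 + ρ) !) _) (cong ((2 + ρ) ! *_) (∑-fibres (allSubsets n) _≟ˢ_ #-≟ˢ′≡1 tight? centers))) ⟩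
    ∑S (λ A → (2 + ρ) ! * # (class? A))
      ≤⟨ ∑-mono (allSubsets n) (λ A → begin
           (2 + ρ) * (1 + ρ) ! * # (class? A)   ≡⟨ solve 3 (λ a b c → a :* b :* c := b :* (a :* c)) refl (2 + ρ) ((1 + ρ) !) (# (class? A)) ⟩
           (1 + ρ) ! * ((2 + ρ) * # (class? A)) ≤⟨ *-monoʳ-≤ ((1 + ρ) !) (shadow-bound (1 + ρ) x (class? A) (base? A) (proj₁ ∘ proj₁) proj₁ class-shadow (≮⇒≥ (λ big → ¬w (A , big)))) ⟩
           (1 + ρ) ! * (x * # (base? A))        ≡⟨ solve 3 (λ a b c → a :* (b :* c) := (b :* a) :* c) refl ((1 + ρ) !) x (# (base? A)) ⟩
           x * (1 + ρ) ! * # (base? A)          ∎) ⟩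
    ∑S (λ A → x * (1 + ρ) ! * # (base? A))
      ≡⟨ trans (∑-*ˡ (allSubsets n) (x * (1 + ρ) !) _) (cong (x * (1 + ρ) ! *_) (∑-fibres (allSubsets n) _≟ˢ_ #-≟ˢ′≡1 (λ P → ∣ P ∣ ≟ 1 + ρ) neighbours)) ⟩
    x * (1 + ρ) ! * layer n (1 + ρ)
      ≡⟨ *-assoc x ((1 + ρ) !) _ ⟩
    x * ((1 + ρ) ! * layer n (1 + ρ))
      ≤⟨ *-monoʳ-≤ x (!*layer≤^ n (1 + ρ)) ⟩
    x * n ^ (1 + ρ) ∎))
    where
    open ≤-Reasoning
    open +-*-Solver

  class⊆link : ∀ {A D} → Tight D × centers D ≡ A → InLink F A D
  class⊆link {D = D} (_ , refl) a h = let _ , (a∉D , e) , _ = ∈-comprehension⁻ (center? D) h in a∉D , subst (List∈._∈ F) (sym (∪⁅⁆≡⊕ D a)) e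

  -- The tangent of x^(2 + ρ) at n turns the lower bound on the class into a linear one, so a
  -- shortage Y of tight sets becomes a shortage (2 + ρ) Y of the class, up to lower-order terms.
  largest-class : 1 ≤ n → suc τ ≤ n → ∀ Y → layer n (2 + ρ) ≤ # tight? + Y →
    ∃[ A ] (∣ A ∣ ≡ suc τ × layer n (2 + ρ) ≤ # (inLink? F A) + ((2 + ρ) * Y + (2 + ρ) * ((2 + ρ) * (2 + ρ)) * n ^ (1 + ρ)))
  largest-class 1≤n τ<n Y le with # tight? in count
  -- Without tight sets Y alone is at least the whole layer, and any A of the right size will do.
  ... | zero = let A , _ , size = subset-of-size (⊤ {n}) (suc τ) (≤-trans τ<n (≤-reflexive (sym (∣⊤∣≡n n)))) in
    A , size , ≤-trans le (≤-trans (m≤n*m′ {n = 2 + ρ} (s≤s z≤n)) (≤-trans (m≤m+n _ _) (m≤n+m _ (# (inLink? F A)))))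
  ... | suc d′ = conclude (big-class x (subst (λ d → x * m < κ ! * d) (sym count) x*m<))
    where
    κ = 2 + ρ
    m = n ^ (1 + ρ)
    instance
      m-nonZero : NonZero m
      m-nonZero = >-nonZero (m^n>0 n {{>-nonZero 1≤n}} (1 + ρ))
    d = suc d′
    N = κ ! * d
    1≤N : 1 ≤ N
    1≤N = 1≤* (1≤! κ) (s≤s {n = d′} z≤n)
    -- The largest x with x * m < N; subtracting 1 gives the strict inequality that `big-class` asks
    -- for, and N ≤ x * m + m still holds.
    x = (N ∸ 1) / m
    x*m< : x * m < N
    x*m< = ≤-trans (s≤s (m/n*n≤m (N ∸ 1) m)) (≤-reflexive (m+[n∸m]≡n 1≤N))
    N≤ : N ≤ x * m + m
    N≤ = ≤-trans (≤-reflexive (trans (sym (m+[n∸m]≡n 1≤N)) (cong suc (m≡m%n+[m/n]*n (N ∸ 1) m))))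
           (≤-trans (+-monoˡ-≤ (x * m) (m%n<n (N ∸ 1) m)) (≤-reflexive (+-comm m (x * m))))
    conclude : ∃[ A ] x ^ κ < κ ! * # (class? A) →
      ∃[ A ] (∣ A ∣ ≡ suc τ × layer n κ ≤ # (inLink? F A) + (κ * Y + κ * (κ * κ) * m))
    conclude (A , big) = A , size , ≤-trans final (+-monoˡ-≤ (κ * Y + κ * (κ * κ) * m) (#-mono (class? A) (inLink? F A) class⊆link))
      where
      open ≤-Reasoning
      open +-*-Solver
      c = # (class? A)
      L = layer n κ
      ι = 1 + ρ
      size : ∣ A ∣ ≡ suc τ
      size = let D , (_ , _ , e) , eq = #-witness (class? A) (n≢0⇒n>0 (λ c≡0 → contradiction big (≤⇒≯ (≤-trans (≤-reflexive (trans (cong (κ ! *_) c≡0) (*-zeroʳ (κ !)))) z≤n)))) in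
             trans (cong ∣_∣ (sym eq)) e
      final : L ≤ c + (κ * Y + κ * (κ * κ) * m)
      -- The tangent estimate leaves ι n^κ on the right, essentially ι κ! L; adding that amount to
      -- both sides turns L on the left into κ L, as κ = ι + 1.
      final = *-cancelˡ-≤ (κ !) {{>-nonZero (1≤! κ)}} (+-cancelʳ-≤ (ι * (κ ! * L)) _ _ (begin
        κ ! * L + ι * (κ ! * L)
          ≡⟨⟩
        κ * (κ ! * L)
          ≤⟨ *-monoʳ-≤ κ (*-monoʳ-≤ (κ !) le) ⟩
        κ * (κ ! * (d + Y))
          ≡⟨ solve 4 (λ κ f d y → κ :* (f :* (d :+ y)) := κ :* (f :* d) :+ κ :* f :* y) refl κ (κ !) d Y ⟩
        κ * N + κ * κ ! * Y
          ≤⟨ +-monoˡ-≤ (κ * κ ! * Y) (*-monoʳ-≤ κ N≤) ⟩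
        κ * (x * m + m) + κ * κ ! * Y
          ≡⟨ cong (_+ κ * κ ! * Y) (solve 3 (λ κ x m → κ :* (x :* m :+ m) := κ :* m :* x :+ κ :* m) refl κ x m) ⟩
        κ * m * x + κ * m + κ * κ ! * Y
          ≤⟨ +-monoˡ-≤ (κ * κ ! * Y) (+-monoˡ-≤ (κ * m) (≤-trans (amgm ι n x) (+-mono-≤ (<⇒≤ big) (*-monoʳ-≤ ι (^≤!*layer+ n ι))))) ⟩
        κ ! * c + ι * (κ ! * L + κ * κ * m) + κ * m + κ * κ ! * Y
          ≡⟨ solve 7 (λ f c ι l κ m y → f :* c :+ ι :* (f :* l :+ κ :* κ :* m) :+ κ :* m :+ κ :* f :* y
                        := f :* c :+ f :* (κ :* y) :+ (ι :* (κ :* κ) :+ κ) :* m :+ ι :* (f :* l)) refl (κ !) c ι L κ m Y ⟩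
        κ ! * c + κ ! * (κ * Y) + (ι * (κ * κ) + κ) * m + ι * (κ ! * L)
          ≤⟨ +-monoˡ-≤ (ι * (κ ! * L)) (+-monoʳ-≤ (κ ! * c + κ ! * (κ * Y)) (*-monoˡ-≤ m (≤-trans
               (≤-reflexive (+-comm (ι * (κ * κ)) κ)) (+-monoˡ-≤ (ι * (κ * κ)) (m≤n*m′ {κ} {κ} (s≤s z≤n)))))) ⟩
        κ ! * c + κ ! * (κ * Y) + (κ * (κ * κ)) * m + ι * (κ ! * L)
          ≤⟨ +-monoˡ-≤ (ι * (κ ! * L)) (+-monoʳ-≤ (κ ! * c + κ ! * (κ * Y)) (m≤n*m′ {n = κ !} (1≤! κ))) ⟩
        κ ! * c + κ ! * (κ * Y) + κ ! * (κ * (κ * κ) * m) + ι * (κ ! * L)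
          ≡⟨ cong (_+ ι * (κ ! * L)) (solve 4 (λ f c y z → f :* c :+ f :* y :+ f :* z := f :* (c :+ (y :+ z))) refl (κ !) c (κ * Y) (κ * (κ * κ) * m)) ⟩
        κ ! * (c + (κ * Y + κ * (κ * κ) * m)) + ι * (κ ! * L) ∎))

-- Counting edges through a vertex set

∑-unique : (F : List (Subset n)) → Unique F → (g : Subset n → ℕ) → ∑ F g ≡ ∑S (λ E → ⟦ E ∈ᴱ? F ⟧ * g E)
∑-unique {n} [] _ g = sym (∑-zero (allSubsets n))
∑-unique {n} (x ∷ F) (x∉F ∷ unique) g = begin
  g x + ∑ F g
    ≡⟨ cong₂ _+_ (sym (trans (∑-*ʳ (allSubsets n) (g x) (λ E → ⟦ E ≟ˢ x ⟧)) (trans (cong (_* g x) (#-≟ˢ≡1 x)) (+-identityʳ (g x))))) (∑-unique F unique g) ⟩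
  ∑S (λ E → ⟦ E ≟ˢ x ⟧ * g x) + ∑S (λ E → ⟦ E ∈ᴱ? F ⟧ * g E)
    ≡⟨ sym (∑-+ (allSubsets n) _ _) ⟩
  ∑S (λ E → ⟦ E ≟ˢ x ⟧ * g x + ⟦ E ∈ᴱ? F ⟧ * g E)
    ≡⟨ ∑-cong (allSubsets n) (λ E → split E (E ≟ˢ x) (E ∈ᴱ? F) (E ∈ᴱ? (x ∷ F))) ⟩
  ∑S (λ E → ⟦ E ∈ᴱ? (x ∷ F) ⟧ * g E) ∎
  where
  open ≡-Reasoning
  split : ∀ E (d : Dec (E ≡ x)) (d′ : Dec (E List∈.∈ F)) (d″ : Dec (E List∈.∈ (x ∷ F))) → ⟦ d ⟧ * g x + ⟦ d′ ⟧ * g E ≡ ⟦ d″ ⟧ * g E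
  split E (yes refl) (yes E∈F) d″ = contradiction refl (All.lookup x∉F E∈F)
  split E (yes refl) (no _) d″ = trans (+-identityʳ _) (sym (cong (_* g E) (⟦⟧≡1 d″ (here refl))))
  split E (no _) (yes E∈F) d″ = sym (cong (_* g E) (⟦⟧≡1 d″ (there E∈F)))
  split E (no E≢x) (no E∉F) d″ = sym (cong (_* g E) (⟦⟧≡0 d″ (λ { (here e) → E≢x e ; (there h) → E∉F h })))

length≡# : (F : List (Subset n)) → Unique F → length F ≡ # (_∈ᴱ? F)
length≡# {n} F unique = trans (sym (trans (∑-const F 1) (*-identityʳ _)))
  (trans (∑-unique F unique (λ _ → 1)) (∑-cong (allSubsets n) (λ E → *-identityʳ _)))

-- A set D in the link avoids all of A, so `D ⊕ a` meets A in a only. Hence D and a can be recovered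
-- from the edge, and distinct pairs give distinct edges.
link-edges : (F : List (Subset n)) → Unique F → (A : Subset n) → ∣ A ∣ * # (inLink? F A) ≤ ∑ F (λ E → ⟦ ∣ A ∩ E ∣ ≟ 1 ⟧)
link-edges {n} F unique A = begin
  ∣ A ∣ * # (inLink? F A)
    ≡⟨ trans (cong (_* # (inLink? F A)) (∣∣≡∑ A)) (trans (*-comm _ (# (inLink? F A))) (sym (∑-*ʳ (allSubsets n) _ _))) ⟩
  ∑S (λ D → ⟦ inLink? F A D ⟧ * ∑F (λ a → ⟦ a ∈? A ⟧))
    ≡⟨ ∑-cong (allSubsets n) (λ D → sym (∑-*ˡ (allFin n) ⟦ inLink? F A D ⟧ _)) ⟩
  ∑S (λ D → ∑F (λ a → ⟦ inLink? F A D ⟧ * ⟦ a ∈? A ⟧))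
    ≤⟨ ∑-mono (allSubsets n) (λ D → ∑-mono (allFin n) (λ a → avoid D a (inLink? F A D) (a ∈? A))) ⟩
  ∑S (λ D → ∑F (λ a → ⟦ ¬? (a ∈? D) ⟧ * (⟦ inLink? F A D ⟧ * ⟦ a ∈? A ⟧)))
    ≡⟨ double-count {n} (λ a D E → ⟦ inLink? F A D ⟧ * ⟦ a ∈? A ⟧) ⟩
  ∑S (λ E → ∑F (λ a → ⟦ a ∈? E ⟧ * (⟦ inLink? F A (E ⊖ a) ⟧ * ⟦ a ∈? A ⟧)))
    ≤⟨ ∑-mono (allSubsets n) (λ E → through E (any? (λ a → (a ∈? E) ×-dec (inLink? F A (E ⊖ a) ×-dec (a ∈? A))))) ⟩
  ∑S (λ E → ⟦ E ∈ᴱ? F ⟧ * ⟦ ∣ A ∩ E ∣ ≟ 1 ⟧)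
    ≡⟨ sym (∑-unique F unique (λ E → ⟦ ∣ A ∩ E ∣ ≟ 1 ⟧)) ⟩
  ∑ F (λ E → ⟦ ∣ A ∩ E ∣ ≟ 1 ⟧) ∎
  where
  open ≤-Reasoning
  avoid : ∀ D a (d : Dec (InLink F A D)) (d′ : Dec (a ∈ A)) → ⟦ d ⟧ * ⟦ d′ ⟧ ≤ ⟦ ¬? (a ∈? D) ⟧ * (⟦ d ⟧ * ⟦ d′ ⟧)
  avoid D a (no _)  d′       = z≤n
  avoid D a (yes _) (no _)   = z≤n
  avoid D a (yes h) (yes a∈) = ≤-trans (1≤⟦⟧ (¬? (a ∈? D)) (proj₁ (h a a∈))) (≤-reflexive (sym (*-identityʳ _)))
  Incident : Subset n → Fin n → Set
  Incident E a = a ∈ E × (InLink F A (E ⊖ a) × a ∈ A)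
  through : ∀ E → Dec (∃[ a ] Incident E a) → ∑F (λ a → ⟦ a ∈? E ⟧ * (⟦ inLink? F A (E ⊖ a) ⟧ * ⟦ a ∈? A ⟧)) ≤ ⟦ E ∈ᴱ? F ⟧ * ⟦ ∣ A ∩ E ∣ ≟ 1 ⟧
  through E (no ¬w) = ≤-trans (≤-reflexive (trans (∑-cong (allFin n) (λ a → zero-term a (a ∈? E) (inLink? F A (E ⊖ a)) (a ∈? A))) (∑-zero (allFin n)))) z≤n
    where
    zero-term : ∀ a (d : Dec (a ∈ E)) (d′ : Dec (InLink F A (E ⊖ a))) (d″ : Dec (a ∈ A)) → ⟦ d ⟧ * (⟦ d′ ⟧ * ⟦ d″ ⟧) ≡ 0
    zero-term a (no _) d′ d″ = refl
    zero-term a (yes _) (no _) d″ = refl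
    zero-term a (yes _) (yes _) (no _) = refl
    zero-term a (yes h) (yes h′) (yes h″) = contradiction (a , h , h′ , h″) ¬w
  through E (yes (a , a∈E , link , a∈A)) = begin
    ∑F (λ a → ⟦ a ∈? E ⟧ * (⟦ inLink? F A (E ⊖ a) ⟧ * ⟦ a ∈? A ⟧))
      ≤⟨ ∑-mono (allFin n) (λ b → ⟦⟧*≤ (b ∈? E) (λ b∈E → ⟦⟧*≤ (inLink? F A (E ⊖ b)) (λ _ → ⟦⟧-mono (b ∈? A) (b ∈? (A ∩ E)) (λ b∈A → x∈p∩q⁺ (b∈A , b∈E))))) ⟩
    ∑F (λ b → ⟦ b ∈? (A ∩ E) ⟧)
      ≡⟨ trans (sym (∣∣≡∑ (A ∩ E))) one ⟩
    1
      ≤⟨ 1≤* (1≤⟦⟧ (E ∈ᴱ? F) (subst (List∈._∈ F) (trans (∪⁅⁆≡⊕ (E ⊖ a) a) (⊖⊕ a∈E)) (proj₂ (link a a∈A)))) (1≤⟦⟧ (∣ A ∩ E ∣ ≟ 1) one) ⟩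
    ⟦ E ∈ᴱ? F ⟧ * ⟦ ∣ A ∩ E ∣ ≟ 1 ⟧ ∎
    where
    one : ∣ A ∩ E ∣ ≡ 1
    one = trans (cong ∣_∣ (⊆-antisym {i = A ∩ E} {⁅ a ⁆}
        (λ {b} h → let b∈A , b∈E = x∈p∩q⁻ A E h in case b ≟ᶠ a of λ
            { (yes refl) → x∈⁅x⁆ a ; (no b≢a) → contradiction (∈⊖⁺ b∈E b≢a) (proj₁ (link b b∈A)) })
        (λ h → subst (_∈ A ∩ E) (sym (x∈⁅y⁆⇒x≡y a h)) (x∈p∩q⁺ (a∈A , a∈E))))) (∣⁅x⁆∣≡1 a)

badCount+link : (F : List (Subset n)) → Unique F → (A : Subset n) → badCount F A + ∣ A ∣ * # (inLink? F A) ≤ length F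
badCount+link F unique A = begin
  badCount F A + ∣ A ∣ * # (inLink? F A)
    ≤⟨ +-mono-≤ (≤-reflexive (length-filter (λ e → ¬? (∣ A ∩ e ∣ ≟ 1)) F)) (link-edges F unique A) ⟩
  ∑ F (λ E → ⟦ ¬? (∣ A ∩ E ∣ ≟ 1) ⟧) + ∑ F (λ E → ⟦ ∣ A ∩ E ∣ ≟ 1 ⟧)
    ≡⟨ sym (∑-+ F _ _) ⟩
  ∑ F (λ E → ⟦ ¬? (∣ A ∩ E ∣ ≟ 1) ⟧ + ⟦ ∣ A ∩ E ∣ ≟ 1 ⟧)
    ≡⟨ ∑-cong F (λ E → one (∣ A ∩ E ∣ ≟ 1)) ⟩
  ∑ F (λ _ → 1)
    ≡⟨ trans (∑-const F 1) (*-identityʳ _) ⟩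
  length F ∎
  where
  open ≤-Reasoning
  one : {P : Set} (d : Dec P) → ⟦ ¬? d ⟧ + ⟦ d ⟧ ≡ 1
  one (yes _) = refl
  one (no _)  = refl

-- The error term

-- `X` is the amount by which `F` may fall short of the main term, and `e` collects all other
-- errors. For q at least n^β the bound on e * q yields e ≤ n^(r-1-β) in integers.
record Stable (n s ρ τ q : ℕ) (F : List (Subset n)) (X : ℕ) : Set where
  field
    A         : Subset n
    size      : ∣ A ∣ ≡ suc τ
    e         : ℕ
    e*q≤      : e * q ≤ n ^ (2 + ρ)
    link-large : layer n (2 + ρ) ≤ # (inLink? F A) + ((2 + ρ) * X + e)
    few-edges  : length F ≤ e + suc τ * layer n (2 + ρ)

-- Chosen so that the dropping edges, multiplied by κ, amount to at most half of n^κ / q.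
scale : ℕ → ℕ → ℕ
scale s κ = 2 * κ * (s * 2 ^ κ)

-- The bound on the size of `W` that results from b = `scale s (2 + ρ) * q`.
heavyBound : ℕ → ℕ → ℕ → ℕ
heavyBound s ρ q = ((scale s (2 + ρ) * q) * (2 + ρ)) ^ (1 + ρ) * s

module Conclusion {s n ρ τ : ℕ} (H : List (Subset s)) (H-graph : IsRGraph (3 + ρ) H)
  {t : ℕ} (T : List (Subset t)) (tree : IsRTree (3 + ρ) T) (reducible : TwoReducible T) (H⊆T : Embeds H T)
  (X₀ : Subset s) (cut : IsCrossCut H X₀) (∣X₀∣ : ∣ X₀ ∣ ≡ 2 + τ)
  (F : List (Subset n)) (F-graph : IsRGraph (3 + ρ) F) (free : ¬ Embeds H F) (2s≤n : s + s ≤ n) where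

  private
    κ = 2 + ρ
    m = n ^ (1 + ρ)
    σ≤s : 2 + τ ≤ s
    σ≤s = ≤-trans (≤-reflexive (sym ∣X₀∣)) (∣p∣≤n X₀)
    1≤s : 1 ≤ s
    1≤s = ≤-trans (s≤s z≤n) σ≤s
    s≤n : s ≤ n
    s≤n = ≤-trans (m≤m+n s s) 2s≤n
    1≤n : 1 ≤ n
    1≤n = ≤-trans 1≤s s≤n
    F-uniform : ∀ {E} → E List∈.∈ F → ∣ E ∣ ≡ 3 + ρ
    F-uniform = All.lookup (proj₂ F-graph)

  open Degrees s ρ F
  open Free H (All.lookup (proj₂ H-graph)) T tree reducible H⊆T 1≤s F F-uniform free

  -- All errors except the dropping edges are of the form constant times n^(1 + ρ); the smallness
  -- hypothesis on q keeps their total within the other half of n^κ / q.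
  stable : (q : ℕ) → 1 ≤ q → 2 * q * (κ * (3 * (s * s) + s * s * heavyBound s ρ q ^ (2 + τ)) + κ * (κ * κ)) ≤ n →
           ∀ X → suc τ * layer n κ ≤ length F + X → Stable n s ρ τ q F X
  stable q 1≤q small X dense = record
    { A = proj₁ largest ; size = proj₁ (proj₂ largest) ; e = e ; e*q≤ = e*q≤
    ; link-large = ≤-trans (proj₂ (proj₂ largest)) (≤-reflexive (cong (# (inLink? F (proj₁ largest)) +_)
        (solve 4 (λ k x y z → k :* (x :+ y) :+ z := k :* x :+ (k :* y :+ z)) refl κ X err (κ * (κ * κ) * m))))
    ; few-edges = few-edges }
    where
    open +-*-Solver
    b = scale s κ * q
    open Counting s ρ τ b F F-uniform
    open Classes s ρ τ b F F-uniform
    err₁ = # (closed? edge? high?) + # lowPair?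
    err = err₁ + (# dropping? + s * # bad?)
    e = κ * err + κ * (κ * κ) * m

    edges≤ : length F ≤ err + (τ * layer n κ + # tight?)
    edges≤ = begin
      length F  ≡⟨ length≡# F (proj₁ F-graph) ⟩
      # edge?   ≤⟨ edges-split ⟩
      # (closed? edge? high?) + (# lowPair? + (# dropping? + ∑S (λ D → ∣ centers D ∣)))
        ≤⟨ +-monoʳ-≤ (# (closed? edge? high?)) (+-monoʳ-≤ (# lowPair?) (+-monoʳ-≤ (# dropping?) centers-bound)) ⟩
      # (closed? edge? high?) + (# lowPair? + (# dropping? + (s * # bad? + (τ * layer n κ + # tight?))))
        ≡⟨ solve 5 (λ a b c d x → a :+ (b :+ (c :+ (d :+ x))) := (a :+ b) :+ (c :+ d) :+ x) refl
             (# (closed? edge? high?)) (# lowPair?) (# dropping?) (s * # bad?) (τ * layer n κ + # tight?) ⟩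
      err + (τ * layer n κ + # tight?) ∎
      where open ≤-Reasoning

    few-edges : length F ≤ e + suc τ * layer n κ
    few-edges = begin
      length F                                       ≤⟨ edges≤ ⟩
      err + (τ * layer n κ + # tight?)               ≤⟨ +-mono-≤ (≤-trans (m≤n*m′ {err} {κ} (s≤s z≤n)) (m≤m+n (κ * err) _)) (+-monoʳ-≤ (τ * layer n κ) (#-mono tight? (λ D → ∣ D ∣ ≟ κ) proj₁)) ⟩
      e + (τ * layer n κ + layer n κ)                ≡⟨ cong (e +_) (+-comm (τ * layer n κ) (layer n κ)) ⟩
      e + suc τ * layer n κ                          ∎
      where open ≤-Reasoning

    largest : ∃[ A ] (∣ A ∣ ≡ suc τ × layer n κ ≤ # (inLink? F A) + (κ * (X + err) + κ * (κ * κ) * m))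
    largest = largest-class 1≤n (≤-trans (≤-trans (n≤1+n (suc τ)) σ≤s) s≤n) (X + err) (+-cancelʳ-≤ (τ * layer n κ) _ _ (begin
      layer n κ + τ * layer n κ                      ≤⟨ dense ⟩
      length F + X                                   ≤⟨ +-monoˡ-≤ X edges≤ ⟩
      err + (τ * layer n κ + # tight?) + X           ≡⟨ solve 4 (λ e l t x → e :+ (l :+ t) :+ x := t :+ (x :+ e) :+ l) refl err (τ * layer n κ) (# tight?) X ⟩
      # tight? + (X + err) + τ * layer n κ           ∎))
      where open ≤-Reasoning

    high≤ : # high? ≤ s * m
    high≤ = ≤-trans (high-bound s≤n) (*-monoʳ-≤ s (layer≤^ n (1 + ρ)))

    err₁≤ : err₁ ≤ 3 * (s * s) * m
    err₁≤ = begin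
      # (closed? edge? high?) + # lowPair?
        ≤⟨ +-mono-≤ (≤-trans (full-edges-bound s≤n) (*-monoʳ-≤ s high≤))
             (≤-trans lowPair-bound (*-monoʳ-≤ s (+-mono-≤ (*-monoʳ-≤ s (layer≤^ n (1 + ρ))) (*-monoʳ-≤ n (≤-trans (expandable-bound s≤n) (*-monoʳ-≤ s (layer≤^ n ρ))))))) ⟩
      s * (s * (n * n ^ ρ)) + s * (s * (n * n ^ ρ) + n * (s * n ^ ρ))
        ≡⟨ solve 3 (λ s n p → s :* (s :* (n :* p)) :+ s :* (s :* (n :* p) :+ n :* (s :* p)) := con 3 :* (s :* s) :* (n :* p)) refl s n (n ^ ρ) ⟩
      3 * (s * s) * m ∎
      where open ≤-Reasoning

    W≤ : ∣ W ∣ ≤ heavyBound s ρ q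
    W≤ = *-cancelˡ-≤ m {{>-nonZero (m^n>0 n {{>-nonZero 1≤n}} (1 + ρ))}} (begin
      m * ∣ W ∣                                ≤⟨ W-bound ⟩
      (b * κ) ^ (1 + ρ) * # high?              ≤⟨ *-monoʳ-≤ ((b * κ) ^ (1 + ρ)) high≤ ⟩
      (b * κ) ^ (1 + ρ) * (s * m)              ≡⟨ solve 3 (λ a s m → a :* (s :* m) := m :* (a :* s)) refl ((b * κ) ^ (1 + ρ)) s m ⟩
      m * heavyBound s ρ q                     ∎)
      where open ≤-Reasoning

    w = heavyBound s ρ q ^ (2 + τ)

    bad≤ : s * # bad? ≤ s * s * w * m
    bad≤ = begin
      s * # bad?
        ≤⟨ *-monoʳ-≤ s (≤-trans bad-bound (*-monoʳ-≤ n (≤-trans (conflict-bound (λ S size →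
             common-link-bound s≤n X₀ cut S (trans size (sym ∣X₀∣)) (≤-trans (+-monoˡ-≤ s (≤-trans (≤-reflexive size) σ≤s)) 2s≤n)))
             (*-mono-≤ (^-monoˡ-≤ (2 + τ) W≤) (*-monoʳ-≤ s (layer≤^ n ρ)))))) ⟩
      s * (n * (w * (s * n ^ ρ)))
        ≡⟨ solve 4 (λ s n w p → s :* (n :* (w :* (s :* p))) := s :* s :* w :* (n :* p)) refl s n w (n ^ ρ) ⟩
      s * s * w * m ∎
      where open ≤-Reasoning

    drop≤ : 2 * (κ * # dropping? * q) ≤ n * m
    drop≤ = *-cancelˡ-≤ (s * 2 ^ κ) {{>-nonZero (1≤* 1≤s (m^n>0 2 κ))}} (begin
      s * 2 ^ κ * (2 * (κ * # dropping? * q))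
        ≡⟨ solve 5 (λ s p k d q → s :* p :* (con 2 :* (k :* d :* q)) := con 2 :* k :* (s :* p) :* q :* d) refl s (2 ^ κ) κ (# dropping?) q ⟩
      b * # dropping?
        ≤⟨ dropping-bound ⟩
      n * (2 ^ κ * # high?)
        ≤⟨ *-monoʳ-≤ n (*-monoʳ-≤ (2 ^ κ) high≤) ⟩
      n * (2 ^ κ * (s * m))
        ≡⟨ solve 4 (λ n p s m → n :* (p :* (s :* m)) := s :* p :* (n :* m)) refl n (2 ^ κ) s m ⟩
      s * 2 ^ κ * (n * m) ∎)
      where open ≤-Reasoning

    e*q≤ : e * q ≤ n * m
    e*q≤ = *-cancelˡ-≤ 2 (begin
      2 * (e * q)
        ≡⟨ solve 6 (λ k a d c z q → con 2 :* ((k :* (a :+ (d :+ c)) :+ z) :* q) := con 2 :* q :* (k :* (a :+ c) :+ z) :+ con 2 :* (k :* d :* q))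
             refl κ err₁ (# dropping?) (s * # bad?) (κ * (κ * κ) * m) q ⟩
      2 * q * (κ * (err₁ + s * # bad?) + κ * (κ * κ) * m) + 2 * (κ * # dropping? * q)
        ≤⟨ +-mono-≤ (≤-trans (*-monoʳ-≤ (2 * q) (+-monoˡ-≤ (κ * (κ * κ) * m) (*-monoʳ-≤ κ (+-mono-≤ err₁≤ bad≤))))
             (≤-trans (≤-reflexive (solve 6 (λ q k a c z m → con 2 :* q :* (k :* (a :* m :+ c :* m) :+ z :* m) := con 2 :* q :* (k :* (a :+ c) :+ z) :* m)
                refl q κ (3 * (s * s)) (s * s * w) (κ * (κ * κ)) m)) (*-monoˡ-≤ m small))) drop≤ ⟩
      n * m + n * m
        ≡⟨ cong (n * m +_) (sym (+-identityʳ _)) ⟩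
      2 * (n * m) ∎)
      where open ≤-Reasoning

-- Choice of constants

integer-root : ∀ d → 1 ≤ d → ∀ n → 1 ≤ n → ∃[ p ] (p ^ d < n × n ≤ suc p ^ d)
integer-root (suc d) _ n 1≤n = search n (≤-trans (n≤1+n n) (≤-trans (≤-reflexive (sym (*-identityʳ (suc n)))) (*-monoʳ-≤ (suc n) (m^n>0 (suc n) d))))
  where
  search : ∀ N → n ≤ suc N ^ suc d → ∃[ p ] (p ^ suc d < n × n ≤ suc p ^ suc d)
  search zero    le = 0 , 1≤n , le
  search (suc N) le with n ≤? suc N ^ suc d
  ... | yes le′ = search N le′
  ... | no ¬le  = suc N , ≰⇒> ¬le , le

w₁ : ℕ → ℕ → ℕ
w₁ s ρ = (scale s (2 + ρ) * (2 + ρ)) ^ (1 + ρ) * s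

-- The coefficient of the power of q in `error-small`. The exponent s stands in for σ ≤ s, so that
-- the final threshold depends on r and s only.
c₃ : ℕ → ℕ → ℕ
c₃ s ρ = 2 * ((2 + ρ) * (4 * (s * s * w₁ s ρ ^ s)) + (2 + ρ) * ((2 + ρ) * (2 + ρ)))

c₄ : ℕ → ℕ → ℕ
c₄ s ρ = c₃ s ρ * 2 ^ suc ((1 + ρ) * s)

-- The power of `c₄` forces the integer root of n to be at least `c₄`; the term s + s leaves room
-- for a σ-set and s further vertices outside it.
threshold : ℕ → ℕ → ℕ
threshold s ρ = suc (c₄ s ρ ^ ((1 + ρ) * (s + 1) + 1)) + (s + s)

threshold⇒2s≤ : ∀ {s ρ n} → threshold s ρ ≤ n → s + s ≤ n
threshold⇒2s≤ {s} {ρ} = ≤-trans (m≤n+m (s + s) (suc (c₄ s ρ ^ ((1 + ρ) * (s + 1) + 1))))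

threshold⇒1≤ : ∀ {s ρ n} → threshold s ρ ≤ n → 1 ≤ n
threshold⇒1≤ {s} {ρ} = ≤-trans (s≤s {n = c₄ s ρ ^ ((1 + ρ) * (s + 1) + 1) + (s + s)} z≤n)

^-distribʳ-* : ∀ k a b → (a * b) ^ k ≡ a ^ k * b ^ k
^-distribʳ-* zero    a b = refl
^-distribʳ-* (suc k) a b = trans (cong (a * b *_) (^-distribʳ-* k a b))
  (solve 4 (λ a b x y → a :* b :* (x :* y) := a :* x :* (b :* y)) refl a b (a ^ k) (b ^ k))
  where open +-*-Solver

heavyBound≡ : ∀ s ρ q → heavyBound s ρ q ≡ w₁ s ρ * q ^ (1 + ρ)
heavyBound≡ s ρ q = trans (cong (_* s) (trans (cong (_^ (1 + ρ)) (solve 3 (λ a q k → a :* q :* k := a :* k :* q) refl (scale s (2 + ρ)) q (2 + ρ)))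
    (^-distribʳ-* (1 + ρ) (scale s (2 + ρ) * (2 + ρ)) q)))
  (solve 3 (λ a q s → a :* q :* s := a :* s :* q) refl ((scale s (2 + ρ) * (2 + ρ)) ^ (1 + ρ)) (q ^ (1 + ρ)) s)
  where open +-*-Solver

1≤w₁ : ∀ s ρ → 1 ≤ s → 1 ≤ w₁ s ρ
1≤w₁ s ρ 1≤s = 1≤* (m^n>0 (scale s (2 + ρ) * (2 + ρ)) {{>-nonZero (1≤* (1≤* {2 * (2 + ρ)} (s≤s z≤n) (1≤* 1≤s (m^n>0 2 (2 + ρ)))) (s≤s {n = 1 + ρ} z≤n))}} (1 + ρ)) 1≤s

error-small : ∀ s ρ σ q → 1 ≤ s → σ ≤ s → 1 ≤ q →
  2 * q * ((2 + ρ) * (3 * (s * s) + s * s * heavyBound s ρ q ^ σ) + (2 + ρ) * ((2 + ρ) * (2 + ρ))) ≤ c₃ s ρ * q ^ suc ((1 + ρ) * σ)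
error-small s ρ σ q 1≤s σ≤s 1≤q = begin
  2 * q * (κ * (3 * (s * s) + s * s * heavyBound s ρ q ^ σ) + κ * (κ * κ))
    ≤⟨ *-monoʳ-≤ (2 * q) (+-mono-≤ (*-monoʳ-≤ κ (+-mono-≤ (≤-trans (m≤n*m′ (1≤* 1≤wˢ 1≤u)) (≤-reflexive (*-comm (wˢ * u) (3 * (s * s))))) (*-monoʳ-≤ (s * s) power≤)))
         (≤-trans (m≤n*m′ 1≤u) (≤-reflexive (*-comm u (κ * (κ * κ)))))) ⟩
  2 * q * (κ * (3 * (s * s) * (wˢ * u) + s * s * (wˢ * u)) + κ * (κ * κ) * u)
    ≡⟨ solve 5 (λ q k s w u → con 2 :* q :* (k :* (con 3 :* (s :* s) :* (w :* u) :+ s :* s :* (w :* u)) :+ k :* (k :* k) :* u)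
         := con 2 :* (k :* (con 4 :* (s :* s :* w)) :+ k :* (k :* k)) :* (q :* u)) refl q κ s wˢ u ⟩
  c₃ s ρ * (q * u) ∎
  where
  open ≤-Reasoning
  open +-*-Solver
  κ = 2 + ρ
  u = q ^ ((1 + ρ) * σ)
  wˢ = w₁ s ρ ^ s
  1≤u : 1 ≤ u
  1≤u = m^n>0 q {{>-nonZero 1≤q}} ((1 + ρ) * σ)
  1≤wˢ : 1 ≤ wˢ
  1≤wˢ = m^n>0 (w₁ s ρ) {{>-nonZero (1≤w₁ s ρ 1≤s)}} s
  power≤ : heavyBound s ρ q ^ σ ≤ wˢ * u
  power≤ = ≤-trans (≤-reflexive (trans (cong (_^ σ) (heavyBound≡ s ρ q)) (trans (^-distribʳ-* σ (w₁ s ρ) (q ^ (1 + ρ))) (cong (w₁ s ρ ^ σ *_) (^-*-assoc q (1 + ρ) σ)))))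
             (*-monoˡ-≤ u (^-monoʳ-≤ (w₁ s ρ) {{>-nonZero (1≤w₁ s ρ 1≤s)}} σ≤s))

-- With p the integer root below n, take q = p + 1 ≤ 2p. The left side has degree 1 + (1 + ρ)σ in q,
-- at least one less than the exponent of the root, and the spare factor p outweighs `c₄`, which
-- includes the powers of 2.
scale-parameter : ∀ s ρ σ n → 1 ≤ s → σ ≤ s → threshold s ρ ≤ n → ∃[ q ] (1 ≤ q × n ≤ q ^ ((1 + ρ) * (σ + 1) + 1) ×
  2 * q * ((2 + ρ) * (3 * (s * s) + s * s * heavyBound s ρ q ^ σ) + (2 + ρ) * ((2 + ρ) * (2 + ρ))) ≤ n)
scale-parameter s ρ σ n 1≤s σ≤s large
  with integer-root ((1 + ρ) * (σ + 1) + 1) (m≤n+m 1 _) n (≤-trans (s≤s z≤n) large)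
... | p , p^d<n , n≤ = suc p , s≤s z≤n , n≤ , ≤-trans (error-small s ρ σ (suc p) 1≤s σ≤s (s≤s z≤n)) (begin
  c₃ s ρ * suc p ^ suc M
    ≤⟨ *-monoʳ-≤ (c₃ s ρ) (^-monoˡ-≤ (suc M) (≤-trans (+-monoˡ-≤ p 1≤p) (≤-reflexive (cong (p +_) (sym (+-identityʳ p)))))) ⟩
  c₃ s ρ * (2 * p) ^ suc M
    ≡⟨ trans (cong (c₃ s ρ *_) (^-distribʳ-* (suc M) 2 p)) (sym (*-assoc (c₃ s ρ) (2 ^ suc M) (p ^ suc M))) ⟩
  c₃ s ρ * 2 ^ suc M * p ^ suc M
    ≤⟨ *-monoˡ-≤ (p ^ suc M) (≤-trans (*-monoʳ-≤ (c₃ s ρ) (^-monoʳ-≤ 2 (s≤s (*-monoʳ-≤ (1 + ρ) σ≤s)))) c₄≤p) ⟩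
  p ^ suc (suc M)
    ≤⟨ ^-monoʳ-≤ p {{>-nonZero 1≤p}} (≤-trans (m≤m+n (2 + M) ρ) (≤-reflexive
         (solve 2 (λ r s → con 2 :+ (con 1 :+ r) :* s :+ r := (con 1 :+ r) :* (s :+ con 1) :+ con 1) refl ρ σ))) ⟩
  p ^ ((1 + ρ) * (σ + 1) + 1)
    ≤⟨ <⇒≤ p^d<n ⟩
  n ∎)
  where
  open ≤-Reasoning
  open +-*-Solver
  M = (1 + ρ) * σ
  c₄≤p : c₄ s ρ ≤ p
  c₄≤p = ≮⇒≥ λ p<c₄ → <-irrefl refl (begin-strict
    n                                       ≤⟨ n≤ ⟩
    suc p ^ ((1 + ρ) * (σ + 1) + 1)         ≤⟨ ^-monoˡ-≤ ((1 + ρ) * (σ + 1) + 1) p<c₄ ⟩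
    c₄ s ρ ^ ((1 + ρ) * (σ + 1) + 1)        ≤⟨ ^-monoʳ-≤ (c₄ s ρ) {{>-nonZero (≤-trans (s≤s z≤n) p<c₄)}} (+-monoˡ-≤ 1 (*-monoʳ-≤ (1 + ρ) (+-monoˡ-≤ 1 σ≤s))) ⟩
    c₄ s ρ ^ ((1 + ρ) * (s + 1) + 1)        <⟨ ≤-trans (m≤m+n _ (s + s)) large ⟩
    n                                       ∎)
  1≤p : 1 ≤ p
  1≤p = ≤-trans (1≤* (1≤* {2} (s≤s z≤n) (≤-trans (1≤* {2 + ρ} (s≤s z≤n) (1≤* {2 + ρ} (s≤s z≤n) (s≤s {n = 1 + ρ} z≤n))) (m≤n+m _ ((2 + ρ) * (4 * (s * s * w₁ s ρ ^ s))))))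
                     (m^n>0 2 (suc ((1 + ρ) * s)))) c₄≤p

-- Inequalities up to rational powers

ℕtoℚ-≃ : ∀ a → ℚ.toℚᵘ (ℕtoℚ a) ℚᵘ.≃ ℚᵘ.mkℚᵘ (ℤ.+ a) 0
ℕtoℚ-≃ a = ℚₚ.toℚᵘ-fromℚᵘ (ℚᵘ.mkℚᵘ (ℤ.+ a) 0)

ℕtoℚ-+ : ∀ a b → ℕtoℚ (a + b) ≡ ℕtoℚ a +ᵠ ℕtoℚ b
ℕtoℚ-+ a b = ℚₚ.toℚᵘ-injective (ℚᵘₚ.≃-trans (ℕtoℚ-≃ (a + b)) (ℚᵘₚ.≃-trans
  (ℚᵘ.*≡* (cong (ℤ._* ℤ.+ 1) (trans (ℤₚ.pos-+ a b) (cong₂ ℤ._+_ (sym (ℤₚ.*-identityʳ (ℤ.+ a))) (sym (ℤₚ.*-identityʳ (ℤ.+ b)))))))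
  (ℚᵘₚ.≃-sym (ℚᵘₚ.≃-trans (ℚₚ.toℚᵘ-homo-+ (ℕtoℚ a) (ℕtoℚ b)) (ℚᵘₚ.+-cong (ℕtoℚ-≃ a) (ℕtoℚ-≃ b))))))

ℕtoℚ-* : ∀ a b → ℕtoℚ (a * b) ≡ ℕtoℚ a *ᵠ ℕtoℚ b
ℕtoℚ-* a b = ℚₚ.toℚᵘ-injective (ℚᵘₚ.≃-trans (ℕtoℚ-≃ (a * b)) (ℚᵘₚ.≃-trans
  (ℚᵘ.*≡* (cong (ℤ._* ℤ.+ 1) (ℤₚ.pos-* a b)))
  (ℚᵘₚ.≃-sym (ℚᵘₚ.≃-trans (ℚₚ.toℚᵘ-homo-* (ℕtoℚ a) (ℕtoℚ b)) (ℚᵘₚ.*-cong (ℕtoℚ-≃ a) (ℕtoℚ-≃ b))))))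

ℕtoℚ-mono : ∀ {a b} → a ≤ b → ℕtoℚ a ≤ᵠ ℕtoℚ b
ℕtoℚ-mono {a} {b} a≤b = ℚₚ.toℚᵘ-cancel-≤ (ℚᵘₚ.≤-respˡ-≃ (ℚᵘₚ.≃-sym (ℕtoℚ-≃ a)) (ℚᵘₚ.≤-respʳ-≃ (ℚᵘₚ.≃-sym (ℕtoℚ-≃ b))
  (ℚᵘ.*≤* (ℤₚ.*-monoʳ-≤-nonNeg (ℤ.+ 1) (ℤ.+≤+ a≤b)))))

0≤ℕtoℚ : ∀ a → 0ℚ ≤ᵠ ℕtoℚ a
0≤ℕtoℚ a = ℕtoℚ-mono {0} {a} z≤n

*ᵠ-monoˡ : ∀ {a b c} → 0ℚ ≤ᵠ a → b ≤ᵠ c → a *ᵠ b ≤ᵠ a *ᵠ c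
*ᵠ-monoˡ {a} 0≤a = ℚₚ.*-monoˡ-≤-nonNeg a {{ℚ.nonNegative 0≤a}}

*ᵠ-monoʳ : ∀ {a b c} → 0ℚ ≤ᵠ a → b ≤ᵠ c → b *ᵠ a ≤ᵠ c *ᵠ a
*ᵠ-monoʳ {a} 0≤a = ℚₚ.*-monoʳ-≤-nonNeg a {{ℚ.nonNegative 0≤a}}

0≤* : ∀ {a b} → 0ℚ ≤ᵠ a → 0ℚ ≤ᵠ b → 0ℚ ≤ᵠ a *ᵠ b
0≤* {a} 0≤a 0≤b = ℚₚ.≤-trans (ℚₚ.≤-reflexive (sym (ℚₚ.*-zeroʳ a))) (*ᵠ-monoˡ 0≤a 0≤b)

0≤+ : ∀ {a b} → 0ℚ ≤ᵠ a → 0ℚ ≤ᵠ b → 0ℚ ≤ᵠ a +ᵠ b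
0≤+ 0≤a 0≤b = ℚₚ.≤-trans (ℚₚ.≤-reflexive (sym (ℚₚ.+-identityˡ 0ℚ))) (ℚₚ.+-mono-≤ 0≤a 0≤b)

0≤^ : ∀ {x} m → 0ℚ ≤ᵠ x → 0ℚ ≤ᵠ x ^ᵠ m
0≤^ zero    0≤x = ℕtoℚ-mono {0} {1} z≤n
0≤^ (suc m) 0≤x = 0≤* 0≤x (0≤^ m 0≤x)

0<^ : ∀ {x} m → 0ℚ <ᵠ x → 0ℚ <ᵠ x ^ᵠ m
0<^ zero    0<x = ℚₚ.positive⁻¹ 1ℚ
0<^ {x} (suc m) 0<x = ℚₚ.positive⁻¹ _ {{ℚₚ.pos*pos⇒pos x {{ℚ.positive 0<x}} (x ^ᵠ m) {{ℚ.positive (0<^ m 0<x)}}}}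

^ᵠ-mono : ∀ {x y} m → 0ℚ ≤ᵠ x → x ≤ᵠ y → x ^ᵠ m ≤ᵠ y ^ᵠ m
^ᵠ-mono zero    0≤x x≤y = ℚₚ.≤-refl
^ᵠ-mono (suc m) 0≤x x≤y = ℚₚ.≤-trans (*ᵠ-monoˡ 0≤x (^ᵠ-mono m 0≤x x≤y)) (*ᵠ-monoʳ (0≤^ m (ℚₚ.≤-trans 0≤x x≤y)) x≤y)

^ᵠ-* : ∀ m x y → (x *ᵠ y) ^ᵠ m ≡ x ^ᵠ m *ᵠ y ^ᵠ m
^ᵠ-* zero    x y = refl
^ᵠ-* (suc m) x y = trans (cong (x *ᵠ y *ᵠ_) (^ᵠ-* m x y))
  (solve 4 (λ a b c d → a :* b :* (c :* d) := a :* c :* (b :* d)) refl x y (x ^ᵠ m) (y ^ᵠ m))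
  where open ℚ-Solver

ℕtoℚ-^ : ∀ m a → ℕtoℚ a ^ᵠ m ≡ ℕtoℚ (a ^ m)
ℕtoℚ-^ zero    a = refl
ℕtoℚ-^ (suc m) a = trans (cong (ℕtoℚ a *ᵠ_) (ℕtoℚ-^ m a)) (sym (ℕtoℚ-* a (a ^ m)))

1^ᵠ : ∀ m → 1ℚ ^ᵠ m ≡ 1ℚ
1^ᵠ zero    = refl
1^ᵠ (suc m) = trans (ℚₚ.*-identityˡ _) (1^ᵠ m)

p≤q+r⇒p-q≤r : ∀ {p q r} → p ≤ᵠ q +ᵠ r → p -ᵠ q ≤ᵠ r
p≤q+r⇒p-q≤r {p} {q} {r} le = ℚₚ.≤-trans (ℚₚ.+-monoˡ-≤ (ℚ.- q) le)
  (ℚₚ.≤-reflexive (solve 2 (λ q r → q :+ r :- q := r) refl q r))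
  where open ℚ-Solver

module Powers (n a m : ℕ) (1≤m : 1 ≤ m) where

  record _≾_ (x c : ℚ) : Set where
    constructor power
    field
      unpower : LeRootPow x c n a m

  open _≾_ public

  N = ℕtoℚ (n ^ a)

  0≤N : 0ℚ ≤ᵠ N
  0≤N = 0≤ℕtoℚ (n ^ a)

  -- The sign of y has to be decided first, since taking m-th powers is monotone only for
  -- nonnegative numbers.
  ≾-monoˡ : ∀ {x y c} → y ≤ᵠ x → x ≾ c → y ≾ c
  ≾-monoˡ y≤x (power (inj₁ x≤0)) = power (inj₁ (ℚₚ.≤-trans y≤x x≤0))
  ≾-monoˡ {x} {y} y≤x (power (inj₂ h)) with y ℚₚ.≤? 0ℚ
  ... | yes y≤0 = power (inj₁ y≤0)
  ... | no y≰0  = power (inj₂ (ℚₚ.≤-trans (^ᵠ-mono m (ℚₚ.<⇒≤ (ℚₚ.≰⇒> y≰0)) y≤x) h))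

  ≾-monoʳ : ∀ {x c d} → 0ℚ ≤ᵠ c → c ≤ᵠ d → x ≾ c → x ≾ d
  ≾-monoʳ 0≤c c≤d (power (inj₁ x≤0)) = power (inj₁ x≤0)
  ≾-monoʳ 0≤c c≤d (power (inj₂ h))   = power (inj₂ (ℚₚ.≤-trans h (*ᵠ-monoʳ 0≤N (^ᵠ-mono m 0≤c c≤d))))

  ≾-scale : ∀ {x c k} → 0ℚ ≤ᵠ k → x ≾ c → (k *ᵠ x) ≾ (k *ᵠ c)
  ≾-scale {k = k} 0≤k (power (inj₁ x≤0)) = power (inj₁ (ℚₚ.≤-trans (*ᵠ-monoˡ 0≤k x≤0) (ℚₚ.≤-reflexive (ℚₚ.*-zeroʳ k))))
  ≾-scale {x} {c} {k} 0≤k (power (inj₂ h)) = power (inj₂ (begin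
    (k *ᵠ x) ^ᵠ m                    ≡⟨ ^ᵠ-* m k x ⟩
    k ^ᵠ m *ᵠ x ^ᵠ m                 ≤⟨ *ᵠ-monoˡ (0≤^ m 0≤k) h ⟩
    k ^ᵠ m *ᵠ (c ^ᵠ m *ᵠ N)          ≡⟨ sym (ℚₚ.*-assoc (k ^ᵠ m) (c ^ᵠ m) N) ⟩
    k ^ᵠ m *ᵠ c ^ᵠ m *ᵠ N            ≡⟨ cong (_*ᵠ N) (sym (^ᵠ-* m k c)) ⟩
    (k *ᵠ c) ^ᵠ m *ᵠ N               ∎))
    where open ℚₚ.≤-Reasoning

  ≾-zero : ∀ {y} → y ≾ 0ℚ → y ≤ᵠ 0ℚ
  ≾-zero (power (inj₁ y≤0)) = y≤0
  ≾-zero {y} (power (inj₂ h)) = ℚₚ.≮⇒≥ λ 0<y → ℚₚ.<-irrefl refl (ℚₚ.<-≤-trans (0<^ m 0<y) (ℚₚ.≤-trans h (ℚₚ.≤-reflexive (zero-power m 1≤m))))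
    where
    zero-power : ∀ m → 1 ≤ m → 0ℚ ^ᵠ m *ᵠ N ≡ 0ℚ
    zero-power (suc m) _ = trans (cong (_*ᵠ N) (ℚₚ.*-zeroˡ (0ℚ ^ᵠ m))) (ℚₚ.*-zeroˡ N)

  -- No root of N is needed: compare x / c with y / d, and bound (x + y) / (c + d) by the larger quotient.
  ≾-+-by : ∀ {x y c d} → 0ℚ ≤ᵠ x → 0ℚ ≤ᵠ y → 0ℚ ≤ᵠ c → 0ℚ ≤ᵠ d → ¬ (y ≤ᵠ 0ℚ) → x *ᵠ d ≤ᵠ y *ᵠ c → y ≾ d → (x +ᵠ y) ≾ (c +ᵠ d)
  ≾-+-by 0≤x 0≤y 0≤c 0≤d y≰0 _ (power (inj₁ y≤0)) = contradiction y≤0 y≰0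
  ≾-+-by {x} {y} {c} {d} 0≤x 0≤y 0≤c 0≤d y≰0 cross (power (inj₂ h)) with d ℚₚ.≤? 0ℚ
  ... | yes d≤0 = contradiction (≾-zero (≾-monoʳ 0≤d d≤0 (power (inj₂ h)))) y≰0
  ... | no d≰0 = power (inj₂ (ℚₚ.*-cancelʳ-≤-pos (d ^ᵠ m) {{ℚ.positive (0<^ m (ℚₚ.≰⇒> d≰0))}} (begin
    (x +ᵠ y) ^ᵠ m *ᵠ d ^ᵠ m          ≡⟨ sym (^ᵠ-* m (x +ᵠ y) d) ⟩
    ((x +ᵠ y) *ᵠ d) ^ᵠ m             ≤⟨ ^ᵠ-mono m (0≤* (0≤+ 0≤x 0≤y) 0≤d) (begin
        (x +ᵠ y) *ᵠ d                   ≡⟨ ℚₚ.*-distribʳ-+ d x y ⟩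
        x *ᵠ d +ᵠ y *ᵠ d                ≤⟨ ℚₚ.+-monoˡ-≤ (y *ᵠ d) cross ⟩
        y *ᵠ c +ᵠ y *ᵠ d                ≡⟨ sym (ℚₚ.*-distribˡ-+ y c d) ⟩
        y *ᵠ (c +ᵠ d)                   ∎) ⟩
    (y *ᵠ (c +ᵠ d)) ^ᵠ m             ≡⟨ ^ᵠ-* m y (c +ᵠ d) ⟩
    y ^ᵠ m *ᵠ (c +ᵠ d) ^ᵠ m          ≤⟨ *ᵠ-monoʳ (0≤^ m (0≤+ 0≤c 0≤d)) h ⟩
    d ^ᵠ m *ᵠ N *ᵠ (c +ᵠ d) ^ᵠ m     ≡⟨ solve 3 (λ d n e → d :* n :* e := e :* n :* d) refl (d ^ᵠ m) N ((c +ᵠ d) ^ᵠ m) ⟩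
    (c +ᵠ d) ^ᵠ m *ᵠ N *ᵠ d ^ᵠ m     ∎)))
    where
    open ℚₚ.≤-Reasoning
    open ℚ-Solver

  ≾-+ : ∀ {x y c d} → 0ℚ ≤ᵠ c → 0ℚ ≤ᵠ d → x ≾ c → y ≾ d → (x +ᵠ y) ≾ (c +ᵠ d)
  ≾-+ {x} {y} {c} {d} 0≤c 0≤d hx hy with x ℚₚ.≤? 0ℚ | y ℚₚ.≤? 0ℚ
  ... | yes x≤0 | _ = ≾-monoˡ (ℚₚ.≤-trans (ℚₚ.+-monoˡ-≤ y x≤0) (ℚₚ.≤-reflexive (ℚₚ.+-identityˡ y)))
                        (≾-monoʳ 0≤d (ℚₚ.≤-trans (ℚₚ.≤-reflexive (sym (ℚₚ.+-identityˡ d))) (ℚₚ.+-monoˡ-≤ d 0≤c)) hy)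
  ... | no _ | yes y≤0 = ≾-monoˡ (ℚₚ.≤-trans (ℚₚ.+-monoʳ-≤ x y≤0) (ℚₚ.≤-reflexive (ℚₚ.+-identityʳ x)))
                        (≾-monoʳ 0≤c (ℚₚ.≤-trans (ℚₚ.≤-reflexive (sym (ℚₚ.+-identityʳ c))) (ℚₚ.+-monoʳ-≤ c 0≤d)) hx)
  ... | no x≰0 | no y≰0 with ℚₚ.≤-total (x *ᵠ d) (y *ᵠ c)
  ...   | inj₁ le = ≾-+-by (ℚₚ.<⇒≤ (ℚₚ.≰⇒> x≰0)) (ℚₚ.<⇒≤ (ℚₚ.≰⇒> y≰0)) 0≤c 0≤d y≰0 le hy
  ...   | inj₂ le = subst₂ _≾_ (ℚₚ.+-comm y x) (ℚₚ.+-comm d c)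
                      (≾-+-by (ℚₚ.<⇒≤ (ℚₚ.≰⇒> y≰0)) (ℚₚ.<⇒≤ (ℚₚ.≰⇒> x≰0)) 0≤d 0≤c x≰0 le hx)

  ≾-nat : ∀ {e} → e ^ m ≤ n ^ a → ℕtoℚ e ≾ 1ℚ
  ≾-nat {e} le = power (inj₂ (ℚₚ.≤-trans (ℚₚ.≤-reflexive (ℕtoℚ-^ m e)) (ℚₚ.≤-trans (ℕtoℚ-mono le)
    (ℚₚ.≤-reflexive (sym (trans (cong (_*ᵠ N) (1^ᵠ m)) (ℚₚ.*-identityˡ N)))))))

  ≾-nat-combination : ∀ {X e K C} j l → 0ℚ ≤ᵠ K → ℕtoℚ X ≾ K → e ^ m ≤ n ^ a → ℕtoℚ j *ᵠ K +ᵠ ℕtoℚ l ≤ᵠ C → ℕtoℚ (j * X + l * e) ≾ C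
  ≾-nat-combination {X} {e} {K} {C} j l 0≤K hX he le = subst (_≾ C)
    (sym (trans (ℕtoℚ-+ (j * X) (l * e)) (cong₂ _+ᵠ_ (ℕtoℚ-* j X) (ℕtoℚ-* l e))))
    (≾-monoʳ (0≤+ (0≤* (0≤ℕtoℚ j) 0≤K) (0≤ℕtoℚ l)) le
      (subst (λ z → (ℕtoℚ j *ᵠ ℕtoℚ X +ᵠ ℕtoℚ l *ᵠ ℕtoℚ e) ≾ (ℕtoℚ j *ᵠ K +ᵠ z)) (ℚₚ.*-identityʳ (ℕtoℚ l))
        (≾-+ (0≤* (0≤ℕtoℚ j) 0≤K) (0≤* (0≤ℕtoℚ l) (ℕtoℚ-mono {0} {1} z≤n)) (≾-scale (0≤ℕtoℚ j) hX) (≾-scale (0≤ℕtoℚ l) (≾-nat he)))))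

  -- Carries the density hypothesis over to the natural number `X` of the counting argument.
  -- Truncation only raises negative differences to 0, which every constant admits.
  ≾-∸ : ∀ {u v K} → (ℕtoℚ u -ᵠ ℕtoℚ v) ≾ K → ℕtoℚ (u ∸ v) ≾ K
  ≾-∸ {u} {v} h with ≤-total u v
  ... | inj₁ u≤v = power (inj₁ (ℕtoℚ-mono (≤-reflexive (m≤n⇒m∸n≡0 u≤v))))
  ... | inj₂ v≤u = ≾-monoˡ (ℚₚ.≤-reflexive (trans (solve 2 (λ p q → p := q :+ p :- q) refl (ℕtoℚ (u ∸ v)) (ℕtoℚ v))
                     (cong (_-ᵠ ℕtoℚ v) (trans (sym (ℕtoℚ-+ v (u ∸ v))) (cong ℕtoℚ (m+[n∸m]≡n v≤u)))))) h
    where open ℚ-Solver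

  -- The shortage `X` contributes κ K, and the error `e`, of constant 1, fits into κ S.
  link-bound : ∀ {L ℓ X e K} κ S → 0ℚ ≤ᵠ K → ℕtoℚ X ≾ K → e ^ m ≤ n ^ a → 1 ≤ κ → 1 ≤ S →
               L ≤ ℓ + (κ * X + e) → (ℕtoℚ L -ᵠ ℕtoℚ ℓ) ≾ (ℕtoℚ κ *ᵠ (K +ᵠ ℕtoℚ S))
  link-bound {L} {ℓ} {X} {e} {K} κ S 0≤K hX he 1≤κ 1≤S le = ≾-monoˡ
    (p≤q+r⇒p-q≤r (ℚₚ.≤-trans (ℕtoℚ-mono (≤-trans le (≤-reflexive (cong (λ z → ℓ + (κ * X + z)) (sym (+-identityʳ e))))))
                             (ℚₚ.≤-reflexive (ℕtoℚ-+ ℓ (κ * X + 1 * e)))))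
    (≾-nat-combination κ 1 0≤K hX he (ℚₚ.≤-trans (ℚₚ.+-monoʳ-≤ (ℕtoℚ κ *ᵠ K) (ℚₚ.≤-trans (ℕtoℚ-mono (1≤* 1≤κ 1≤S)) (ℚₚ.≤-reflexive (ℕtoℚ-* κ S))))
      (ℚₚ.≤-reflexive (sym (ℚₚ.*-distribˡ-+ (ℕtoℚ κ) K (ℕtoℚ S))))))

  bad-bound : ∀ {b f L ℓ X e K} κ τ S → 0ℚ ≤ᵠ K → ℕtoℚ X ≾ K → e ^ m ≤ n ^ a → 2 + τ ≤ S →
              L ≤ ℓ + (κ * X + e) → f ≤ e + suc τ * L → b + suc τ * ℓ ≤ f →
              ℕtoℚ b ≾ (ℕtoℚ (suc τ * κ) *ᵠ (K +ᵠ ℕtoℚ S) +ᵠ ℕtoℚ S)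
  bad-bound {b} {f} {L} {ℓ} {X} {e} {K} κ τ S 0≤K hX he 2+τ≤S le f≤ b≤ = ≾-monoˡ (ℕtoℚ-mono few)
    (≾-nat-combination (suc τ * κ) (2 + τ) 0≤K hX he
      (ℚₚ.+-mono-≤ (*ᵠ-monoˡ (0≤ℕtoℚ (suc τ * κ)) (ℚₚ.≤-trans (ℚₚ.≤-reflexive (sym (ℚₚ.+-identityʳ K))) (ℚₚ.+-monoʳ-≤ K (0≤ℕtoℚ S))))
        (ℕtoℚ-mono 2+τ≤S)))
    where
    -- The error occurs once in the upper bound for f and suc τ times through the link, which
    -- explains 2 + τ.
    few : b ≤ suc τ * κ * X + (2 + τ) * e
    few = +-cancelʳ-≤ (suc τ * ℓ) _ _ (begin
      b + suc τ * ℓ                      ≤⟨ b≤ ⟩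
      f                                  ≤⟨ f≤ ⟩
      e + suc τ * L                      ≤⟨ +-monoʳ-≤ e (*-monoʳ-≤ (suc τ) le) ⟩
      e + suc τ * (ℓ + (κ * X + e))
        ≡⟨ solve 5 (λ e t l k x → e :+ (con 1 :+ t) :* (l :+ (k :* x :+ e)) := (con 1 :+ t) :* k :* x :+ (con 2 :+ t) :* e :+ (con 1 :+ t) :* l)
             refl e τ ℓ κ X ⟩
      suc τ * κ * X + (2 + τ) * e + suc τ * ℓ ∎)
      where
      open ≤-Reasoning
      open +-*-Solver

-- Raising e * q ≤ n^κ to the power d and using n ≤ q^d, one factor n cancels: this is the gain β =
-- 1/d in the exponent.
root-bound : ∀ {n e q κ d} → 1 ≤ n → 1 ≤ κ * d → e * q ≤ n ^ κ → n ≤ q ^ d → e ^ d ≤ n ^ (κ * d ∸ 1)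
root-bound {n} {e} {q} {κ} {d} 1≤n 1≤κd le root = *-cancelˡ-≤ n {{>-nonZero 1≤n}} (begin
  n * e ^ d                  ≤⟨ *-monoˡ-≤ (e ^ d) root ⟩
  q ^ d * e ^ d              ≡⟨ trans (*-comm (q ^ d) (e ^ d)) (sym (^-distribʳ-* d e q)) ⟩
  (e * q) ^ d                ≤⟨ ^-monoˡ-≤ d le ⟩
  (n ^ κ) ^ d                ≡⟨ ^-*-assoc n κ d ⟩
  n ^ (κ * d)                ≡⟨ cong (n ^_) (sym (m+[n∸m]≡n 1≤κd)) ⟩
  n * n ^ (κ * d ∸ 1)        ∎)
  where open ≤-Reasoning

-- Assembling the stability statement

stability : ∀ {s n ρ τ t} (H : List (Subset s)) → IsRGraph (3 + ρ) H →
  (T : List (Subset t)) → IsRTree (3 + ρ) T → TwoReducible T → Embeds H T →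
  (X₀ : Subset s) → IsCrossCut H X₀ → ∣ X₀ ∣ ≡ 2 + τ → threshold s ρ ≤ n → (K : ℚ) → 0ℚ ≤ᵠ K →
  (F : List (Subset n)) → IsRGraph (3 + ρ) F → ¬ Embeds H F →
  LeRootPow (ℕtoℚ (suc τ * (n C (2 + ρ))) -ᵠ ℕtoℚ (length F)) K n (expNum (3 + ρ) (2 + τ)) (βden (3 + ρ) (2 + τ)) →
  ∃[ A ] (∣ A ∣ ≡ suc τ
    × LeRootPow (ℕtoℚ (n C (2 + ρ)) -ᵠ ℕtoℚ (linkSize F A)) (ℕtoℚ (2 + ρ) *ᵠ (K +ᵠ ℕtoℚ (2 * (s * s)))) n (expNum (3 + ρ) (2 + τ)) (βden (3 + ρ) (2 + τ))
    × LeRootPow (ℕtoℚ (badCount F A)) ((ℕtoℚ (suc τ * (2 + ρ)) *ᵠ (K +ᵠ ℕtoℚ (2 * (s * s)))) +ᵠ ℕtoℚ (2 * (s * s))) n (expNum (3 + ρ) (2 + τ)) (βden (3 + ρ) (2 + τ)))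
stability {s} {n} {ρ} {τ} H H-graph T tree reducible H⊆T X₀ cut ∣X₀∣ large K 0≤K F F-graph free dense =
  from-parameter (scale-parameter s ρ (2 + τ) n (≤-trans (s≤s z≤n) σ≤s) σ≤s large)
  where
  σ≤s : 2 + τ ≤ s
  σ≤s = ≤-trans (≤-reflexive (sym ∣X₀∣)) (∣p∣≤n X₀)
  from-stable : ∀ {q} → n ≤ q ^ βden (3 + ρ) (2 + τ) → Stable n s ρ τ q F (suc τ * (n C (2 + ρ)) ∸ length F) →
    ∃[ A ] (∣ A ∣ ≡ suc τ
      × LeRootPow (ℕtoℚ (n C (2 + ρ)) -ᵠ ℕtoℚ (linkSize F A)) (ℕtoℚ (2 + ρ) *ᵠ (K +ᵠ ℕtoℚ (2 * (s * s)))) n (expNum (3 + ρ) (2 + τ)) (βden (3 + ρ) (2 + τ))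
      × LeRootPow (ℕtoℚ (badCount F A)) ((ℕtoℚ (suc τ * (2 + ρ)) *ᵠ (K +ᵠ ℕtoℚ (2 * (s * s)))) +ᵠ ℕtoℚ (2 * (s * s))) n (expNum (3 + ρ) (2 + τ)) (βden (3 + ρ) (2 + τ)))
  from-stable {q} root st = A , size ,
    unpower (link-bound {n C (2 + ρ)} {linkSize F A} {suc τ * (n C (2 + ρ)) ∸ length F} {e} (2 + ρ) (2 * (s * s)) 0≤K X≾K e≤ (s≤s z≤n) (≤-trans (s≤s z≤n) σ≤2s²) link≤) ,
    unpower (bad-bound {badCount F A} {length F} {n C (2 + ρ)} {linkSize F A} {suc τ * (n C (2 + ρ)) ∸ length F} {e} (2 + ρ) τ (2 * (s * s)) 0≤K X≾K e≤ σ≤2s² link≤ few-edges′ bad+link≤)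
    where
    open Stable st
    d = βden (3 + ρ) (2 + τ)
    1≤d : 1 ≤ d
    1≤d = m≤n+m 1 ((1 + ρ) * (2 + τ + 1))
    open Powers n (expNum (3 + ρ) (2 + τ)) d 1≤d
    X≾K : ℕtoℚ (suc τ * (n C (2 + ρ)) ∸ length F) ≾ K
    X≾K = ≾-∸ {suc τ * (n C (2 + ρ))} {length F} (power dense)
    e≤ : e ^ d ≤ n ^ expNum (3 + ρ) (2 + τ)
    e≤ = root-bound {n} {e} {q} {2 + ρ} {d} (threshold⇒1≤ {s} {ρ} large) (1≤* {2 + ρ} (s≤s z≤n) 1≤d) e*q≤ root
    σ≤2s² : 2 + τ ≤ 2 * (s * s)
    σ≤2s² = ≤-trans σ≤s (≤-trans (m≤n*m′ (≤-trans (s≤s z≤n) σ≤s)) (m≤m+n (s * s) _))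
    link≡ : # (inLink? F A) ≡ linkSize F A
    link≡ = sym (length-filter (inLink? F A) (allSubsets n))
    link≤ : n C (2 + ρ) ≤ linkSize F A + ((2 + ρ) * (suc τ * (n C (2 + ρ)) ∸ length F) + e)
    link≤ = subst₂ (λ L ℓ → L ≤ ℓ + ((2 + ρ) * (suc τ * (n C (2 + ρ)) ∸ length F) + e)) (layer≡C n (2 + ρ)) link≡ link-large
    few-edges′ : length F ≤ e + suc τ * (n C (2 + ρ))
    few-edges′ = subst (λ L → length F ≤ e + suc τ * L) (layer≡C n (2 + ρ)) few-edges
    bad+link≤ : badCount F A + suc τ * linkSize F A ≤ length F
    bad+link≤ = subst₂ (λ a ℓ → badCount F A + a * ℓ ≤ length F) size link≡ (badCount+link F (proj₁ F-graph) A)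
  from-parameter : ∃[ q ] (1 ≤ q × n ≤ q ^ βden (3 + ρ) (2 + τ) ×
      2 * q * ((2 + ρ) * (3 * (s * s) + s * s * heavyBound s ρ q ^ (2 + τ)) + (2 + ρ) * ((2 + ρ) * (2 + ρ))) ≤ n) →
    ∃[ A ] (∣ A ∣ ≡ suc τ
      × LeRootPow (ℕtoℚ (n C (2 + ρ)) -ᵠ ℕtoℚ (linkSize F A)) (ℕtoℚ (2 + ρ) *ᵠ (K +ᵠ ℕtoℚ (2 * (s * s)))) n (expNum (3 + ρ) (2 + τ)) (βden (3 + ρ) (2 + τ))
      × LeRootPow (ℕtoℚ (badCount F A)) ((ℕtoℚ (suc τ * (2 + ρ)) *ᵠ (K +ᵠ ℕtoℚ (2 * (s * s)))) +ᵠ ℕtoℚ (2 * (s * s))) n (expNum (3 + ρ) (2 + τ)) (βden (3 + ρ) (2 + τ)))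
  from-parameter (q , 1≤q , root , small) = from-stable root
    (Conclusion.stable H H-graph T tree reducible H⊆T X₀ cut ∣X₀∣ F F-graph free (threshold⇒2s≤ {s} {ρ} large) q 1≤q small
      (suc τ * (n C (2 + ρ)) ∸ length F)
      (subst (λ L → suc τ * L ≤ length F + (suc τ * (n C (2 + ρ)) ∸ length F)) (sym (layer≡C n (2 + ρ))) (m≤n+m∸n (suc τ * (n C (2 + ρ))) (length F))))

theorem4p2 : ∀ (r s : ℕ) → 4 ≤ r →
    ∃[ n₀ ]
    (∀ (H : List (Subset s)) → IsRGraph r H →
    (∃[ t ] ∃[ T ] (IsRTree {t} r T × TwoReducible T × Embeds H T)) →
    ∀ (σ : ℕ) → IsCrossCutNumber H σ → 2 ≤ σ →
    ∀ (n : ℕ) → n₀ ≤ n →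
    ∀ (K : ℚ) → 0ℚ ≤ᵠ K →
    ∀ (F : List (Subset n)) → IsRGraph r F → ¬ Embeds H F →
    LeRootPow (ℕtoℚ ((σ ∸ 1) * (n C (r ∸ 1))) -ᵠ ℕtoℚ (length F))
    K n (expNum r σ) (βden r σ) →
    ∃[ A ] (∣ A ∣ ≡ σ ∸ 1
    × LeRootPow (ℕtoℚ (n C (r ∸ 1)) -ᵠ ℕtoℚ (linkSize F A))
    (ℕtoℚ (r ∸ 1) *ᵠ (K +ᵠ ℕtoℚ (2 * (s * s))))
    n (expNum r σ) (βden r σ)
    × LeRootPow (ℕtoℚ (badCount F A))
    ((ℕtoℚ ((σ ∸ 1) * (r ∸ 1)) *ᵠ (K +ᵠ ℕtoℚ (2 * (s * s))))
    +ᵠ ℕtoℚ (2 * (s * s)))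
    n (expNum r σ) (βden r σ)))
theorem4p2 (suc (suc (suc ρ))) s (s≤s (s≤s (s≤s _))) = threshold s ρ ,
  λ { H H-graph (t , T , tree , reducible , H⊆T) (suc (suc τ)) ((X₀ , cut , ∣X₀∣) , _) (s≤s (s≤s _)) n large K 0≤K F F-graph free dense →
      stability H H-graph T tree reducible H⊆T X₀ cut ∣X₀∣ large K 0≤K F F-graph free dense }
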